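{- Let $SD_{16}=\langle X,Y \mid X^8=Y^2=1,\ YXY=X^3\rangle$ be the semidihedral group of order 16. The even integers that occur as integer group determinants of $SD_{16}$ are exactly the multiples of $2^{10}$. The odd integers that occur as integer group determinants of $SD_{16}$ are exactly the integers $n\equiv 1 \pmod 8$ together with those integers $n\equiv 5\pmod 8$ of the form $n=mp^2$ where $m\equiv 5\pmod 8$ is an integer and $p$ is a prime with $p\equiv 3\pmod 8$.
   Context: For a finite group $G$, the group determinant of an element $\sum_{g\in G} a_g g$ of the group ring $\mathbb{Z}[G]$ is $\mathcal{D}_G\left(\sum_{g\in G} a_g g\right)=\det\left(a_{gh^{ -1}}\right)_{g,h\in G}$. An integer group determinant of $G$ is a value of $\mathcal{D}_G$ at an element of $\mathbb{Z}[G]$, i.e. with all $a_g\in\mathbb{Z}$. -}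

module Defs where

open import Data.Nat as ℕ using (ℕ; zero; suc; _%_; _/_; _∸_)
open import Data.Nat.DivMod using (_mod_)
open import Data.Fin using (Fin; zero; suc; toℕ; punchIn)
open import Data.Integer using (ℤ; +_; -_; _+_; _*_; 1ℤ; 0ℤ)
open import Data.Product using (∃)
open import Relation.Binary.PropositionalEquality using (_≡_)

sign : ℕ → ℤ
sign zero = 1ℤ
sign (suc k) = - sign k

ΣFin : (n : ℕ) → (Fin n → ℤ) → ℤ
ΣFin zero f = 0ℤ
ΣFin (suc n) f = f zero + ΣFin n (λ i → f (suc i))

det : (n : ℕ) → (Fin n → Fin n → ℤ) → ℤ
det zero M = 1ℤ
det (suc n) M =
  ΣFin (suc n) (λ j → sign (toℕ j) * (M zero j * det n (λ r c → M (suc r) (punchIn j c))))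

-- SD16 = ⟨X,Y | X^8 = Y^2 = 1, YXY = X^3⟩.  Every element is uniquely X^a Y^b
-- (0 ≤ a < 8, 0 ≤ b < 2); it is encoded by the index a + 8 b ∈ {0,…,15}.
-- Since Y X = X^3 Y:  (X^a Y^b)(X^c Y^d) = X^(a + 3^b c) Y^(b+d),
-- and (X^a Y^b)⁻¹ = Y^b X^(-a) = X^(-3^b a) Y^b.
xPart yPart : ℕ → ℕ
xPart g = g % 8
yPart g = g / 8

sdMul : ℕ → ℕ → ℕ
sdMul g h = (xPart g ℕ.+ (3 ℕ.^ yPart g) ℕ.* xPart h) % 8 ℕ.+ 8 ℕ.* ((yPart g ℕ.+ yPart h) % 2)

sdInv : ℕ → ℕ
sdInv g = ((3 ℕ.^ yPart g) ℕ.* (8 ∸ xPart g)) % 8 ℕ.+ 8 ℕ.* yPart g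

SD16 : Set
SD16 = Fin 16

_·_ : SD16 → SD16 → SD16
g · h = sdMul (toℕ g) (toℕ h) mod 16

_⁻¹ : SD16 → SD16
g ⁻¹ = sdInv (toℕ g) mod 16

groupDet : (SD16 → ℤ) → ℤ
groupDet a = det 16 (λ g h → a (g · (h ⁻¹)))

IsIntGroupDet : ℤ → Set
IsIntGroupDet n = ∃ λ (a : SD16 → ℤ) → groupDet a ≡ n

{-# OPTIONS --safe #-}
module Submission where

-- Write an element of ℤ[SD₁₆] as f(X) + g(X) Y.  Its matrix has the shape [[F, G], [G, F]], and
-- splitting off first Y, then X⁴, gives
--   D = (f(1)² - g(1)²) (f(-1)² - g(-1)²) (|f(i)|² - |g(i)|²)² (c² + 2 d²)²,
-- where f(ζ) f(ζ³) - g(ζ) g(ζ³) = c + d √-2 for a primitive eighth root of unity ζ.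
--
-- The factors are linked modulo 2 and 4 through the sums of the even and of the odd coefficients
-- of f and g.  Their parities show that D is divisible by 2¹⁰, or D ≡ 1 (mod 8), or D ≡ 5 (mod 8)
-- with c and d odd.  In the last case c² + 2 d² ≡ 3 (mod 8); after division by gcd(c, d)² it
-- divides some x² + 2, whose divisors are all of the form a² + 2 b² by reduction of binary forms.
-- Hence its odd divisors are 1 or 3 modulo 8, so that a prime p ≡ 3 (mod 8) divides it.
--
-- Conversely, for f = 1 + g explicit g realise 8k + 1 and (8k + 5) p², the latter from
-- p = a² + 2 b².  This representation exists because 2^((p-1)/2) ≡ ±1 (mod p): the sign + would make
-- 2 a square modulo p, which a descent forbids for p ≡ 3 (mod 8), and the sign - makes -2 a square.

open import Defs
open import Data.Empty using (⊥; ⊥-elim)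
open import Data.Fin using (Fin; zero; suc; toℕ; punchIn; inject₁; splitAt; _↑ˡ_; _↑ʳ_; #_)
open import Data.Fin.Patterns
import Data.Fin.Properties as Fin
open import Data.Integer using (ℤ; +_; -[1+_]; -_; _+_; _-_; _*_; ∣_∣; 0ℤ; 1ℤ; -1ℤ)
import Data.Integer.DivMod as ℤ
open import Data.Integer.Divisibility using (_∣_)
import Data.Integer.Divisibility.Signed as Signed
import Data.Integer.Properties as ℤ
open import Data.Integer.Solver using (module +-*-Solver)
open import Data.Integer.Tactic.RingSolver using (solve-∀)
open import Data.List using ([]; _∷_)
open import Data.List.Relation.Unary.All using (All; []; _∷_)
open import Data.Nat as ℕ using (ℕ; zero; suc; s≤s; z≤n; _%_; NonZero)
open import Data.Nat.Combinatorics using (nCn≡1; nC1≡n; nCk≡nC[n∸k]; k>n⇒nCk≡0; nCk+nC[k+1]≡[n+1]C[k+1]) renaming (_C_ to infixl 6.5 _choose_)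
import Data.Nat.DivMod as ℕ
open import Data.Nat.DivMod using (_mod_)
open import Data.Nat.Divisibility as ℕ using (divides)
open import Data.Nat.GCD using (module GCD; module Bézout)
open import Data.Nat.Induction using (<-rec)
open import Data.Nat.ListAction using (product)
open import Data.Nat.Primality using (Prime; euclidsLemma)
open import Data.Nat.Primality.Factorisation using (PrimeFactorisation; factorise)
import Data.Nat.Properties as ℕ
import Data.Nat.Tactic.RingSolver as ℕ-Solver
open import Data.Product using (_×_; ∃; ∃-syntax; _,_; proj₁; proj₂)
open import Data.Sum using (_⊎_; inj₁; inj₂)
open import Data.Unit using (tt)
open import Data.Vec as Vec using (Vec; []; _∷_)
open import Data.Vec.Functional using (Vector; updateAt; insertAt; _++_) renaming ([] to ⟨⟩; _∷_ to infixr 5 _◂_)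
import Data.Vec.Functional.Properties as FVec
open import Function using (_∘_; const)
open import Function.Bundles using (_⇔_; mk⇔)
open import Relation.Binary.PropositionalEquality using (_≡_; _≢_; refl; sym; trans; cong; cong₂; subst; module ≡-Reasoning)
open import Relation.Nullary using (¬_; yes; no; contradiction)
open import Relation.Nullary.Decidable using (toWitness)
open +-*-Solver using (Polynomial; con; var; _:+_; _:*_; _:-_; :-_; prove; normalise; ⟦_⟧; ⟦_⟧N)

-- Determinants

-- `det` expands along the first row, so a 16 × 16 determinant can be neither evaluated nor
-- normalised as a polynomial. The splittings are therefore derived from one abstract fact: an
-- alternating multilinear function of the rows is its value at the identity matrix times `det`.
-- Multiplicativity and invariance under similarity follow, and only two kinds of 4 × 4 blocks are
-- left to the ring solver. The two halves that Y splits off differ by g ↦ -g. The quantities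
-- |f(i)|² - |g(i)|² and c + d √-2 are quadratic in g and do not change, which is why they enter D
-- squared, whereas the linear factors pair up to f(±1)² - g(±1)². The residue 5 modulo 8 arises
-- only if, for one of f and g, both coefficient sums are odd, and for the other exactly one is.
-- Modulo 2, d is the difference of the products of the two sums, hence odd; c is odd together with
-- f(1)² - g(1)². The oddness of both is what forces a prime p ≡ 3 (mod 8), and N² then contributes
-- p².

Row : ℕ → Set
Row n = Fin n → ℤ

Matrix : ℕ → Set
Matrix n = Fin n → Row n

infix 4 _≋_

_≋_ : ∀ {m n} (M N : Fin m → Row n) → Set
M ≋ N = ∀ i j → M i j ≡ N i j

Σ-cong : ∀ n {f g : Row n} → (∀ i → f i ≡ g i) → ΣFin n f ≡ ΣFin n g
Σ-cong zero    f≗g = refl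
Σ-cong (suc n) f≗g = cong₂ _+_ (f≗g zero) (Σ-cong n (f≗g ∘ suc))

Σ-zero : ∀ n {f : Row n} → (∀ i → f i ≡ 0ℤ) → ΣFin n f ≡ 0ℤ
Σ-zero zero    f≗0 = refl
Σ-zero (suc n) f≗0 = cong₂ _+_ (f≗0 zero) (Σ-zero n (f≗0 ∘ suc))

Σ-linear : ∀ n c {f g h : Row n} → (∀ i → h i ≡ f i + c * g i) → ΣFin n h ≡ ΣFin n f + c * ΣFin n g
Σ-linear zero    c eq = sym (trans (ℤ.+-identityˡ _) (ℤ.*-zeroʳ c))
Σ-linear (suc n) c {f} {g} eq =
  trans (cong₂ _+_ (eq zero) (Σ-linear n c (eq ∘ suc)))
        (rearrange c (f zero) (g zero) (ΣFin n (f ∘ suc)) (ΣFin n (g ∘ suc)))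
  where
  rearrange : ∀ c x y X Y → (x + c * y) + (X + c * Y) ≡ (x + X) + c * (y + Y)
  rearrange = solve-∀

Σ-*ˡ : ∀ n c (f : Row n) → ΣFin n (λ i → c * f i) ≡ c * ΣFin n f
Σ-*ˡ zero    c f = sym (ℤ.*-zeroʳ c)
Σ-*ˡ (suc n) c f = trans (cong (_+_ (c * f zero)) (Σ-*ˡ n c (f ∘ suc))) (sym (ℤ.*-distribˡ-+ c _ _))

Σ-*ʳ : ∀ n c (f : Row n) → ΣFin n (λ i → f i * c) ≡ ΣFin n f * c
Σ-*ʳ n c f = trans (Σ-cong n λ i → ℤ.*-comm (f i) c) (trans (Σ-*ˡ n c f) (ℤ.*-comm c _))

Σ-split : ∀ m n (f : Row (m ℕ.+ n)) →
  ΣFin (m ℕ.+ n) f ≡ ΣFin m (λ i → f (i ↑ˡ n)) + ΣFin n (λ j → f (m ↑ʳ j))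
Σ-split zero    n f = sym (ℤ.+-identityˡ _)
Σ-split (suc m) n f = trans (cong (_+_ (f zero)) (Σ-split m n (f ∘ suc))) (sym (ℤ.+-assoc (f zero) _ _))

δ : ∀ {n} → Matrix n
δ zero    zero    = 1ℤ
δ zero    (suc j) = 0ℤ
δ (suc i) zero    = 0ℤ
δ (suc i) (suc j) = δ i j

δ-diag : ∀ {n} (i : Fin n) → δ i i ≡ 1ℤ
δ-diag zero    = refl
δ-diag (suc i) = δ-diag i

δ-punchIn-left : ∀ {n} (j : Fin (suc n)) k → δ (punchIn j k) j ≡ 0ℤ
δ-punchIn-left zero    k       = refl
δ-punchIn-left (suc j) zero    = refl
δ-punchIn-left (suc j) (suc k) = δ-punchIn-left j k

δ-punchIn-right : ∀ {n} (j : Fin (suc n)) k → δ j (punchIn j k) ≡ 0ℤ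
δ-punchIn-right zero    k       = refl
δ-punchIn-right (suc j) zero    = refl
δ-punchIn-right (suc j) (suc k) = δ-punchIn-right j k

δ-punchIn : ∀ {n} (j : Fin (suc n)) k l → δ (punchIn j k) (punchIn j l) ≡ δ k l
δ-punchIn zero    k       l       = refl
δ-punchIn (suc j) zero    zero    = refl
δ-punchIn (suc j) zero    (suc l) = refl
δ-punchIn (suc j) (suc k) zero    = refl
δ-punchIn (suc j) (suc k) (suc l) = δ-punchIn j k l

δ-↑ˡ-↑ˡ : ∀ {m} n (i j : Fin m) → δ (i ↑ˡ n) (j ↑ˡ n) ≡ δ i j
δ-↑ˡ-↑ˡ n zero    zero    = refl
δ-↑ˡ-↑ˡ n zero    (suc j) = refl
δ-↑ˡ-↑ˡ n (suc i) zero    = refl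
δ-↑ˡ-↑ˡ n (suc i) (suc j) = δ-↑ˡ-↑ˡ n i j

δ-↑ʳ-↑ʳ : ∀ m {n} (i j : Fin n) → δ (m ↑ʳ i) (m ↑ʳ j) ≡ δ i j
δ-↑ʳ-↑ʳ zero    i j = refl
δ-↑ʳ-↑ʳ (suc m) i j = δ-↑ʳ-↑ʳ m i j

δ-↑ˡ-↑ʳ : ∀ {m n} (i : Fin m) (j : Fin n) → δ (i ↑ˡ n) (m ↑ʳ j) ≡ 0ℤ
δ-↑ˡ-↑ʳ zero    j = refl
δ-↑ˡ-↑ʳ (suc i) j = δ-↑ˡ-↑ʳ i j

δ-↑ʳ-↑ˡ : ∀ {m n} (i : Fin m) (j : Fin n) → δ (m ↑ʳ j) (i ↑ˡ n) ≡ 0ℤ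
δ-↑ʳ-↑ˡ zero    j = refl
δ-↑ʳ-↑ˡ (suc i) j = δ-↑ʳ-↑ˡ i j

Σ-δˡ : ∀ n (i : Fin n) (f : Row n) → ΣFin n (λ k → δ i k * f k) ≡ f i
Σ-δˡ (suc n) zero    f = trans (cong₂ _+_ (ℤ.*-identityˡ (f zero)) (Σ-zero n λ k → refl)) (ℤ.+-identityʳ _)
Σ-δˡ (suc n) (suc i) f = trans (ℤ.+-identityˡ _) (Σ-δˡ n i (f ∘ suc))

Σ-δʳ : ∀ n (j : Fin n) (f : Row n) → ΣFin n (λ k → f k * δ k j) ≡ f j
Σ-δʳ (suc n) zero    f = trans (cong₂ _+_ (ℤ.*-identityʳ (f zero)) (Σ-zero n λ k → ℤ.*-zeroʳ (f (suc k)))) (ℤ.+-identityʳ _)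
Σ-δʳ (suc n) (suc j) f =
  trans (cong (_+ ΣFin n (λ k → f (suc k) * δ k j)) (ℤ.*-zeroʳ (f zero)))
        (trans (ℤ.+-identityˡ _) (Σ-δʳ n j (f ∘ suc)))

-- One law covers additivity (c = 1) and the vanishing on a zero row (c = -1). Matrices are
-- functions without extensionality, so `D-cong` has to be an axiom as well.
record IsAlternating n (D : Matrix n → ℤ) : Set where
  field
    D-cong : ∀ {M N} → M ≋ N → D M ≡ D N
    linear : ∀ i c {L M N} →
      (∀ k → k ≢ i → ∀ j → L k j ≡ M k j) →
      (∀ k → k ≢ i → ∀ j → L k j ≡ N k j) →
      (∀ j → L i j ≡ M i j + c * N i j) →
      D L ≡ D M + c * D N
    alternating : ∀ {i k} M → i ≢ k → (∀ j → M i j ≡ M k j) → D M ≡ 0ℤ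

minor : ∀ {n} → Matrix (suc n) → Fin (suc n) → Matrix n
minor M j r c = M (suc r) (punchIn j c)

cofactor : ∀ {n} → Matrix (suc n) → Row (suc n)
cofactor {n} M j = sign (toℕ j) * (M zero j * det n (minor M j))

det-cong : ∀ n {M N} → M ≋ N → det n M ≡ det n N
det-cong zero    eq = refl
det-cong (suc n) eq = Σ-cong (suc n) λ j →
  cong (sign (toℕ j) *_) (cong₂ _*_ (eq zero j) (det-cong n λ r c → eq (suc r) (punchIn j c)))

det-linear : ∀ n i c {L M N} →
  (∀ k → k ≢ i → ∀ j → L k j ≡ M k j) →
  (∀ k → k ≢ i → ∀ j → L k j ≡ N k j) →
  (∀ j → L i j ≡ M i j + c * N i j) →
  det n L ≡ det n M + c * det n N
det-linear (suc n) zero c {L} {M} {N} offM offN at = Σ-linear (suc n) c {cofactor M} {cofactor N} term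
  where
  expand : ∀ c s x y d → s * ((x + c * y) * d) ≡ s * (x * d) + c * (s * (y * d))
  expand = solve-∀
  term : ∀ j → cofactor L j ≡ cofactor M j + c * cofactor N j
  term j = begin
    cofactor L j
      ≡⟨ cong (λ l → sign (toℕ j) * (l * det n (minor L j))) (at j) ⟩
    sign (toℕ j) * ((M zero j + c * N zero j) * det n (minor L j))
      ≡⟨ expand c (sign (toℕ j)) (M zero j) (N zero j) (det n (minor L j)) ⟩
    sign (toℕ j) * (M zero j * det n (minor L j)) + c * (sign (toℕ j) * (N zero j * det n (minor L j)))
      ≡⟨ cong₂ (λ d e → sign (toℕ j) * (M zero j * d) + c * (sign (toℕ j) * (N zero j * e)))
               (det-cong n λ r k → offM (suc r) (λ ()) (punchIn j k))
               (det-cong n λ r k → offN (suc r) (λ ()) (punchIn j k)) ⟩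
    cofactor M j + c * cofactor N j ∎
    where open ≡-Reasoning
det-linear (suc n) (suc i) c {L} {M} {N} offM offN at = Σ-linear (suc n) c {cofactor M} {cofactor N} term
  where
  expand : ∀ c s x d e → s * (x * (d + c * e)) ≡ s * (x * d) + c * (s * (x * e))
  expand = solve-∀
  term : ∀ j → cofactor L j ≡ cofactor M j + c * cofactor N j
  term j = begin
    cofactor L j
      ≡⟨ cong (λ d → sign (toℕ j) * (L zero j * d))
              (det-linear n i c (λ k k≢i l → offM (suc k) (k≢i ∘ Fin.suc-injective) (punchIn j l))
                                (λ k k≢i l → offN (suc k) (k≢i ∘ Fin.suc-injective) (punchIn j l))
                                (at ∘ punchIn j)) ⟩
    sign (toℕ j) * (L zero j * (det n (minor M j) + c * det n (minor N j)))
      ≡⟨ expand c (sign (toℕ j)) (L zero j) (det n (minor M j)) (det n (minor N j)) ⟩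
    sign (toℕ j) * (L zero j * det n (minor M j)) + c * (sign (toℕ j) * (L zero j * det n (minor N j)))
      ≡⟨ cong₂ (λ x y → sign (toℕ j) * (x * det n (minor M j)) + c * (sign (toℕ j) * (y * det n (minor N j))))
               (offM zero (λ ()) j) (offN zero (λ ()) j) ⟩
    cofactor M j + c * cofactor N j ∎
    where open ≡-Reasoning

liftColumns : ∀ {m n} → (Fin m → Fin n) → Fin (suc m) → Fin (suc n)
liftColumns φ zero    = zero
liftColumns φ (suc c) = suc (φ c)

-- The expansion along the first two rows x and y; W is the minor of the remaining rows,
-- as a function of the columns it uses.
doubleExpansion : ∀ n → ((Fin n → Fin (suc (suc n))) → ℤ) → (x y : Row (suc (suc n))) → ℤ
doubleExpansion n W x y = ΣFin (suc (suc n)) λ j → sign (toℕ j) * (x j *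
  ΣFin (suc n) λ k → sign (toℕ k) * (y (punchIn j k) * W (punchIn j ∘ punchIn k)))

-- The terms in which x or y uses column 0 cancel between the two orders. In the others column 0 is
-- left to `W`, so they form a double expansion with one column fewer, for `W ∘ liftColumns`; the
-- induction runs through `both-antisym`.
doubleExpansion-antisym : ∀ n (W : (Fin n → Fin (suc (suc n))) → ℤ) →
  (∀ {φ ψ} → (∀ c → φ c ≡ ψ c) → W φ ≡ W ψ) →
  ∀ x y → doubleExpansion n W x y + doubleExpansion n W y x ≡ 0ℤ
doubleExpansion-antisym n W W-cong x y =
  trans (cong₂ _+_ (split x y) (split y x))
        (trans (regroup (x zero) (cross y) (y zero) (cross x) (both n W x y) (both n W y x)) (both-antisym n W W-cong x y))
  where
  cross : Row (suc (suc n)) → ℤ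
  cross y = ΣFin (suc n) λ k → sign (toℕ k) * (y (suc k) * W (suc ∘ punchIn k))

  bothTerm : ∀ n → ((Fin n → Fin (suc (suc n))) → ℤ) → (x y : Row (suc (suc n))) → Row (suc n)
  bothTerm n W x y j = sign (toℕ j) * (x (suc j) *
    ΣFin n λ k → sign (toℕ k) * (y (suc (punchIn j k)) * W (punchIn (suc j) ∘ punchIn (suc k))))

  both : ∀ n → ((Fin n → Fin (suc (suc n))) → ℤ) → (x y : Row (suc (suc n))) → ℤ
  both n W x y = ΣFin (suc n) (bothTerm n W x y)

  split : ∀ x y → doubleExpansion n W x y ≡ x zero * cross y + (both n W x y + - y zero * cross x)
  split x y = cong₂ _+_ (ℤ.*-identityˡ (x zero * cross y))
    (Σ-linear (suc n) (- y zero) {bothTerm n W x y} {λ k → sign (toℕ k) * (x (suc k) * W (suc ∘ punchIn k))} term)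
    where
    negate : ∀ s z → - s * z ≡ -1ℤ * (s * z)
    negate = solve-∀
    rearrange : ∀ s x y w z → - s * (x * (1ℤ * (y * w) + -1ℤ * z)) ≡ s * (x * z) + - y * (s * (x * w))
    rearrange = solve-∀
    term : ∀ j → sign (toℕ (suc j)) * (x (suc j) * ΣFin (suc n) (λ k → sign (toℕ k) * (y (punchIn (suc j) k) * W (punchIn (suc j) ∘ punchIn k))))
               ≡ bothTerm n W x y j + - y zero * (sign (toℕ j) * (x (suc j) * W (suc ∘ punchIn j)))
    term j = trans
      (cong (λ z → - sign (toℕ j) * (x (suc j) * (1ℤ * (y zero * W (suc ∘ punchIn j)) + z)))
            (trans (Σ-cong n λ k → negate (sign (toℕ k)) (y (suc (punchIn j k)) * W (punchIn (suc j) ∘ punchIn (suc k))))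
                   (Σ-*ˡ n -1ℤ (λ k → sign (toℕ k) * (y (suc (punchIn j k)) * W (punchIn (suc j) ∘ punchIn (suc k)))))))
      (rearrange (sign (toℕ j)) (x (suc j)) (y zero) (W (suc ∘ punchIn j))
                 (ΣFin n λ k → sign (toℕ k) * (y (suc (punchIn j k)) * W (punchIn (suc j) ∘ punchIn (suc k)))))

  regroup : ∀ p q p′ q′ r s → (p * q + (r + - p′ * q′)) + (p′ * q′ + (s + - p * q)) ≡ r + s
  regroup = solve-∀

  both-antisym : ∀ n (W : (Fin n → Fin (suc (suc n))) → ℤ) → (∀ {φ ψ} → (∀ c → φ c ≡ ψ c) → W φ ≡ W ψ) →
    ∀ x y → both n W x y + both n W y x ≡ 0ℤ
  both-antisym zero    W W-cong x y = vanish (x (suc zero)) (y (suc zero))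
    where
    vanish : ∀ a b → (1ℤ * (a * 0ℤ) + 0ℤ) + (1ℤ * (b * 0ℤ) + 0ℤ) ≡ 0ℤ
    vanish = solve-∀
  both-antisym (suc n) W W-cong x y =
    trans (cong₂ _+_ (lower x y) (lower y x))
          (doubleExpansion-antisym n (W ∘ liftColumns) (λ eq → W-cong λ { zero → refl ; (suc c) → cong suc (eq c) }) (x ∘ suc) (y ∘ suc))
    where
    lower : ∀ x y → both (suc n) W x y ≡ doubleExpansion n (W ∘ liftColumns) (x ∘ suc) (y ∘ suc)
    lower x y = Σ-cong (suc (suc n)) λ j → cong (λ z → sign (toℕ j) * (x (suc j) * z)) (Σ-cong (suc n) λ k →
      cong (λ w → sign (toℕ k) * (y (suc (punchIn j k)) * w))
           (W-cong {punchIn (suc j) ∘ punchIn (suc k)} {liftColumns (punchIn j ∘ punchIn k)} λ { zero → refl ; (suc c) → refl }))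

swap₀₁ : ∀ {n} {A : Set} → Vector A (suc (suc n)) → Vector A (suc (suc n))
swap₀₁ M zero          = M (suc zero)
swap₀₁ M (suc zero)    = M zero
swap₀₁ M (suc (suc i)) = M (suc (suc i))

det-swap₀₁ : ∀ n M → det (suc (suc n)) M + det (suc (suc n)) (swap₀₁ M) ≡ 0ℤ
det-swap₀₁ n M = doubleExpansion-antisym n (λ φ → det n (λ r c → M (suc (suc r)) (φ c)))
  (λ eq → det-cong n λ r c → cong (M (suc (suc r))) (eq c)) (M zero) (M (suc zero))

cofactor-zero : ∀ {n} (M : Matrix (suc n)) → (∀ j → det n (minor M j) ≡ 0ℤ) → det (suc n) M ≡ 0ℤ
cofactor-zero {n} M eq = Σ-zero (suc n) λ j →
  trans (cong (λ d → sign (toℕ j) * (M zero j * d)) (eq j)) (vanish (sign (toℕ j)) (M zero j))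
  where
  vanish : ∀ s x → s * (x * 0ℤ) ≡ 0ℤ
  vanish = solve-∀

x+y≡0∧y≡0⇒x≡0 : ∀ {x y} → x + y ≡ 0ℤ → y ≡ 0ℤ → x ≡ 0ℤ
x+y≡0∧y≡0⇒x≡0 {x} x+y≡0 refl = trans (sym (ℤ.+-identityʳ x)) x+y≡0

x+y≡0∧y≡x⇒x≡0 : ∀ {x y} → x + y ≡ 0ℤ → y ≡ x → x ≡ 0ℤ
x+y≡0∧y≡x⇒x≡0 {x} x+x≡0 refl = ℤ.*-cancelˡ-≡ (+ 2) x 0ℤ (trans (double x) x+x≡0)
  where
  double : ∀ i → + 2 * i ≡ i + i
  double = solve-∀

-- If the equal rows are the first two, the swap gives 2 det = 0. Otherwise the swap moves row 0 to
-- row 1, and then every minor along the new row 0 contains both equal rows.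
det-alternating₀ : ∀ n k (M : Matrix (suc n)) → (∀ j → M zero j ≡ M (suc k) j) → det (suc n) M ≡ 0ℤ
det-alternating₀ (suc n) zero M eq =
  x+y≡0∧y≡x⇒x≡0 (det-swap₀₁ n M) (det-cong (suc (suc n)) {swap₀₁ M} {M} swapped)
  where
  swapped : swap₀₁ M ≋ M
  swapped zero          j = sym (eq j)
  swapped (suc zero)    j = eq j
  swapped (suc (suc i)) j = refl
det-alternating₀ (suc n) (suc k) M eq = x+y≡0∧y≡0⇒x≡0 (det-swap₀₁ n M) swapped
  where
  swapped : det (suc (suc n)) (swap₀₁ M) ≡ 0ℤ
  swapped = cofactor-zero (swap₀₁ M) λ j → det-alternating₀ n k (minor (swap₀₁ M) j) (λ l → eq (punchIn j l))

det-alternating : ∀ n i k M → i ≢ k → (∀ j → M i j ≡ M k j) → det n M ≡ 0ℤ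
det-alternating (suc n) zero    zero    M i≢k eq = contradiction refl i≢k
det-alternating (suc n) zero    (suc k) M i≢k eq = det-alternating₀ n k M eq
det-alternating (suc n) (suc i) zero    M i≢k eq = det-alternating₀ n i M (sym ∘ eq)
det-alternating (suc n) (suc i) (suc k) M i≢k eq =
  cofactor-zero M λ j → det-alternating n i k (minor M j) (i≢k ∘ cong suc) (eq ∘ punchIn j)

det-δ : ∀ n → det n δ ≡ 1ℤ
det-δ zero    = refl
det-δ (suc n) = trans (cong₂ _+_ (trans (ℤ.*-identityˡ _) (trans (ℤ.*-identityˡ _) (det-δ n)))
                                 (Σ-zero n λ j → ℤ.*-zeroʳ (- sign (toℕ j)))) refl

-- Uniqueness of alternating forms

punchIn-elim : ∀ {n} (j : Fin (suc n)) (P : Fin (suc n) → Set) → P j → (∀ k → P (punchIn j k)) → ∀ c → P c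
punchIn-elim j P pj pk c with j Fin.≟ c
... | yes refl = pj
... | no j≢c   = subst P (Fin.punchIn-punchOut j≢c) (pk _)

insertZero : ∀ {n} → Fin (suc n) → Row n → Row (suc n)
insertZero j r = insertAt r j 0ℤ

-- One row is changed at a time. `G` is an arbitrary function of the rows so that the recursion can
-- hold the first row fixed while it treats the others.
row-shift : ∀ {w} n (e : Row w) (G : (Fin n → Row w) → ℤ) →
  (∀ {M N} → M ≋ N → G M ≡ G N) →
  (∀ i c {M N} → (∀ k → k ≢ i → ∀ j → N k j ≡ M k j) → (∀ j → N i j ≡ M i j + c * e j) → G N ≡ G M) →
  ∀ (c : Row n) {M N} → (∀ i j → N i j ≡ M i j + c i * e j) → G N ≡ G M
row-shift zero    e G G-cong step c eq = G-cong λ ()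
row-shift (suc n) e G G-cong step c {M} {N} eq = begin
  G N                       ≡⟨ G-cong (λ { zero j → refl ; (suc i) j → refl }) ⟩
  G (N zero ◂ N ∘ suc)      ≡⟨ row-shift n e (λ K → G (N zero ◂ K)) tail-cong tail-step (c ∘ suc) (eq ∘ suc) ⟩
  G (N zero ◂ M ∘ suc)      ≡⟨ step zero (c zero) off-zero (eq zero) ⟩
  G M                       ∎
  where
  open ≡-Reasoning
  tail-cong : ∀ {K L} → K ≋ L → G (N zero ◂ K) ≡ G (N zero ◂ L)
  tail-cong K≋L = G-cong λ { zero j → refl ; (suc i) j → K≋L i j }
  tail-step : ∀ i c {K L} → (∀ k → k ≢ i → ∀ j → L k j ≡ K k j) → (∀ j → L i j ≡ K i j + c * e j) →
              G (N zero ◂ L) ≡ G (N zero ◂ K)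
  tail-step i c off at = step (suc i) c
    (λ { zero _ j → refl ; (suc k) k≢i j → off k (k≢i ∘ cong suc) j }) at
  off-zero : ∀ k → k ≢ zero → ∀ j → (N zero ◂ M ∘ suc) k j ≡ M k j
  off-zero zero    0≢0 = contradiction refl 0≢0
  off-zero (suc k) _ j = refl

module Alternating {n} {D : Matrix n → ℤ} (alt : IsAlternating n D) where
  open IsAlternating alt public

  zero-row : ∀ i {M} → (∀ j → M i j ≡ 0ℤ) → D M ≡ 0ℤ
  zero-row i {M} M≡0 = trans (linear i -1ℤ {M} {M} {M} (λ _ _ _ → refl) (λ _ _ _ → refl)
    (λ j → trans (M≡0 j) (sym (cong (λ x → x + -1ℤ * x) (M≡0 j))))) (cancel (D M))
    where
    cancel : ∀ x → x + -1ℤ * x ≡ 0ℤ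
    cancel = solve-∀

  additive : ∀ i {L M N} →
    (∀ k → k ≢ i → ∀ j → L k j ≡ M k j) → (∀ k → k ≢ i → ∀ j → L k j ≡ N k j) →
    (∀ j → L i j ≡ M i j + N i j) → D L ≡ D M + D N
  additive i {L} {M} {N} offM offN at = trans (linear i 1ℤ offM offN λ j → trans (at j) (cong (_+_ (M i j)) (sym (ℤ.*-identityˡ _))))
    (cong (_+_ (D M)) (ℤ.*-identityˡ _))

  add-row : ∀ i k c {M N} → i ≢ k → (∀ l → l ≢ i → ∀ j → N l j ≡ M l j) →
            (∀ j → N i j ≡ M i j + c * M k j) → D N ≡ D M
  add-row i k c {M} {N} i≢k off at = begin
    D N                  ≡⟨ linear i c off offK atK ⟩
    D M + c * D K        ≡⟨ cong (λ d → D M + c * d) (alternating K i≢k λ j → cong (λ r → r j) (trans Ki (sym Kk))) ⟩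
    D M + c * 0ℤ         ≡⟨ cong (_+_ (D M)) (ℤ.*-zeroʳ c) ⟩
    D M + 0ℤ             ≡⟨ ℤ.+-identityʳ _ ⟩
    D M                  ∎
    where
    open ≡-Reasoning
    K : Matrix n
    K = updateAt M i (const (M k))
    Ki : K i ≡ M k
    Ki = FVec.updateAt-updates i M
    Kk : K k ≡ M k
    Kk = FVec.updateAt-minimal k i M (i≢k ∘ sym)
    offK : ∀ l → l ≢ i → ∀ j → N l j ≡ K l j
    offK l l≢i j = trans (off l l≢i j) (cong (λ r → r j) (sym (FVec.updateAt-minimal l i M l≢i)))
    atK : ∀ j → N i j ≡ M i j + c * K i j
    atK j = trans (at j) (cong (λ r → M i j + c * r j) (sym Ki))

  -- Polarisation: `f u+v u+v`, `f u u` and `f v v` vanish, so expanding the first leaves `f u v` +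
  -- `f v u` = 0.
  swap-rows : ∀ i k {M N} → i ≢ k → (∀ j → N i j ≡ M k j) → (∀ j → N k j ≡ M i j) →
              (∀ l → l ≢ i → l ≢ k → ∀ j → N l j ≡ M l j) → D N ≡ - D M
  swap-rows i k {M} {N} i≢k Ni Nk off = begin
    D N                          ≡⟨ D-cong N≋ ⟩
    f v u                        ≡⟨ isolate (f u u) (f u v) (f v u) (f v v) ⟩
    ((f u u + f u v) + (f v u + f v v)) - f u u - f v v - f u v
                                 ≡⟨ cong (λ z → z - f u u - f v v - f u v) expand ⟨
    f u+v u+v - f u u - f v v - f u v
                                 ≡⟨ cong₂ (λ y z → y - z - f v v - f u v) (f-diag u+v) (f-diag u) ⟩
    0ℤ - 0ℤ - f v v - f u v      ≡⟨ cong (λ z → 0ℤ - 0ℤ - z - f u v) (f-diag v) ⟩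
    0ℤ - 0ℤ - 0ℤ - f u v         ≡⟨ ℤ.+-identityˡ _ ⟩
    - f u v                      ≡⟨ cong -_ (D-cong M≋) ⟨
    - D M                        ∎
    where
    open ≡-Reasoning
    u v u+v : Row n
    u = M i
    v = M k
    u+v j = u j + v j
    B : Row n → Row n → Matrix n
    B a b = updateAt (updateAt M i (const a)) k (const b)
    Bk : ∀ a b → B a b k ≡ b
    Bk a b = FVec.updateAt-updates k _
    Bi : ∀ a b → B a b i ≡ a
    Bi a b = trans (FVec.updateAt-minimal i k _ i≢k) (FVec.updateAt-updates i M)
    Bl : ∀ a b l → l ≢ i → l ≢ k → B a b l ≡ M l
    Bl a b l l≢i l≢k = trans (FVec.updateAt-minimal l k _ l≢k) (FVec.updateAt-minimal l i M l≢i)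
    f : Row n → Row n → ℤ
    f a b = D (B a b)
    B-char : ∀ {a b K} → (∀ j → K i j ≡ a j) → (∀ j → K k j ≡ b j) →
             (∀ l → l ≢ i → l ≢ k → ∀ j → K l j ≡ M l j) → K ≋ B a b
    B-char {a} {b} {K} Ki Kk Kl l j with l Fin.≟ i
    ... | yes refl = trans (Ki j) (cong (λ r → r j) (sym (Bi a b)))
    ... | no l≢i with l Fin.≟ k
    ...   | yes refl = trans (Kk j) (cong (λ r → r j) (sym (Bk a b)))
    ...   | no l≢k   = trans (Kl l l≢i l≢k j) (cong (λ r → r j) (sym (Bl a b l l≢i l≢k)))
    N≋ : N ≋ B v u
    N≋ = B-char Ni Nk off
    M≋ : M ≋ B u v
    M≋ = B-char (λ _ → refl) (λ _ → refl) (λ _ _ _ _ → refl)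
    f-diag : ∀ a → f a a ≡ 0ℤ
    f-diag a = alternating (B a a) i≢k λ j → cong (λ r → r j) (trans (Bi a a) (sym (Bk a a)))
    f-addˡ : ∀ b → f u+v b ≡ f u b + f v b
    f-addˡ b = additive i (agree u) (agree v) λ j →
      trans (cong (λ r → r j) (Bi u+v b)) (sym (cong₂ (λ r s → r j + s j) (Bi u b) (Bi v b)))
      where
      agree : ∀ a l → l ≢ i → ∀ j → B u+v b l j ≡ B a b l j
      agree a l l≢i j with l Fin.≟ k
      ... | yes refl = cong (λ r → r j) (trans (Bk u+v b) (sym (Bk a b)))
      ... | no l≢k   = cong (λ r → r j) (trans (Bl u+v b l l≢i l≢k) (sym (Bl a b l l≢i l≢k)))
    f-addʳ : ∀ a → f a u+v ≡ f a u + f a v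
    f-addʳ a = additive k (agree u) (agree v) λ j →
      trans (cong (λ r → r j) (Bk a u+v)) (sym (cong₂ (λ r s → r j + s j) (Bk a u) (Bk a v)))
      where
      agree : ∀ b l → l ≢ k → ∀ j → B a u+v l j ≡ B a b l j
      agree b l l≢k j with l Fin.≟ i
      ... | yes refl = cong (λ r → r j) (trans (Bi a u+v) (sym (Bi a b)))
      ... | no l≢i   = cong (λ r → r j) (trans (Bl a u+v l l≢i l≢k) (sym (Bl a b l l≢i l≢k)))
    expand : f u+v u+v ≡ (f u u + f u v) + (f v u + f v v)
    expand = trans (f-addˡ u+v) (cong₂ _+_ (f-addʳ u) (f-addʳ v))
    isolate : ∀ a b c d → c ≡ ((a + b) + (c + d)) - a - d - b
    isolate = solve-∀

module Alternating₁ {n} {D : Matrix (suc n) → ℤ} (alt : IsAlternating (suc n) D) where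
  open Alternating alt

  expand-row : ∀ m (x : Row m) (V : Fin m → Row (suc n)) {r} (K : Fin n → Row (suc n)) →
    (∀ j → r j ≡ ΣFin m (λ k → x k * V k j)) → D (r ◂ K) ≡ ΣFin m (λ k → x k * D (V k ◂ K))
  expand-row zero    x V K eq = zero-row zero eq
  expand-row (suc m) x V {r} K eq = begin
    D (r ◂ K)                                 ≡⟨ linear zero (x zero) {r ◂ K} {rest ◂ K} {V zero ◂ K}
                                                   (off r rest) (off r (V zero)) (λ j → trans (eq j) (ℤ.+-comm (x zero * V zero j) _)) ⟩
    D (rest ◂ K) + x zero * D (V zero ◂ K)    ≡⟨ cong (λ d → d + x zero * D (V zero ◂ K)) (expand-row m (x ∘ suc) (V ∘ suc) K (λ _ → refl)) ⟩
    _                                         ≡⟨ ℤ.+-comm (ΣFin m (λ k → x (suc k) * D (V (suc k) ◂ K))) _ ⟩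
    ΣFin (suc m) (λ k → x k * D (V k ◂ K))    ∎
    where
    open ≡-Reasoning
    rest : Row (suc n)
    rest j = ΣFin m (λ k → x (suc k) * V (suc k) j)
    off : ∀ r s k → k ≢ zero → ∀ j → (r ◂ K) k j ≡ (s ◂ K) k j
    off r s zero    0≢0 = contradiction refl 0≢0
    off r s (suc k) _ j = refl

  -- Multiples of the unit row `δ l` on top clear column l below it. The value thus depends only on
  -- the minor, to which `minor-isAlternating` lets the induction apply.
  clear-column : ∀ l (K : Fin n → Row (suc n)) →
    D (δ l ◂ K) ≡ D (δ l ◂ λ r → insertZero l (λ c → K r (punchIn l c)))
  clear-column l K = row-shift n (δ l) (λ K → D (δ l ◂ K))
    (λ eq → D-cong λ { zero j → refl ; (suc i) j → eq i j })
    (λ i c off at → add-row (suc i) zero c (λ ())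
       (λ { zero _ j → refl ; (suc k) k≢i j → off k (k≢i ∘ cong suc) j }) at)
    (λ r → K r l) λ r → punchIn-elim l _
      (sym (trans (cong₂ (λ x y → x + K r l * y) (FVec.insertAt-lookup _ l 0ℤ) (δ-diag l)) (simp₁ (K r l))))
      λ k → sym (trans (cong₂ (λ x y → x + K r l * y) (FVec.insertAt-punchIn _ l 0ℤ k) (δ-punchIn-right l k))
                       (simp₂ (K r (punchIn l k)) (K r l)))
    where
    simp₁ : ∀ x → 0ℤ + x * 1ℤ ≡ x
    simp₁ = solve-∀
    simp₂ : ∀ x y → x + y * 0ℤ ≡ x
    simp₂ = solve-∀

  minor-isAlternating : ∀ l → IsAlternating n (λ K → D (δ l ◂ insertZero l ∘ K))
  minor-isAlternating l = record
    { D-cong = λ eq → D-cong λ { zero j → refl ; (suc i) → lift (eq i) }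
    ; linear = λ i c offM offN at → linear (suc i) c
        (λ { zero _ j → refl ; (suc k) k≢i → lift (offM k (k≢i ∘ cong suc)) })
        (λ { zero _ j → refl ; (suc k) k≢i → lift (offN k (k≢i ∘ cong suc)) })
        (punchIn-elim l _
          (trans (FVec.insertAt-lookup _ l 0ℤ) (sym (trans (cong₂ (λ x y → x + c * y) (FVec.insertAt-lookup _ l 0ℤ) (FVec.insertAt-lookup _ l 0ℤ)) (simp c))))
          λ k → trans (FVec.insertAt-punchIn _ l 0ℤ k) (trans (at k)
                  (sym (cong₂ (λ x y → x + c * y) (FVec.insertAt-punchIn _ l 0ℤ k) (FVec.insertAt-punchIn _ l 0ℤ k)))))
    ; alternating = λ M i≢k eq → alternating (δ l ◂ insertZero l ∘ M) (i≢k ∘ Fin.suc-injective) (lift eq)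
    }
    where
    lift : ∀ {r s : Row n} → (∀ j → r j ≡ s j) → ∀ j → insertZero l r j ≡ insertZero l s j
    lift eq = punchIn-elim l _ (trans (FVec.insertAt-lookup _ l 0ℤ) (sym (FVec.insertAt-lookup _ l 0ℤ)))
      λ k → trans (FVec.insertAt-punchIn _ l 0ℤ k) (trans (eq k) (sym (FVec.insertAt-punchIn _ l 0ℤ k)))
    simp : ∀ c → 0ℤ + c * 0ℤ ≡ 0ℤ
    simp = solve-∀

punchIn-inject₁-self : ∀ {n} (i : Fin n) → punchIn (inject₁ i) i ≡ suc i
punchIn-inject₁-self zero    = refl
punchIn-inject₁-self (suc i) = cong suc (punchIn-inject₁-self i)

punchIn-suc-self : ∀ {n} (i : Fin n) → punchIn (suc i) i ≡ inject₁ i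
punchIn-suc-self zero    = refl
punchIn-suc-self (suc i) = cong suc (punchIn-suc-self i)

punchIn-inject₁-suc : ∀ {n} (i k : Fin n) → k ≢ i → punchIn (suc i) k ≡ punchIn (inject₁ i) k
punchIn-inject₁-suc zero    zero    0≢0 = contradiction refl 0≢0
punchIn-inject₁-suc zero    (suc k) _   = refl
punchIn-inject₁-suc (suc i) zero    _   = refl
punchIn-inject₁-suc (suc i) (suc k) k≢i = cong suc (punchIn-inject₁-suc i k (k≢i ∘ cong suc))

-- δ ∘ cycle l is the permutation matrix of the cycle (l 0 1 … l-1).
cycle : ∀ {n} → Fin (suc n) → Fin (suc n) → Fin (suc n)
cycle l = l ◂ punchIn l

-- Swapping rows 0 and l + 1 turns the cycle of l into that of l + 1. The separate `m` makes the
-- recursion structural, since `inject₁ l` is no subterm of `suc l`.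
cycle-sign : ∀ {n} {D : Matrix (suc n) → ℤ} → IsAlternating (suc n) D →
             ∀ m l → toℕ l ≡ m → D (δ ∘ cycle l) ≡ sign m * D δ
cycle-sign {n} {D} alt zero zero eq = trans (D-cong λ { zero j → refl ; (suc i) j → refl }) (sym (ℤ.*-identityˡ (D δ)))
  where open Alternating alt
cycle-sign {n} {D} alt (suc m) (suc l) eq = begin
  D (δ ∘ cycle (suc l))          ≡⟨ swap-rows zero (suc l) {δ ∘ cycle (inject₁ l)} (λ ())
                                      (λ j → cong (λ i → δ i j) (sym (punchIn-inject₁-self l)))
                                      (λ j → cong (λ i → δ i j) (punchIn-suc-self l)) off ⟩
  - D (δ ∘ cycle (inject₁ l))    ≡⟨ cong -_ (cycle-sign alt m (inject₁ l) (trans (Fin.toℕ-inject₁ l) (ℕ.suc-injective eq))) ⟩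
  - (sign m * D δ)               ≡⟨ ℤ.neg-distribˡ-* (sign m) (D δ) ⟩
  - sign m * D δ                 ∎
  where
  open Alternating alt
  open ≡-Reasoning
  off : ∀ k → k ≢ zero → k ≢ suc l → ∀ j → δ (cycle (suc l) k) j ≡ δ (cycle (inject₁ l) k) j
  off zero    0≢0 _   _ = contradiction refl 0≢0
  off (suc k) _   k≢l j = cong (λ i → δ i j) (punchIn-inject₁-suc l k (k≢l ∘ cong suc))

-- Row 0 is expanded into unit rows and the column under each is cleared. By induction what remains
-- is the determinant of the minor times the value at a permutation matrix, whose sign is that of
-- the cofactor expansion.
alternating-unique : ∀ n {D : Matrix n → ℤ} → IsAlternating n D → ∀ M → D M ≡ D δ * det n M
alternating-unique zero    alt M = trans (IsAlternating.D-cong alt λ ()) (sym (ℤ.*-identityʳ _))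
alternating-unique (suc n) {D} alt M = begin
  D M                                                    ≡⟨ D-cong (λ { zero j → refl ; (suc i) j → refl }) ⟩
  D (M zero ◂ M ∘ suc)                                   ≡⟨ expand-row (suc n) (M zero) δ (M ∘ suc) (λ j → sym (Σ-δʳ (suc n) j (M zero))) ⟩
  ΣFin (suc n) (λ l → M zero l * D (δ l ◂ M ∘ suc))      ≡⟨ Σ-cong (suc n) term ⟩
  ΣFin (suc n) (λ l → D δ * cofactor M l)                ≡⟨ Σ-*ˡ (suc n) (D δ) (cofactor M) ⟩
  D δ * det (suc n) M                                    ∎
  where
  open Alternating alt
  open Alternating₁ alt
  open ≡-Reasoning
  rearrange : ∀ x s d m → x * (s * d * m) ≡ d * (s * (x * m))
  rearrange = solve-∀
  insertZero-δ : ∀ l → (δ l ◂ insertZero l ∘ δ) ≋ δ ∘ cycle l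
  insertZero-δ l zero    j = refl
  insertZero-δ l (suc k)   = punchIn-elim l _
    (trans (FVec.insertAt-lookup _ l 0ℤ) (sym (δ-punchIn-left l k)))
    (λ c → trans (FVec.insertAt-punchIn _ l 0ℤ c) (sym (δ-punchIn l k c)))
  term : ∀ l → M zero l * D (δ l ◂ M ∘ suc) ≡ D δ * cofactor M l
  term l = begin
    M zero l * D (δ l ◂ M ∘ suc)
      ≡⟨ cong (M zero l *_) (clear-column l (M ∘ suc)) ⟩
    M zero l * D (δ l ◂ insertZero l ∘ minor M l)
      ≡⟨ cong (M zero l *_) (alternating-unique n (minor-isAlternating l) (minor M l)) ⟩
    M zero l * (D (δ l ◂ insertZero l ∘ δ) * det n (minor M l))
      ≡⟨ cong (λ d → M zero l * (d * det n (minor M l))) (trans (D-cong (insertZero-δ l)) (cycle-sign alt (toℕ l) l refl)) ⟩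
    M zero l * (sign (toℕ l) * D δ * det n (minor M l))
      ≡⟨ rearrange (M zero l) (sign (toℕ l)) (D δ) (det n (minor M l)) ⟩
    D δ * cofactor M l ∎

-- Multiplicativity, block triangular matrices and similarity

record IsLinear {n} (φ : Row n → Row n) : Set where
  field
    φ-cong   : ∀ {r s} → (∀ j → r j ≡ s j) → ∀ j → φ r j ≡ φ s j
    φ-linear : ∀ c {r s t} → (∀ j → t j ≡ r j + c * s j) → ∀ j → φ t j ≡ φ r j + c * φ s j

-- Applying φ to every row is multiplication by a matrix from the right, so this covers column
-- operations as well as products.
det-∘-linear : ∀ n {φ : Row n → Row n} → IsLinear φ → ∀ M → det n (φ ∘ M) ≡ det n (φ ∘ δ) * det n M
det-∘-linear n {φ} lin = alternating-unique n {λ M → det n (φ ∘ M)} record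
  { D-cong      = λ eq → det-cong n λ i → φ-cong (eq i)
  ; linear      = λ i c offM offN at → det-linear n i c (λ k k≢i → φ-cong (offM k k≢i)) (λ k k≢i → φ-cong (offN k k≢i)) (φ-linear c at)
  ; alternating = λ {i} {k} M i≢k eq → det-alternating n i k (φ ∘ M) i≢k (φ-cong eq)
  }
  where open IsLinear lin

_⊙_ : ∀ {n} → Row n → Matrix n → Row n
_⊙_ {n} r M j = ΣFin n λ k → r k * M k j

⊙-isLinear : ∀ {n} (M : Matrix n) → IsLinear (_⊙ M)
⊙-isLinear {n} M = record
  { φ-cong   = λ eq j → Σ-cong n λ k → cong (_* M k j) (eq k)
  ; φ-linear = λ c {r} {s} eq j → Σ-linear n c λ k → trans (cong (_* M k j) (eq k)) (distrib (r k) c (s k) (M k j))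
  }
  where
  distrib : ∀ x c y m → (x + c * y) * m ≡ x * m + c * (y * m)
  distrib = solve-∀

det-* : ∀ n P M → det n (λ i → P i ⊙ M) ≡ det n M * det n P
det-* n P M = trans (det-∘-linear n (⊙-isLinear M) P)
  (cong (_* det n P) (det-cong n λ i j → Σ-δˡ n i (λ k → M k j)))

punchIn-↑ˡ-↑ˡ : ∀ {n} m (j : Fin (suc n)) c → punchIn (j ↑ˡ m) (c ↑ˡ m) ≡ punchIn j c ↑ˡ m
punchIn-↑ˡ-↑ˡ m zero    c       = refl
punchIn-↑ˡ-↑ˡ m (suc j) zero    = refl
punchIn-↑ˡ-↑ˡ m (suc j) (suc c) = cong suc (punchIn-↑ˡ-↑ˡ m j c)

punchIn-↑ˡ-↑ʳ : ∀ {n m} (j : Fin (suc n)) (c : Fin m) → punchIn (j ↑ˡ m) (n ↑ʳ c) ≡ suc n ↑ʳ c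
punchIn-↑ˡ-↑ʳ         zero    c = refl
punchIn-↑ˡ-↑ʳ {suc n} (suc j) c = cong suc (punchIn-↑ˡ-↑ʳ j c)

det-block : ∀ n m (M : Matrix (n ℕ.+ m)) → (∀ i j → M (i ↑ˡ m) (n ↑ʳ j) ≡ 0ℤ) →
  det (n ℕ.+ m) M ≡ det n (λ i j → M (i ↑ˡ m) (j ↑ˡ m)) * det m (λ i j → M (n ↑ʳ i) (n ↑ʳ j))
det-block zero    m M _    = sym (ℤ.*-identityˡ (det m M))
det-block (suc n) m M zero-block = begin
  det (suc n ℕ.+ m) M
    ≡⟨ Σ-split (suc n) m (cofactor M) ⟩
  ΣFin (suc n) (λ j → cofactor M (j ↑ˡ m)) + ΣFin m (λ j → cofactor M (suc n ↑ʳ j))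
    ≡⟨ cong₂ _+_ (Σ-cong (suc n) left) (Σ-zero m right) ⟩
  ΣFin (suc n) (λ j → cofactor A j * det m C) + 0ℤ
    ≡⟨ ℤ.+-identityʳ _ ⟩
  ΣFin (suc n) (λ j → cofactor A j * det m C)
    ≡⟨ Σ-*ʳ (suc n) (det m C) (cofactor A) ⟩
  det (suc n) A * det m C ∎
  where
  open ≡-Reasoning
  A : Matrix (suc n)
  A i j = M (i ↑ˡ m) (j ↑ˡ m)
  C : Matrix m
  C i j = M (suc n ↑ʳ i) (suc n ↑ʳ j)
  reassoc : ∀ s x a c → s * (x * (a * c)) ≡ s * (x * a) * c
  reassoc = solve-∀
  vanish : ∀ s d → s * (0ℤ * d) ≡ 0ℤ
  vanish = solve-∀
  left : ∀ j → cofactor M (j ↑ˡ m) ≡ cofactor A j * det m C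
  left j = begin
    sign (toℕ (j ↑ˡ m)) * (A zero j * det (n ℕ.+ m) (minor M (j ↑ˡ m)))
      ≡⟨ cong₂ (λ t d → sign t * (A zero j * d)) (Fin.toℕ-↑ˡ j m)
           (trans (det-block n m (minor M (j ↑ˡ m)) (λ i c → trans (cong (M (suc (i ↑ˡ m))) (punchIn-↑ˡ-↑ʳ j c)) (zero-block (suc i) c)))
             (cong₂ _*_ (det-cong n λ i c → cong (M (suc (i ↑ˡ m))) (punchIn-↑ˡ-↑ˡ m j c))
                        (det-cong m λ i c → cong (M (suc (n ↑ʳ i))) (punchIn-↑ˡ-↑ʳ j c)))) ⟩
    sign (toℕ j) * (A zero j * (det n (minor A j) * det m C))
      ≡⟨ reassoc (sign (toℕ j)) (A zero j) (det n (minor A j)) (det m C) ⟩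
    cofactor A j * det m C ∎
  right : ∀ j → cofactor M (suc n ↑ʳ j) ≡ 0ℤ
  right j = trans (cong (λ x → sign (toℕ (suc n ↑ʳ j)) * (x * det (n ℕ.+ m) (minor M (suc n ↑ʳ j)))) (zero-block zero j))
                  (vanish (sign (toℕ (suc n ↑ʳ j))) (det (n ℕ.+ m) (minor M (suc n ↑ʳ j))))

↑-elim : ∀ m {n} (P : Fin (m ℕ.+ n) → Set) → (∀ i → P (i ↑ˡ n)) → (∀ j → P (m ↑ʳ j)) → ∀ k → P k
↑-elim m {n} P left right k with splitAt m k in eq
... | inj₁ i = subst P (Fin.splitAt⁻¹-↑ˡ eq) (left i)
... | inj₂ j = subst P (Fin.splitAt⁻¹-↑ʳ eq) (right j)

-- With `addLeft` this is conjugation by S = [[1, -1], [0, 1]]: S acts on the rows, S⁻¹ on the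
-- columns. It takes [[A, B], [B, A]] to [[A - B, 0], [B, A + B]].
subtractBottom : ∀ n {w} → (Fin (n ℕ.+ n) → Row w) → Fin (n ℕ.+ n) → Row w
subtractBottom n M = (λ i j → M (i ↑ˡ n) j - M (n ↑ʳ i) j) ++ (λ i → M (n ↑ʳ i))

addLeft : ∀ n → Row (n ℕ.+ n) → Row (n ℕ.+ n)
addLeft n r = (λ j → r (j ↑ˡ n)) ++ (λ j → r (j ↑ˡ n) + r (n ↑ʳ j))

module _ {n : ℕ} where

  addLeft-↑ˡ : ∀ (r : Row (n ℕ.+ n)) j → addLeft n r (j ↑ˡ n) ≡ r (j ↑ˡ n)
  addLeft-↑ˡ r j = FVec.lookup-++ˡ {m = n} {n = n} _ (λ j → r (j ↑ˡ n) + r (n ↑ʳ j)) j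

  addLeft-↑ʳ : ∀ (r : Row (n ℕ.+ n)) j → addLeft n r (n ↑ʳ j) ≡ r (j ↑ˡ n) + r (n ↑ʳ j)
  addLeft-↑ʳ r j = FVec.lookup-++ʳ {m = n} {n = n} (λ j → r (j ↑ˡ n)) _ j

  subtractBottom-↑ˡ : ∀ {w} (M : Fin (n ℕ.+ n) → Row w) i → subtractBottom n M (i ↑ˡ n) ≡ λ j → M (i ↑ˡ n) j - M (n ↑ʳ i) j
  subtractBottom-↑ˡ M i = FVec.lookup-++ˡ {m = n} {n = n} _ (λ i → M (n ↑ʳ i)) i

  subtractBottom-↑ʳ : ∀ {w} (M : Fin (n ℕ.+ n) → Row w) i → subtractBottom n M (n ↑ʳ i) ≡ M (n ↑ʳ i)
  subtractBottom-↑ʳ M i = FVec.lookup-++ʳ {m = n} {n = n} (λ i j → M (i ↑ˡ n) j - M (n ↑ʳ i) j) _ i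

  addLeft-isLinear : IsLinear (addLeft n)
  addLeft-isLinear = record
    { φ-cong = λ {r} {s} eq → ↑-elim n _
        (λ j → trans (addLeft-↑ˡ r j) (trans (eq _) (sym (addLeft-↑ˡ s j))))
        (λ j → trans (addLeft-↑ʳ r j) (trans (cong₂ _+_ (eq _) (eq _)) (sym (addLeft-↑ʳ s j))))
    ; φ-linear = λ c {r} {s} {t} eq → ↑-elim n _
        (λ j → trans (addLeft-↑ˡ t j) (trans (eq _) (sym (cong₂ (λ x y → x + c * y) (addLeft-↑ˡ r j) (addLeft-↑ˡ s j)))))
        (λ j → trans (addLeft-↑ʳ t j) (trans (cong₂ _+_ (eq _) (eq _))
          (trans (rearrange (r (j ↑ˡ n)) (r (n ↑ʳ j)) c (s (j ↑ˡ n)) (s (n ↑ʳ j)))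
                 (sym (cong₂ (λ x y → x + c * y) (addLeft-↑ʳ r j) (addLeft-↑ʳ s j))))))
    }
    where
    rearrange : ∀ x y c z w → (x + c * z) + (y + c * w) ≡ (x + y) + c * (z + w)
    rearrange = solve-∀

  subtractBottom-⊙ : ∀ (M : Matrix (n ℕ.+ n)) → (λ i → subtractBottom n δ i ⊙ M) ≋ subtractBottom n M
  subtractBottom-⊙ M = ↑-elim n _ top bottom
    where
    distrib : ∀ x y m → (x - y) * m ≡ x * m + -1ℤ * (y * m)
    distrib = solve-∀
    subtract : ∀ x y → x + -1ℤ * y ≡ x - y
    subtract = solve-∀
    top : ∀ i j → (subtractBottom n δ (i ↑ˡ n) ⊙ M) j ≡ subtractBottom n M (i ↑ˡ n) j
    top i j rewrite subtractBottom-↑ˡ δ i | subtractBottom-↑ˡ M i = trans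
      (Σ-linear (n ℕ.+ n) -1ℤ {λ k → δ (i ↑ˡ n) k * M k j} {λ k → δ (n ↑ʳ i) k * M k j} λ k → distrib (δ (i ↑ˡ n) k) (δ (n ↑ʳ i) k) (M k j))
      (trans (cong₂ (λ x y → x + -1ℤ * y) (Σ-δˡ (n ℕ.+ n) (i ↑ˡ n) (λ k → M k j)) (Σ-δˡ (n ℕ.+ n) (n ↑ʳ i) (λ k → M k j)))
             (subtract (M (i ↑ˡ n) j) (M (n ↑ʳ i) j)))
    bottom : ∀ i j → (subtractBottom n δ (n ↑ʳ i) ⊙ M) j ≡ subtractBottom n M (n ↑ʳ i) j
    bottom i j rewrite subtractBottom-↑ʳ δ i | subtractBottom-↑ʳ M i = Σ-δˡ (n ℕ.+ n) (n ↑ʳ i) (λ k → M k j)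

  addLeft-subtractBottom-δ : addLeft n ∘ subtractBottom n (δ {n ℕ.+ n}) ≋ δ
  addLeft-subtractBottom-δ = ↑-elim n _ (λ i → ↑-elim n _ (tl i) (tr i)) (λ i → ↑-elim n _ (bl i) (br i))
    where
    tl : ∀ i j → addLeft n (subtractBottom n δ (i ↑ˡ n)) (j ↑ˡ n) ≡ δ (i ↑ˡ n) (j ↑ˡ n)
    tl i j rewrite subtractBottom-↑ˡ (δ {n ℕ.+ n}) i | addLeft-↑ˡ (λ k → δ (i ↑ˡ n) k - δ (n ↑ʳ i) k) j | δ-↑ʳ-↑ˡ {n} {n} j i = ℤ.+-identityʳ _
    cancel : ∀ d → (d - 0ℤ) + (0ℤ - d) ≡ 0ℤ
    cancel = solve-∀
    tr : ∀ i j → addLeft n (subtractBottom n δ (i ↑ˡ n)) (n ↑ʳ j) ≡ δ (i ↑ˡ n) (n ↑ʳ j)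
    tr i j rewrite subtractBottom-↑ˡ (δ {n ℕ.+ n}) i | addLeft-↑ʳ (λ k → δ (i ↑ˡ n) k - δ (n ↑ʳ i) k) j
                 | δ-↑ʳ-↑ˡ {n} {n} j i | δ-↑ˡ-↑ʳ {n} {n} i j | δ-↑ˡ-↑ˡ n i j | δ-↑ʳ-↑ʳ n i j = cancel (δ i j)
    bl : ∀ i j → addLeft n (subtractBottom n δ (n ↑ʳ i)) (j ↑ˡ n) ≡ δ (n ↑ʳ i) (j ↑ˡ n)
    bl i j rewrite subtractBottom-↑ʳ (δ {n ℕ.+ n}) i = addLeft-↑ˡ (δ (n ↑ʳ i)) j
    br : ∀ i j → addLeft n (subtractBottom n δ (n ↑ʳ i)) (n ↑ʳ j) ≡ δ (n ↑ʳ i) (n ↑ʳ j)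
    br i j rewrite subtractBottom-↑ʳ (δ {n ℕ.+ n}) i | addLeft-↑ʳ (δ (n ↑ʳ i)) j | δ-↑ʳ-↑ˡ {n} {n} j i = ℤ.+-identityˡ _

  -- The determinants of the two operations are never computed: their product is the determinant of
  -- the conjugated identity matrix, which is 1.
  det-similar : ∀ M → det (n ℕ.+ n) (addLeft n ∘ subtractBottom n M) ≡ det (n ℕ.+ n) M
  det-similar M = begin
    det (n ℕ.+ n) (addLeft n ∘ subtractBottom n M)
      ≡⟨ det-∘-linear (n ℕ.+ n) addLeft-isLinear (subtractBottom n M) ⟩
    c * det (n ℕ.+ n) (subtractBottom n M)
      ≡⟨ cong (c *_) (det-cong (n ℕ.+ n) (subtractBottom-⊙ M)) ⟨
    c * det (n ℕ.+ n) (λ i → subtractBottom n δ i ⊙ M)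
      ≡⟨ cong (c *_) (det-* (n ℕ.+ n) (subtractBottom n δ) M) ⟩
    c * (det (n ℕ.+ n) M * p)
      ≡⟨ rearrange c (det (n ℕ.+ n) M) p ⟩
    c * p * det (n ℕ.+ n) M
      ≡⟨ cong (_* det (n ℕ.+ n) M) (det-∘-linear (n ℕ.+ n) addLeft-isLinear (subtractBottom n δ)) ⟨
    det (n ℕ.+ n) (addLeft n ∘ subtractBottom n δ) * det (n ℕ.+ n) M
      ≡⟨ cong (_* det (n ℕ.+ n) M) (trans (det-cong (n ℕ.+ n) addLeft-subtractBottom-δ) (det-δ (n ℕ.+ n))) ⟩
    1ℤ * det (n ℕ.+ n) M
      ≡⟨ ℤ.*-identityˡ _ ⟩
    det (n ℕ.+ n) M ∎
    where
    open ≡-Reasoning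
    c p : ℤ
    c = det (n ℕ.+ n) (addLeft n ∘ δ)
    p = det (n ℕ.+ n) (subtractBottom n δ)
    rearrange : ∀ c m p → c * (m * p) ≡ c * p * m
    rearrange = solve-∀

-- The parameter m and the matrices P and Q serve to keep det from being unfolded when a
-- literal is put for m: comparing det 16 with det (8 + 8) would expand both.
det-halve : ∀ {m} n (n+n≡m : n ℕ.+ n ≡ m) (M : Matrix m) (P Q : Matrix n) →
  let l = λ i → subst Fin n+n≡m (i ↑ˡ n) ; r = λ i → subst Fin n+n≡m (n ↑ʳ i) in
  (∀ i j → M (r i) (r j) ≡ M (l i) (l j)) →
  (∀ i j → M (r i) (l j) ≡ M (l i) (r j)) →
  (∀ i j → M (l i) (l j) + M (l i) (r j) ≡ P i j) →
  (∀ i j → M (l i) (l j) - M (l i) (r j) ≡ Q i j) →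
  det m M ≡ det n P * det n Q
det-halve n refl M P Q diag off sum difference = begin
  det (n ℕ.+ n) M
    ≡⟨ det-similar {n} M ⟨
  det (n ℕ.+ n) T
    ≡⟨ det-block n n T upper ⟩
  det n (λ i j → T (i ↑ˡ n) (j ↑ˡ n)) * det n (λ i j → T (n ↑ʳ i) (n ↑ʳ j))
    ≡⟨ cong₂ _*_ (det-cong n upper-left) (det-cong n lower-right) ⟩
  det n Q * det n P
    ≡⟨ ℤ.*-comm (det n Q) (det n P) ⟩
  det n P * det n Q ∎
  where
  open ≡-Reasoning
  T : Matrix (n ℕ.+ n)
  T = addLeft n ∘ subtractBottom n M
  cancel : ∀ a b → (a - b) + (b - a) ≡ 0ℤ
  cancel = solve-∀
  upper : ∀ i j → T (i ↑ˡ n) (n ↑ʳ j) ≡ 0ℤ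
  upper i j rewrite subtractBottom-↑ˡ {n} M i | addLeft-↑ʳ {n} (λ k → M (i ↑ˡ n) k - M (n ↑ʳ i) k) j | diag i j | off i j
    = cancel (M (i ↑ˡ n) (j ↑ˡ n)) (M (i ↑ˡ n) (n ↑ʳ j))
  upper-left : ∀ i j → T (i ↑ˡ n) (j ↑ˡ n) ≡ Q i j
  upper-left i j rewrite subtractBottom-↑ˡ {n} M i | addLeft-↑ˡ {n} (λ k → M (i ↑ˡ n) k - M (n ↑ʳ i) k) j | off i j = difference i j
  lower-right : ∀ i j → T (n ↑ʳ i) (n ↑ʳ j) ≡ P i j
  lower-right i j rewrite subtractBottom-↑ʳ {n} M i | addLeft-↑ʳ {n} (M (n ↑ʳ i)) j | diag i j | off i j
    = trans (ℤ.+-comm (M (i ↑ˡ n) (n ↑ʳ j)) _) (sum i j)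

-- The group determinant as a product of norms

Σᴾ : ∀ {m} n → (Fin n → Polynomial m) → Polynomial m
Σᴾ zero    f = con 0ℤ
Σᴾ (suc n) f = f zero :+ Σᴾ n (f ∘ suc)

-- The definition of `det` repeated on the syntax of the ring solver, so that the 4 × 4 identities
-- can be decided by normal forms.
detᴾ : ∀ {m} n → (Fin n → Fin n → Polynomial m) → Polynomial m
detᴾ zero    M = con 1ℤ
detᴾ (suc n) M = Σᴾ (suc n) λ j → con (sign (toℕ j)) :* (M zero j :* detᴾ n λ r c → M (suc r) (punchIn j c))

⟦detᴾ⟧ : ∀ {m} n (M : Fin n → Fin n → Polynomial m) ρ → ⟦ detᴾ n M ⟧ ρ ≡ det n (λ i j → ⟦ M i j ⟧ ρ)
⟦detᴾ⟧ zero    M ρ = refl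
⟦detᴾ⟧ (suc n) M ρ = ⟦Σᴾ⟧ (suc n)
  {λ j → con (sign (toℕ j)) :* (M zero j :* detᴾ n λ r c → M (suc r) (punchIn j c))} λ j →
  cong (λ d → sign (toℕ j) * (⟦ M zero j ⟧ ρ * d)) (⟦detᴾ⟧ n (λ r c → M (suc r) (punchIn j c)) ρ)
  where
  ⟦Σᴾ⟧ : ∀ n {f : Fin n → Polynomial _} {g} → (∀ j → ⟦ f j ⟧ ρ ≡ g j) → ⟦ Σᴾ n f ⟧ ρ ≡ ΣFin n g
  ⟦Σᴾ⟧ zero    eq = refl
  ⟦Σᴾ⟧ (suc n) eq = cong₂ _+_ (eq zero) (⟦Σᴾ⟧ n (eq ∘ suc))

-- Comparing the normal forms before they are evaluated keeps _*_ from being unfolded.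
proveℤ : ∀ {m} (ρ : Vec ℤ m) p q → normalise p ≡ normalise q → ⟦ p ⟧ ρ ≡ ⟦ q ⟧ ρ
proveℤ ρ p q eq = prove ρ p q (cong (λ n → ⟦ n ⟧N ρ) eq)

record Operations (A : Set) : Set where
  infixl 6 _⊕_ _⊖_
  infixl 7 _⊗_
  field
    _⊕_ _⊖_ _⊗_ : A → A → A
    ⊖_ : A → A

-- Forms on ℤ[X]/(X⁴ - 1) and ℤ[X]/(X⁴ + 1), for the integers and for the polynomials of the
-- ring solver: s(±1) = even s ± odd s, s(i) = re s + i im s, and u(ζ) u(ζ³) = q₁ u + q₂ u √-2
-- for a primitive eighth root of unity ζ with √-2 = ζ + ζ³.
module Forms {A : Set} (operations : Operations A) where
  open Operations operations
  even odd re im q₁ q₂ : (Fin 4 → A) → A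
  even s = s (# 0) ⊕ s (# 2)
  odd  s = s (# 1) ⊕ s (# 3)
  re   s = s (# 0) ⊖ s (# 2)
  im   s = s (# 1) ⊖ s (# 3)
  q₁   u = u (# 0) ⊗ u (# 0) ⊖ u (# 1) ⊗ u (# 1) ⊕ u (# 2) ⊗ u (# 2) ⊖ u (# 3) ⊗ u (# 3)
  q₂   u = u (# 0) ⊗ u (# 1) ⊕ u (# 0) ⊗ u (# 3) ⊖ u (# 1) ⊗ u (# 2) ⊕ u (# 2) ⊗ u (# 3)

  norm-i norm-ζ₁ norm-ζ₂ : (s t : Fin 4 → A) → A
  norm-i  s t = re s ⊗ re s ⊕ im s ⊗ im s ⊖ (re t ⊗ re t ⊕ im t ⊗ im t)
  norm-ζ₁ u v = q₁ u ⊖ q₁ v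
  norm-ζ₂ u v = q₂ u ⊖ q₂ v

  fold⁺ fold⁻ : (Fin 8 → A) → Fin 4 → A
  fold⁺ h i = h (i ↑ˡ 4) ⊕ h (4 ↑ʳ i)
  fold⁻ h i = h (i ↑ˡ 4) ⊖ h (4 ↑ʳ i)

  periodic antiperiodic : (Fin 4 → A) → Fin 8 → A
  periodic     s = s ++ s
  antiperiodic u = u ++ λ i → ⊖ u i

integers : Operations ℤ
integers = record { _⊕_ = _+_ ; _⊖_ = _-_ ; _⊗_ = _*_ ; ⊖_ = -_ }

polynomials : ∀ {n} → Operations (Polynomial n)
polynomials = record { _⊕_ = _:+_ ; _⊖_ = _:-_ ; _⊗_ = _:*_ ; ⊖_ = :-_ }

open Forms integers
module ᴾ {n} = Forms (polynomials {n})

-- The blocks of the group matrix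

infixl 6 _⊝_ _⊝₃_

-- The exponents i - j and i - 3 j modulo 8: 7 and 5 stand for -1 and -3.
_⊝_ _⊝₃_ : Fin 8 → Fin 8 → Fin 8
i ⊝ j  = (toℕ i ℕ.+ 7 ℕ.* toℕ j) mod 8
i ⊝₃ j = (toℕ i ℕ.+ 5 ℕ.* toℕ j) mod 8

-- The matrix of h ↦ f h + g σ(h) on ℤ[X]/(X⁸ - 1), where σ(X) = X³.
twisted : (f g : Fin 8 → ℤ) → Matrix 8
twisted f g i j = f (i ⊝ j) + g (i ⊝₃ j)

-- The diagonal blocks agree because 3² ≡ 1 (mod 8): both Xⁱ (Xʲ)⁻¹ and Xⁱ Y (Xʲ Y)⁻¹ are X^(i - j).
-- Off the diagonal both products are X^(i - 3j) Y.
groupDet-split : ∀ a → let f = λ i → a (i ↑ˡ 8) ; g = λ i → a (8 ↑ʳ i) in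
  groupDet a ≡ det 8 (twisted f g) * det 8 (twisted f (λ i → - g i))
groupDet-split a = det-halve 8 refl (λ g h → a (g · (h ⁻¹)))
  (twisted (λ i → a (i ↑ˡ 8)) (λ i → a (8 ↑ʳ i))) (twisted (λ i → a (i ↑ˡ 8)) (λ i → - a (8 ↑ʳ i)))
  (λ i j → cong a (right-right i j))
  (λ i j → cong a (right-left i j))
  (λ i j → cong₂ (λ g h → a g + a h) (left-left i j) (left-right i j))
  (λ i j → cong₂ (λ g h → a g - a h) (left-left i j) (left-right i j))
  where
  left-left : ∀ i j → (i ↑ˡ 8) · ((j ↑ˡ 8) ⁻¹) ≡ (i ⊝ j) ↑ˡ 8
  left-left = toWitness {a? = Fin.all? λ i → Fin.all? λ j → (i ↑ˡ 8) · ((j ↑ˡ 8) ⁻¹) Fin.≟ (i ⊝ j) ↑ˡ 8} tt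
  left-right : ∀ i j → (i ↑ˡ 8) · ((8 ↑ʳ j) ⁻¹) ≡ 8 ↑ʳ (i ⊝₃ j)
  left-right = toWitness {a? = Fin.all? λ i → Fin.all? λ j → (i ↑ˡ 8) · ((8 ↑ʳ j) ⁻¹) Fin.≟ 8 ↑ʳ (i ⊝₃ j)} tt
  right-right : ∀ (i j : Fin 8) → (8 ↑ʳ i) · ((8 ↑ʳ j) ⁻¹) ≡ (i ↑ˡ 8) · ((j ↑ˡ 8) ⁻¹)
  right-right = toWitness {a? = Fin.all? λ i → Fin.all? λ j → (8 ↑ʳ i) · ((8 ↑ʳ j) ⁻¹) Fin.≟ (i ↑ˡ 8) · ((j ↑ˡ 8) ⁻¹)} tt
  right-left : ∀ (i j : Fin 8) → (8 ↑ʳ i) · ((j ↑ˡ 8) ⁻¹) ≡ (i ↑ˡ 8) · ((8 ↑ʳ j) ⁻¹)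
  right-left = toWitness {a? = Fin.all? λ i → Fin.all? λ j → (8 ↑ʳ i) · ((j ↑ˡ 8) ⁻¹) Fin.≟ (i ↑ˡ 8) · ((8 ↑ʳ j) ⁻¹)} tt

left⊝ left⊝₃ : Fin 4 → Fin 4 → Fin 8
left⊝  i j = (i ↑ˡ 4) ⊝ (j ↑ˡ 4)
left⊝₃ i j = (i ↑ˡ 4) ⊝₃ (j ↑ˡ 4)

periodicMatrix antiperiodicMatrix : (s t : Fin 4 → ℤ) → Matrix 4
periodicMatrix     s t i j = periodic s (left⊝ i j) + periodic t (left⊝₃ i j)
antiperiodicMatrix u v i j = antiperiodic u (left⊝ i j) + antiperiodic v (left⊝₃ i j)

linearFactors : (E O E′ O′ : ℤ) → ℤ
linearFactors E O E′ O′ = (E + O + (E′ + O′)) * (E - O + (E′ - O′))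

norm : ℤ → ℤ → ℤ
norm c d = c * c + + 2 * (d * d)

module _ (s t : Fin 4 → ℤ) where
  private
    ρ : Vec ℤ 8
    ρ = s (# 0) ∷ s (# 1) ∷ s (# 2) ∷ s (# 3) ∷ t (# 0) ∷ t (# 1) ∷ t (# 2) ∷ t (# 3) ∷ []
    sᴾ tᴾ : Fin 4 → Polynomial 8
    sᴾ i = var (i ↑ˡ 4)
    tᴾ i = var (4 ↑ʳ i)
    periodicᴾ antiperiodicᴾ : Fin 4 → Fin 4 → Polynomial 8
    periodicᴾ     i j = ᴾ.periodic sᴾ (left⊝ i j) :+ ᴾ.periodic tᴾ (left⊝₃ i j)
    antiperiodicᴾ i j = ᴾ.antiperiodic sᴾ (left⊝ i j) :+ ᴾ.antiperiodic tᴾ (left⊝₃ i j)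

    ⟦periodicᴾ⟧ : ∀ i j → periodicMatrix s t i j ≡ ⟦ periodicᴾ i j ⟧ ρ
    ⟦periodicᴾ⟧ i j = cong₂ _+_ (on-s (left⊝ i j)) (on-t (left⊝₃ i j))
      where
      on-s : ∀ k → periodic s k ≡ ⟦ ᴾ.periodic sᴾ k ⟧ ρ
      on-s = λ { 0F → refl ; 1F → refl ; 2F → refl ; 3F → refl ; 4F → refl ; 5F → refl ; 6F → refl ; 7F → refl }
      on-t : ∀ k → periodic t k ≡ ⟦ ᴾ.periodic tᴾ k ⟧ ρ
      on-t = λ { 0F → refl ; 1F → refl ; 2F → refl ; 3F → refl ; 4F → refl ; 5F → refl ; 6F → refl ; 7F → refl }

    ⟦antiperiodicᴾ⟧ : ∀ i j → antiperiodicMatrix s t i j ≡ ⟦ antiperiodicᴾ i j ⟧ ρ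
    ⟦antiperiodicᴾ⟧ i j = cong₂ _+_ (on-s (left⊝ i j)) (on-t (left⊝₃ i j))
      where
      on-s : ∀ k → antiperiodic s k ≡ ⟦ ᴾ.antiperiodic sᴾ k ⟧ ρ
      on-s = λ { 0F → refl ; 1F → refl ; 2F → refl ; 3F → refl ; 4F → refl ; 5F → refl ; 6F → refl ; 7F → refl }
      on-t : ∀ k → antiperiodic t k ≡ ⟦ ᴾ.antiperiodic tᴾ k ⟧ ρ
      on-t = λ { 0F → refl ; 1F → refl ; 2F → refl ; 3F → refl ; 4F → refl ; 5F → refl ; 6F → refl ; 7F → refl }

  -- On ℤ[X]/(X⁴ - 1) the map σ is X ↦ X⁻¹. It fixes the values at ±1, which give the factors s(±1)
  -- + t(±1), and conjugates the value at i, where h ↦ s h + t σ(h) has determinant |s(i)|² -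
  -- |t(i)|².
  det-periodic : det 4 (periodicMatrix s t) ≡ linearFactors (even s) (odd s) (even t) (odd t) * norm-i s t
  det-periodic = trans (det-cong 4 ⟦periodicᴾ⟧) (trans (sym (⟦detᴾ⟧ 4 periodicᴾ ρ)) (proveℤ ρ (detᴾ 4 periodicᴾ)
    ((ᴾ.even sᴾ :+ ᴾ.odd sᴾ :+ (ᴾ.even tᴾ :+ ᴾ.odd tᴾ)) :* (ᴾ.even sᴾ :- ᴾ.odd sᴾ :+ (ᴾ.even tᴾ :- ᴾ.odd tᴾ)) :* ᴾ.norm-i sᴾ tᴾ) refl))

  -- On ℤ[ζ] the map σ sends ζ to ζ³ and fixes √-2 = ζ + ζ³. Over ℚ(√-2) the determinant of h ↦ s h
  -- + t σ(h) is s σ(s) - t σ(t) = c + d √-2, whose norm to ℚ is c² + 2 d².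
  det-antiperiodic : det 4 (antiperiodicMatrix s t) ≡ norm (norm-ζ₁ s t) (norm-ζ₂ s t)
  det-antiperiodic = trans (det-cong 4 ⟦antiperiodicᴾ⟧) (trans (sym (⟦detᴾ⟧ 4 antiperiodicᴾ ρ)) (proveℤ ρ (detᴾ 4 antiperiodicᴾ)
    (ᴾ.norm-ζ₁ sᴾ tᴾ :* ᴾ.norm-ζ₁ sᴾ tᴾ :+ con (+ 2) :* (ᴾ.norm-ζ₂ sᴾ tᴾ :* ᴾ.norm-ζ₂ sᴾ tᴾ)) refl))

↑ˡ-⊝4 : ∀ i → (i ↑ˡ 4) ⊝ # 4 ≡ 4 ↑ʳ i
↑ˡ-⊝4 = toWitness {a? = Fin.all? λ i → (i ↑ˡ 4) ⊝ # 4 Fin.≟ 4 ↑ʳ i} tt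

↑ʳ-⊝4 : ∀ (i : Fin 4) → (4 ↑ʳ i) ⊝ # 4 ≡ i ↑ˡ 4
↑ʳ-⊝4 = toWitness {a? = Fin.all? λ i → (4 ↑ʳ i) ⊝ # 4 Fin.≟ i ↑ˡ 4} tt

periodic-fold⁺ : ∀ h k → h k + h (k ⊝ # 4) ≡ periodic (fold⁺ h) k
periodic-fold⁺ h = ↑-elim 4 _
  (λ i → trans (cong (λ l → h (i ↑ˡ 4) + h l) (↑ˡ-⊝4 i)) (sym (FVec.lookup-++ˡ (fold⁺ h) (fold⁺ h) i)))
  (λ i → trans (trans (cong (λ l → h (4 ↑ʳ i) + h l) (↑ʳ-⊝4 i)) (ℤ.+-comm (h (4 ↑ʳ i)) (h (i ↑ˡ 4))))
               (sym (FVec.lookup-++ʳ (fold⁺ h) (fold⁺ h) i)))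

antiperiodic-fold⁻ : ∀ h k → h k - h (k ⊝ # 4) ≡ antiperiodic (fold⁻ h) k
antiperiodic-fold⁻ h = ↑-elim 4 _
  (λ i → trans (cong (λ l → h (i ↑ˡ 4) - h l) (↑ˡ-⊝4 i)) (sym (FVec.lookup-++ˡ (fold⁻ h) (λ i → - fold⁻ h i) i)))
  (λ i → trans (trans (cong (λ l → h (4 ↑ʳ i) - h l) (↑ʳ-⊝4 i)) (flip (h (4 ↑ʳ i)) (h (i ↑ˡ 4))))
               (sym (FVec.lookup-++ʳ (fold⁻ h) (λ i → - fold⁻ h i) i)))
  where
  flip : ∀ x y → x - y ≡ - (y - x)
  flip = solve-∀

-- The splitting is repeated with X⁴ in the role of Y. As 3 · 4 ≡ 4 (mod 8), σ fixes X⁴, so f and g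
-- are both shifted by 4 and fold in the same way.
det-twisted : ∀ f g → let s = fold⁺ f ; t = fold⁺ g ; u = fold⁻ f ; v = fold⁻ g in
  det 8 (twisted f g) ≡
  linearFactors (even s) (odd s) (even t) (odd t) * norm-i s t * norm (norm-ζ₁ u v) (norm-ζ₂ u v)
det-twisted f g = trans
  (det-halve 4 refl (twisted f g)
    (periodicMatrix (fold⁺ f) (fold⁺ g))
    (antiperiodicMatrix (fold⁻ f) (fold⁻ g))
    (λ i j → cong₂ (λ k l → f k + g l)
      (toWitness {a? = Fin.all? λ i → Fin.all? λ j → (4 ↑ʳ i) ⊝ (4 ↑ʳ j) Fin.≟ left⊝ i j} tt i j)
      (toWitness {a? = Fin.all? λ i → Fin.all? λ j → (4 ↑ʳ i) ⊝₃ (4 ↑ʳ j) Fin.≟ left⊝₃ i j} tt i j))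
    (λ i j → cong₂ (λ k l → f k + g l)
      (toWitness {a? = Fin.all? λ i → Fin.all? λ j → (4 ↑ʳ i) ⊝ (j ↑ˡ 4) Fin.≟ (i ↑ˡ 4) ⊝ (4 ↑ʳ j)} tt i j)
      (toWitness {a? = Fin.all? λ i → Fin.all? λ j → (4 ↑ʳ i) ⊝₃ (j ↑ˡ 4) Fin.≟ (i ↑ˡ 4) ⊝₃ (4 ↑ʳ j)} tt i j))
    (λ i j → trans (trans (cong₂ (λ k l → (f (left⊝ i j) + g (left⊝₃ i j)) + (f k + g l)) (shift i j) (shift₃ i j))
                          (interchange⁺ (f (left⊝ i j)) (g (left⊝₃ i j)) (f (left⊝ i j ⊝ # 4)) (g (left⊝₃ i j ⊝ # 4))))
                   (cong₂ _+_ (periodic-fold⁺ f (left⊝ i j)) (periodic-fold⁺ g (left⊝₃ i j))))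
    (λ i j → trans (trans (cong₂ (λ k l → (f (left⊝ i j) + g (left⊝₃ i j)) - (f k + g l)) (shift i j) (shift₃ i j))
                          (interchange⁻ (f (left⊝ i j)) (g (left⊝₃ i j)) (f (left⊝ i j ⊝ # 4)) (g (left⊝₃ i j ⊝ # 4))))
                   (cong₂ _+_ (antiperiodic-fold⁻ f (left⊝ i j)) (antiperiodic-fold⁻ g (left⊝₃ i j)))))
  (cong₂ _*_ (det-periodic (fold⁺ f) (fold⁺ g)) (det-antiperiodic (fold⁻ f) (fold⁻ g)))
  where
  shift : ∀ i j → (i ↑ˡ 4) ⊝ (4 ↑ʳ j) ≡ left⊝ i j ⊝ # 4
  shift = toWitness {a? = Fin.all? λ i → Fin.all? λ j → (i ↑ˡ 4) ⊝ (4 ↑ʳ j) Fin.≟ left⊝ i j ⊝ # 4} tt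
  shift₃ : ∀ i j → (i ↑ˡ 4) ⊝₃ (4 ↑ʳ j) ≡ left⊝₃ i j ⊝ # 4
  shift₃ = toWitness {a? = Fin.all? λ i → Fin.all? λ j → (i ↑ˡ 4) ⊝₃ (4 ↑ʳ j) Fin.≟ left⊝₃ i j ⊝ # 4} tt
  interchange⁺ : ∀ a b c d → (a + b) + (c + d) ≡ (a + c) + (b + d)
  interchange⁺ = solve-∀
  interchange⁻ : ∀ a b c d → (a + b) - (c + d) ≡ (a - c) + (b - d)
  interchange⁻ = solve-∀

value : (F₁ F₂ G₁ G₂ Q N : ℤ) → ℤ
value F₁ F₂ G₁ G₂ Q N = (F₁ * F₁ - G₁ * G₁) * (F₂ * F₂ - G₂ * G₂) * (Q * Q) * (N * N)

module _ (h : Fin 8 → ℤ) where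
  private
    ρ : Vec ℤ 8
    ρ = Vec.tabulate h
    hᴾ : Fin 8 → Polynomial 8
    hᴾ = var
    sᴾ uᴾ -sᴾ -uᴾ : Fin 4 → Polynomial 8
    sᴾ  = ᴾ.fold⁺ hᴾ
    uᴾ  = ᴾ.fold⁻ hᴾ
    -sᴾ = ᴾ.fold⁺ (λ i → :- hᴾ i)
    -uᴾ = ᴾ.fold⁻ (λ i → :- hᴾ i)

  even-neg : even (fold⁺ (-_ ∘ h)) ≡ - even (fold⁺ h)
  even-neg = proveℤ ρ (ᴾ.even -sᴾ) (:- ᴾ.even sᴾ) refl

  odd-neg : odd (fold⁺ (-_ ∘ h)) ≡ - odd (fold⁺ h)
  odd-neg = proveℤ ρ (ᴾ.odd -sᴾ) (:- ᴾ.odd sᴾ) refl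

  re²+im²-neg : let s = fold⁺ (-_ ∘ h) ; t = fold⁺ h in re s * re s + im s * im s ≡ re t * re t + im t * im t
  re²+im²-neg = proveℤ ρ (ᴾ.re -sᴾ :* ᴾ.re -sᴾ :+ ᴾ.im -sᴾ :* ᴾ.im -sᴾ) (ᴾ.re sᴾ :* ᴾ.re sᴾ :+ ᴾ.im sᴾ :* ᴾ.im sᴾ) refl

  q₁-neg : q₁ (fold⁻ (-_ ∘ h)) ≡ q₁ (fold⁻ h)
  q₁-neg = proveℤ ρ (ᴾ.q₁ -uᴾ) (ᴾ.q₁ uᴾ) refl

  q₂-neg : q₂ (fold⁻ (-_ ∘ h)) ≡ q₂ (fold⁻ h)
  q₂-neg = proveℤ ρ (ᴾ.q₂ -uᴾ) (ᴾ.q₂ uᴾ) refl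

  q₁-mod-2 : ∃ λ k → q₁ (fold⁻ h) ≡ (even (fold⁺ h) + odd (fold⁺ h)) * (even (fold⁺ h) + odd (fold⁺ h)) + + 2 * k
  q₁-mod-2 = _ , proveℤ ρ (ᴾ.q₁ uᴾ) ((ᴾ.even sᴾ :+ ᴾ.odd sᴾ) :* (ᴾ.even sᴾ :+ ᴾ.odd sᴾ) :+ con (+ 2) :* kᴾ) refl
    where
    Tᴾ kᴾ : Polynomial 8
    Tᴾ = hᴾ (# 4) :+ hᴾ (# 5) :+ hᴾ (# 6) :+ hᴾ (# 7)
    -- The sum of all uᵢ is E + O - 2T, and q₁ is the square of that sum less 2 u₁², 2 u₃² and twice
    -- all products uᵢ uⱼ with i < j.
    kᴾ = con (+ 2) :* Tᴾ :* (Tᴾ :- (ᴾ.even sᴾ :+ ᴾ.odd sᴾ)) :- uᴾ (# 1) :* uᴾ (# 1) :- uᴾ (# 3) :* uᴾ (# 3)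
         :- (uᴾ (# 0) :* (uᴾ (# 1) :+ uᴾ (# 2) :+ uᴾ (# 3)) :+ uᴾ (# 1) :* (uᴾ (# 2) :+ uᴾ (# 3)) :+ uᴾ (# 2) :* uᴾ (# 3))

  q₂-mod-2 : ∃ λ k → q₂ (fold⁻ h) ≡ even (fold⁺ h) * odd (fold⁺ h) + + 2 * k
  q₂-mod-2 = _ , proveℤ ρ (ᴾ.q₂ uᴾ) (ᴾ.even sᴾ :* ᴾ.odd sᴾ :+ con (+ 2) :* kᴾ) refl
    where
    Aᴾ Bᴾ kᴾ : Polynomial 8
    Aᴾ = hᴾ (# 4) :+ hᴾ (# 6)
    Bᴾ = hᴾ (# 5) :+ hᴾ (# 7)
    -- From q₂ = (u₀ + u₂)(u₁ + u₃) - 2 u₁ u₂ with u₀ + u₂ = E - 2A and u₁ + u₃ = O - 2B.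
    kᴾ = con (+ 2) :* Aᴾ :* Bᴾ :- ᴾ.even sᴾ :* Bᴾ :- ᴾ.odd sᴾ :* Aᴾ :- uᴾ (# 1) :* uᴾ (# 2)

combine : ∀ E O E′ O′ Q N →
  linearFactors E O E′ O′ * Q * N * (linearFactors E O (- E′) (- O′) * Q * N) ≡ value (E + O) (E - O) (E′ + O′) (E′ - O′) Q N
combine = identity
  where
  identity : ∀ E O E′ O′ Q N →
    (E + O + (E′ + O′)) * (E - O + (E′ - O′)) * Q * N * ((E + O + (- E′ + - O′)) * (E - O + (- E′ - - O′)) * Q * N) ≡
    ((E + O) * (E + O) - (E′ + O′) * (E′ + O′)) * ((E - O) * (E - O) - (E′ - O′) * (E′ - O′)) * (Q * Q) * (N * N)
  identity = solve-∀

-- All the numbers are variables here since with the actual forms Agda would expand the products.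
assemble : ∀ {D D₁ D₂} E O E′ O′ Q N E″ O″ Q″ N″ → D ≡ D₁ * D₂ →
  D₁ ≡ linearFactors E O E′ O′ * Q * N → D₂ ≡ linearFactors E O E″ O″ * Q″ * N″ →
  E″ ≡ - E′ → O″ ≡ - O′ → Q″ ≡ Q → N″ ≡ N → D ≡ value (E + O) (E - O) (E′ + O′) (E′ - O′) Q N
assemble E O E′ O′ Q N _ _ _ _ D≡ D₁≡ D₂≡ refl refl refl refl =
  trans D≡ (trans (cong₂ _*_ D₁≡ D₂≡) (combine E O E′ O′ Q N))

groupDet-value : ∀ a → let f = λ i → a (i ↑ˡ 8) ; g = λ i → a (8 ↑ʳ i) in
  groupDet a ≡ value
    (even (fold⁺ f) + odd (fold⁺ f)) (even (fold⁺ f) - odd (fold⁺ f))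
    (even (fold⁺ g) + odd (fold⁺ g)) (even (fold⁺ g) - odd (fold⁺ g))
    (norm-i (fold⁺ f) (fold⁺ g)) (norm (norm-ζ₁ (fold⁻ f) (fold⁻ g)) (norm-ζ₂ (fold⁻ f) (fold⁻ g)))
groupDet-value a = let f = λ i → a (i ↑ˡ 8) ; g = λ i → a (8 ↑ʳ i) ; g⁻ = λ i → - a (8 ↑ʳ i) in
  assemble (even (fold⁺ f)) (odd (fold⁺ f)) (even (fold⁺ g)) (odd (fold⁺ g))
    (norm-i (fold⁺ f) (fold⁺ g)) (norm (norm-ζ₁ (fold⁻ f) (fold⁻ g)) (norm-ζ₂ (fold⁻ f) (fold⁻ g)))
    (even (fold⁺ g⁻)) (odd (fold⁺ g⁻))
    (norm-i (fold⁺ f) (fold⁺ g⁻)) (norm (norm-ζ₁ (fold⁻ f) (fold⁻ g⁻)) (norm-ζ₂ (fold⁻ f) (fold⁻ g⁻)))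
    (groupDet-split a) (det-twisted f g) (det-twisted f g⁻)
    (even-neg g) (odd-neg g)
    (cong (λ R → re (fold⁺ f) * re (fold⁺ f) + im (fold⁺ f) * im (fold⁺ f) - R) (re²+im²-neg g))
    (cong₂ (λ p q → norm (q₁ (fold⁻ f) - p) (q₂ (fold⁻ f) - q)) (q₁-neg g) (q₂-neg g))

norm-i-mod-4 : ∀ s t → ∃ λ k →
  norm-i s t ≡ even s * even s + odd s * odd s - (even t * even t + odd t * odd t) + + 4 * k
norm-i-mod-4 s t = _ , identity (s (# 0)) (s (# 1)) (s (# 2)) (s (# 3)) (t (# 0)) (t (# 1)) (t (# 2)) (t (# 3))
  where
  identity : ∀ a b c d a′ b′ c′ d′ →
    (a - c) * (a - c) + (b - d) * (b - d) - ((a′ - c′) * (a′ - c′) + (b′ - d′) * (b′ - d′)) ≡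
    (a + c) * (a + c) + (b + d) * (b + d) - ((a′ + c′) * (a′ + c′) + (b′ + d′) * (b′ + d′))
    + + 4 * (a′ * c′ + b′ * d′ - a * c - b * d)
  identity = solve-∀

-- Parities

data Parity : ℤ → Set where
  isEven : ∀ h → Parity (+ 2 * h)
  isOdd  : ∀ h → Parity (1ℤ + + 2 * h)

parity : ∀ n → Parity n
parity n with n ℤ.%ℕ 2 | ℤ.n%ℕd<d n 2 | ℤ.a≡a%ℕn+[a/ℕn]*n n 2
... | 0 | _ | eq = subst Parity (sym (trans eq (trans (ℤ.+-identityˡ _) (ℤ.*-comm (n ℤ./ℕ 2) (+ 2))))) (isEven (n ℤ./ℕ 2))
... | 1 | _ | eq = subst Parity (sym (trans eq (cong (_+_ 1ℤ) (ℤ.*-comm (n ℤ./ℕ 2) (+ 2))))) (isOdd (n ℤ./ℕ 2))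
... | suc (suc _) | ℕ.s≤s (ℕ.s≤s ()) | _

odd-square : ∀ x → ∃ λ t → (1ℤ + + 2 * x) * (1ℤ + + 2 * x) ≡ 1ℤ + + 8 * t
odd-square x with parity x
... | isEven h = h + + 2 * h * h , identity h
  where
  identity : ∀ h → (1ℤ + + 2 * (+ 2 * h)) * (1ℤ + + 2 * (+ 2 * h)) ≡ 1ℤ + + 8 * (h + + 2 * h * h)
  identity = solve-∀
... | isOdd h = 1ℤ + + 3 * h + + 2 * h * h , identity h
  where
  identity : ∀ h → (1ℤ + + 2 * (1ℤ + + 2 * h)) * (1ℤ + + 2 * (1ℤ + + 2 * h)) ≡ 1ℤ + + 8 * (1ℤ + + 3 * h + + 2 * h * h)
  identity = solve-∀

Even Odd : ℤ → Set
Even n = ∃ λ h → n ≡ + 2 * h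
Odd  n = ∃ λ h → n ≡ 1ℤ + + 2 * h

data Outcome (n : ℤ) : Set where
  multiple : ∀ t → n ≡ + 1024 * t → Outcome n
  one      : ∀ t → n ≡ 1ℤ + + 8 * t → Outcome n
  five     : ∀ t m c d → n ≡ + 5 + + 8 * t →
             n ≡ m * (norm (1ℤ + + 2 * c) (1ℤ + + 2 * d) * norm (1ℤ + + 2 * c) (1ℤ + + 2 * d)) → Outcome n

data Class (E O : ℤ) : Set where
  mixed    : Odd (E + O) → Odd (E - O) → Even (E * O) → Class E O
  bothEven : ∀ e o → E ≡ + 2 * e → O ≡ + 2 * o → Class E O
  bothOdd  : ∀ e o → E ≡ 1ℤ + + 2 * e → O ≡ 1ℤ + + 2 * o → Class E O

classify : ∀ E O → Class E O
classify E O with parity E | parity O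
... | isEven e | isEven o = bothEven e o refl refl
... | isOdd e  | isOdd o  = bothOdd e o refl refl
... | isOdd e  | isEven o = mixed (e + o , sum e o) (e - o , difference e o) ((1ℤ + + 2 * e) * o , prod e o)
  where
  sum : ∀ e o → 1ℤ + + 2 * e + + 2 * o ≡ 1ℤ + + 2 * (e + o)
  sum = solve-∀
  difference : ∀ e o → 1ℤ + + 2 * e - + 2 * o ≡ 1ℤ + + 2 * (e - o)
  difference = solve-∀
  prod : ∀ e o → (1ℤ + + 2 * e) * (+ 2 * o) ≡ + 2 * ((1ℤ + + 2 * e) * o)
  prod = solve-∀
... | isEven e | isOdd o = mixed (e + o , sum e o) (e - o - 1ℤ , difference e o) (e * (1ℤ + + 2 * o) , prod e o)
  where
  sum : ∀ e o → + 2 * e + (1ℤ + + 2 * o) ≡ 1ℤ + + 2 * (e + o)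
  sum = solve-∀
  difference : ∀ e o → + 2 * e - (1ℤ + + 2 * o) ≡ 1ℤ + + 2 * (e - o - 1ℤ)
  difference = solve-∀
  prod : ∀ e o → (+ 2 * e) * (1ℤ + + 2 * o) ≡ + 2 * (e * (1ℤ + + 2 * o))
  prod = solve-∀

-- All that the parity argument knows about Q, c and d: their dependence on the coefficient sums E,
-- O of f and E′, O′ of g, over the even and the odd exponents.
record Linked (E O E′ O′ Q c d : ℤ) : Set where
  constructor linked
  field
    k k₁ k₂ : ℤ
    Q≡ : Q ≡ E * E + O * O - (E′ * E′ + O′ * O′) + + 4 * k
    c≡ : c ≡ (E + O) * (E + O) - (E′ + O′) * (E′ + O′) + + 2 * k₁
    d≡ : d ≡ E * O - E′ * O′ + + 2 * k₂

-- Exchanging f and g negates both differences of squares as well as Q, c and d, so the value stays.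
-- With `value-swap` this settles the cases that mirror another one.
swap-links : ∀ {E O E′ O′ Q c d} → Linked E O E′ O′ Q c d → Linked E′ O′ E O (- Q) (- c) (- d)
swap-links {E} {O} {E′} {O′} (linked k k₁ k₂ refl refl refl) =
  linked (- k) (- k₁) (- k₂) (Q-swap E O E′ O′ k) (c-swap E O E′ O′ k₁) (d-swap E O E′ O′ k₂)
  where
  Q-swap : ∀ E O E′ O′ k → - (E * E + O * O - (E′ * E′ + O′ * O′) + + 4 * k) ≡ E′ * E′ + O′ * O′ - (E * E + O * O) + + 4 * - k
  Q-swap = solve-∀
  c-swap : ∀ E O E′ O′ k → - ((E + O) * (E + O) - (E′ + O′) * (E′ + O′) + + 2 * k) ≡ (E′ + O′) * (E′ + O′) - (E + O) * (E + O) + + 2 * - k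
  c-swap = solve-∀
  d-swap : ∀ E O E′ O′ k → - (E * O - E′ * O′ + + 2 * k) ≡ E′ * O′ - E * O + + 2 * - k
  d-swap = solve-∀

value-swap : ∀ F₁ F₂ G₁ G₂ Q c d → value G₁ G₂ F₁ F₂ (- Q) (norm (- c) (- d)) ≡ value F₁ F₂ G₁ G₂ Q (norm c d)
value-swap F₁ F₂ G₁ G₂ Q c d = trans (cong (value G₁ G₂ F₁ F₂ (- Q)) (norm-neg c d)) (identity F₁ F₂ G₁ G₂ Q (norm c d))
  where
  norm-neg : ∀ c d → - c * - c + + 2 * (- d * - d) ≡ c * c + + 2 * (d * d)
  norm-neg = solve-∀
  identity : ∀ F₁ F₂ G₁ G₂ Q N → (G₁ * G₁ - F₁ * F₁) * (G₂ * G₂ - F₂ * F₂) * (- Q * - Q) * (N * N) ≡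
    (F₁ * F₁ - G₁ * G₁) * (F₂ * F₂ - G₂ * G₂) * (Q * Q) * (N * N)
  identity = solve-∀

norm-even : ∀ {c} d → Even c → Even (norm c d)
norm-even d (c , refl) = + 2 * c * c + d * d , identity c d
  where
  identity : ∀ c d → + 2 * c * (+ 2 * c) + + 2 * (d * d) ≡ + 2 * (+ 2 * c * c + d * d)
  identity = solve-∀

norm-odd : ∀ {c} d → Odd c → Odd (norm c d)
norm-odd d (c , refl) = + 2 * c + + 2 * c * c + d * d , identity c d
  where
  identity : ∀ c d → (1ℤ + + 2 * c) * (1ℤ + + 2 * c) + + 2 * (d * d) ≡ 1ℤ + + 2 * (+ 2 * c + + 2 * c * c + d * d)
  identity = solve-∀

norm-even-even : ∀ {c d} → Even c → Even d → ∃ λ m → norm c d ≡ + 4 * m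
norm-even-even (c , refl) (d , refl) = c * c + + 2 * d * d , identity c d
  where
  identity : ∀ c d → + 2 * c * (+ 2 * c) + + 2 * (+ 2 * d * (+ 2 * d)) ≡ + 4 * (c * c + + 2 * d * d)
  identity = solve-∀

1024-multiple : ∀ {P Q N} s → P ≡ + 64 * s → Even Q → Even N → Outcome (P * (Q * Q) * (N * N))
1024-multiple s refl (q , refl) (m , refl) = multiple (s * (q * q) * (m * m)) (identity s q m)
  where
  identity : ∀ s q m → + 64 * s * (+ 2 * q * (+ 2 * q)) * (+ 2 * m * (+ 2 * m)) ≡ + 1024 * (s * (q * q) * (m * m))
  identity = solve-∀

4096-multiple : ∀ {P₁ P₂ Q N} s s′ → P₁ ≡ + 4 * s → P₂ ≡ + 4 * s′ →
  (∃ λ q → Q ≡ + 4 * q) → (∃ λ m → N ≡ + 4 * m) → Outcome (P₁ * P₂ * (Q * Q) * (N * N))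
4096-multiple s s′ refl refl (q , refl) (m , refl) = multiple (+ 4 * ((s * s′) * (q * q) * (m * m)))
  (trans (collect s s′ (q * q) (m * m) (square q) (square m)) (scale ((s * s′) * (q * q) * (m * m))))
  where
  square : ∀ q → + 4 * q * (+ 4 * q) ≡ + 16 * (q * q)
  square = solve-∀
  regroup : ∀ a b s s′ q m → a * s * (a * s′) * (b * q) * (b * m) ≡ a * a * b * b * (s * s′ * q * m)
  regroup = solve-∀
  collect : ∀ s s′ q² m² {Q N} → Q ≡ + 16 * q² → N ≡ + 16 * m² → + 4 * s * (+ 4 * s′) * Q * N ≡ + 4096 * (s * s′ * q² * m²)
  collect s s′ q² m² refl refl = regroup (+ 4) (+ 16) s s′ q² m²
  scale : ∀ x → + 4096 * x ≡ + 1024 * (+ 4 * x)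
  scale x = ℤ.*-assoc (+ 1024) (+ 4) x

odd-squares-difference : ∀ {F G} → Odd F → Odd G → ∃ λ s → F * F - G * G ≡ + 8 * s
odd-squares-difference (x , refl) (z , refl) with odd-square x | odd-square z
... | a , eqa | b , eqb = a - b , trans (cong₂ _-_ eqa eqb) (identity a b)
  where
  identity : ∀ a b → 1ℤ + + 8 * a - (1ℤ + + 8 * b) ≡ + 8 * (a - b)
  identity = solve-∀

even-squares-difference : ∀ {F G} r p → F ≡ + 2 * r → G ≡ + 2 * p → F * F - G * G ≡ + 4 * (r * r - p * p)
even-squares-difference r p refl refl = identity r p
  where
  identity : ∀ r p → + 2 * r * (+ 2 * r) - + 2 * p * (+ 2 * p) ≡ + 4 * (r * r - p * p)
  identity = solve-∀

mixed-squares-difference : ∀ {F G} → Odd F → ∀ p → G ≡ + 2 * p → ∃ λ t → F * F - G * G ≡ 1ℤ + + 8 * t - + 4 * (p * p)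
mixed-squares-difference (x , refl) p refl with odd-square x
... | t , eq = t , trans (cong (_- + 2 * p * (+ 2 * p)) eq) (identity t p)
  where
  identity : ∀ t p → 1ℤ + + 8 * t - + 2 * p * (+ 2 * p) ≡ 1ℤ + + 8 * t - + 4 * (p * p)
  identity = solve-∀

Q-mod-2 : ∀ E O E′ O′ k → E * E + O * O - (E′ * E′ + O′ * O′) + + 4 * k ≡
  (E + O) * (E + O) - (E′ + O′) * (E′ + O′) + + 2 * (E′ * O′ - E * O + + 2 * k)
Q-mod-2 = solve-∀

even-shift : ∀ {X c} → Even X → ∀ k → c ≡ X + + 2 * k → Even c
even-shift (x , refl) k refl = x + k , sym (ℤ.*-distribˡ-+ (+ 2) x k)

odd-shift : ∀ {X c} → Odd X → ∀ k → c ≡ X + + 2 * k → Odd c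
odd-shift (x , refl) k refl = x + k , identity x k
  where
  identity : ∀ x k → 1ℤ + + 2 * x + + 2 * k ≡ 1ℤ + + 2 * (x + k)
  identity = solve-∀

8s-even : ∀ {X} s → X ≡ + 8 * s → Even X
8s-even s refl = + 4 * s , ℤ.*-assoc (+ 2) (+ 4) s

4s-even : ∀ {X} s → X ≡ + 4 * s → Even X
4s-even s refl = + 2 * s , ℤ.*-assoc (+ 2) (+ 2) s

8t-4p+1-odd : ∀ {X} t p → X ≡ 1ℤ + + 8 * t - + 4 * p → Odd X
8t-4p+1-odd t p refl = + 4 * t - + 2 * p , identity t p
  where
  identity : ∀ t p → 1ℤ + + 8 * t - + 4 * p ≡ 1ℤ + + 2 * (+ 4 * t - + 2 * p)
  identity = solve-∀

sum-even : ∀ e o → + 2 * e + + 2 * o ≡ + 2 * (e + o)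
sum-even = solve-∀

difference-even : ∀ e o → + 2 * e - + 2 * o ≡ + 2 * (e - o)
difference-even = solve-∀

sum-odd : ∀ e o → 1ℤ + + 2 * e + (1ℤ + + 2 * o) ≡ + 2 * (e + o + 1ℤ)
sum-odd = solve-∀

difference-odd : ∀ e o → 1ℤ + + 2 * e - (1ℤ + + 2 * o) ≡ + 2 * (e - o)
difference-odd = solve-∀

-- Modulo 8 the odd squares Q² and N² are 1, and (1 - 4p)(1 - 4p′) is 1 - 4(p + p′).
odd-cofactors : ∀ {P₁ P₂ Q N} t t′ p p′ → P₁ ≡ 1ℤ + + 8 * t - + 4 * p → P₂ ≡ 1ℤ + + 8 * t′ - + 4 * p′ →
  Odd Q → Odd N → ∃ λ s → P₁ * P₂ * (Q * Q) * (N * N) ≡ 1ℤ - + 4 * (p + p′) + + 8 * s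
odd-cofactors t t′ p p′ refl refl (q , refl) (m , refl) = conclude (odd-square q) (odd-square m)
  where
  expand : ∀ t t′ p p′ → (1ℤ + + 8 * t - + 4 * p) * (1ℤ + + 8 * t′ - + 4 * p′) ≡
    1ℤ - + 4 * (p + p′) + + 8 * (t + t′ + + 8 * t * t′ - + 4 * t * p′ - + 4 * t′ * p + + 2 * p * p′)
  expand = solve-∀
  collect : ∀ P s a b → (1ℤ - + 4 * P + + 8 * s) * (1ℤ + + 8 * a) * (1ℤ + + 8 * b) ≡
    1ℤ - + 4 * P + + 8 * (s + (1ℤ - + 4 * P + + 8 * s) * (a + b + + 8 * a * b))
  collect = solve-∀
  conclude : ∀ {Q² N²} → (∃ λ a → Q² ≡ 1ℤ + + 8 * a) → (∃ λ b → N² ≡ 1ℤ + + 8 * b) →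
    ∃ λ s → (1ℤ + + 8 * t - + 4 * p) * (1ℤ + + 8 * t′ - + 4 * p′) * Q² * N² ≡ 1ℤ - + 4 * (p + p′) + + 8 * s
  conclude (a , refl) (b , refl) = S + (1ℤ - + 4 * (p + p′) + + 8 * S) * (a + b + + 8 * a * b) ,
    trans (cong (λ x → x * (1ℤ + + 8 * a) * (1ℤ + + 8 * b)) (expand t t′ p p′)) (collect (p + p′) S a b)
    where
    S : ℤ
    S = t + t′ + + 8 * t * t′ - + 4 * t * p′ - + 4 * t′ * p + + 2 * p * p′

module _ {E O E′ O′ Q c d : ℤ} (links : Linked E O E′ O′ Q c d) where
  open Linked links
  private
    n : ℤ
    n = value (E + O) (E - O) (E′ + O′) (E′ - O′) Q (norm c d)
    k₀ : ℤ
    k₀ = E′ * O′ - E * O + + 2 * k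
    Q≡′ : Q ≡ (E + O) * (E + O) - (E′ + O′) * (E′ + O′) + + 2 * k₀
    Q≡′ = trans Q≡ (Q-mod-2 E O E′ O′ k)

  -- Odd squares agree modulo 8, so the two differences give 8 · 8. The first of them being even, Q
  -- and c are even too, and 64 · 2² · 2² = 1024.
  mixed-mixed : Odd (E + O) → Odd (E - O) → Odd (E′ + O′) → Odd (E′ - O′) → Outcome n
  mixed-mixed F₁ F₂ G₁ G₂ = conclude (odd-squares-difference F₁ G₁) (odd-squares-difference F₂ G₂)
    where
    identity : ∀ s s′ → + 8 * s * (+ 8 * s′) ≡ + 64 * (s * s′)
    identity = solve-∀
    conclude : (∃ λ s → (E + O) * (E + O) - (E′ + O′) * (E′ + O′) ≡ + 8 * s) →
               (∃ λ s → (E - O) * (E - O) - (E′ - O′) * (E′ - O′) ≡ + 8 * s) → Outcome n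
    conclude (s , X≡) (s′ , Y≡) = 1024-multiple (s * s′) (trans (cong₂ _*_ X≡ Y≡) (identity s s′))
      (even-shift (8s-even s X≡) k₀ Q≡′) (norm-even d (even-shift (8s-even s X≡) k₁ c≡))

  -- Common to the cases where all four coefficient sums are even or all are odd. The values at ±1
  -- are even and give 4 · 4; c is even along with d, so that 4 divides c² + 2 d², and Q² N² gives
  -- 4² · 4².
  same-parity : ∀ r r′ p p′ → E + O ≡ + 2 * r → E - O ≡ + 2 * r′ → E′ + O′ ≡ + 2 * p → E′ - O′ ≡ + 2 * p′ →
    (∃ λ q → Q ≡ + 4 * q) → Even d → Outcome n
  same-parity r r′ p p′ F₁≡ F₂≡ G₁≡ G₂≡ 4∣Q 2∣d = 4096-multiple (r * r - p * p) (r′ * r′ - p′ * p′) X≡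
      (even-squares-difference r′ p′ F₂≡ G₂≡) 4∣Q
      (norm-even-even (even-shift (4s-even (r * r - p * p) X≡) k₁ c≡) 2∣d)
    where
    X≡ : (E + O) * (E + O) - (E′ + O′) * (E′ + O′) ≡ + 4 * (r * r - p * p)
    X≡ = even-squares-difference r p F₁≡ G₁≡

  even-even : ∀ e o e′ o′ → E ≡ + 2 * e → O ≡ + 2 * o → E′ ≡ + 2 * e′ → O′ ≡ + 2 * o′ → Outcome n
  even-even e o e′ o′ refl refl refl refl = same-parity (e + o) (e - o) (e′ + o′) (e′ - o′)
    (sum-even e o) (difference-even e o) (sum-even e′ o′) (difference-even e′ o′)
    (e * e + o * o - e′ * e′ - o′ * o′ + k , trans Q≡ (Q-identity e o e′ o′ k))
    (+ 2 * e * o - + 2 * e′ * o′ + k₂ , trans d≡ (d-identity e o e′ o′ k₂))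
    where
    Q-identity : ∀ e o e′ o′ k → + 2 * e * (+ 2 * e) + + 2 * o * (+ 2 * o) - (+ 2 * e′ * (+ 2 * e′) + + 2 * o′ * (+ 2 * o′)) + + 4 * k
      ≡ + 4 * (e * e + o * o - e′ * e′ - o′ * o′ + k)
    Q-identity = solve-∀
    d-identity : ∀ e o e′ o′ k → + 2 * e * (+ 2 * o) - + 2 * e′ * (+ 2 * o′) + + 2 * k ≡ + 2 * (+ 2 * e * o - + 2 * e′ * o′ + k)
    d-identity = solve-∀

  odd-odd : ∀ e o e′ o′ → E ≡ 1ℤ + + 2 * e → O ≡ 1ℤ + + 2 * o → E′ ≡ 1ℤ + + 2 * e′ → O′ ≡ 1ℤ + + 2 * o′ → Outcome n
  odd-odd e o e′ o′ refl refl refl refl = same-parity (e + o + 1ℤ) (e - o) (e′ + o′ + 1ℤ) (e′ - o′)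
    (sum-odd e o) (difference-odd e o) (sum-odd e′ o′) (difference-odd e′ o′)
    (e + e * e + o + o * o - e′ - e′ * e′ - o′ - o′ * o′ + k , trans Q≡ (Q-identity e o e′ o′ k))
    (e + o + + 2 * e * o - e′ - o′ - + 2 * e′ * o′ + k₂ , trans d≡ (d-identity e o e′ o′ k₂))
    where
    Q-identity : ∀ e o e′ o′ k →
      (1ℤ + + 2 * e) * (1ℤ + + 2 * e) + (1ℤ + + 2 * o) * (1ℤ + + 2 * o)
      - ((1ℤ + + 2 * e′) * (1ℤ + + 2 * e′) + (1ℤ + + 2 * o′) * (1ℤ + + 2 * o′)) + + 4 * k
      ≡ + 4 * (e + e * e + o + o * o - e′ - e′ * e′ - o′ - o′ * o′ + k)
    Q-identity = solve-∀
    d-identity : ∀ e o e′ o′ k → (1ℤ + + 2 * e) * (1ℤ + + 2 * o) - (1ℤ + + 2 * e′) * (1ℤ + + 2 * o′) + + 2 * k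
      ≡ + 2 * (e + o + + 2 * e * o - e′ - o′ - + 2 * e′ * o′ + k)
    d-identity = solve-∀

  -- Here F₁ = 2r, G₁ = 2p, F₂ = 2r′ and G₂ = 2p′ with r + r′ odd and p + p′ even, so that
  -- one of r - p and r′ - p′ is even.
  odd-even : ∀ e o e′ o′ → E ≡ 1ℤ + + 2 * e → O ≡ 1ℤ + + 2 * o → E′ ≡ + 2 * e′ → O′ ≡ + 2 * o′ → Outcome n
  odd-even e o e′ o′ E≡ O≡ E′≡ O′≡ =
    1024-multiple (proj₁ (prod (r - p) refl (parity (r - p))))
      (trans (cong₂ _*_ X≡ Y≡) (proj₂ (prod (r - p) refl (parity (r - p)))))
      (even-shift (4s-even (r * r - p * p) X≡) k₀ Q≡′) (norm-even d (even-shift (4s-even (r * r - p * p) X≡) k₁ c≡))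
    where
    r r′ p p′ : ℤ
    r  = e + o + 1ℤ
    r′ = e - o
    p  = e′ + o′
    p′ = e′ - o′
    X≡ : (E + O) * (E + O) - (E′ + O′) * (E′ + O′) ≡ + 4 * (r * r - p * p)
    X≡ = even-squares-difference r p (trans (cong₂ _+_ E≡ O≡) (sum-odd e o)) (trans (cong₂ _+_ E′≡ O′≡) (sum-even e′ o′))
    Y≡ : (E - O) * (E - O) - (E′ - O′) * (E′ - O′) ≡ + 4 * (r′ * r′ - p′ * p′)
    Y≡ = even-squares-difference r′ p′ (trans (cong₂ _-_ E≡ O≡) (difference-odd e o)) (trans (cong₂ _-_ E′≡ O′≡) (difference-even e′ o′))
    left : ∀ δ r p Y → r - p ≡ δ → ∀ m → δ ≡ + 2 * m → + 4 * (r * r - p * p) * (+ 4 * Y) ≡ + 64 * (m * (p + m) * Y)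
    left _ r p Y refl m r-p≡ = trans (factor r p Y) (trans (cong (λ δ → + 4 * (δ * (δ + + 2 * p)) * (+ 4 * Y)) r-p≡) (identity m p Y))
      where
      factor : ∀ r p Y → + 4 * (r * r - p * p) * (+ 4 * Y) ≡ + 4 * ((r - p) * (r - p + + 2 * p)) * (+ 4 * Y)
      factor = solve-∀
      identity : ∀ m p Y → + 4 * (+ 2 * m * (+ 2 * m + + 2 * p)) * (+ 4 * Y) ≡ + 64 * (m * (p + m) * Y)
      identity = solve-∀
    prod : ∀ δ → r - p ≡ δ → Parity δ → ∃ λ s → + 4 * (r * r - p * p) * (+ 4 * (r′ * r′ - p′ * p′)) ≡ + 64 * s
    prod _ eq (isEven m) = m * (p + m) * (r′ * r′ - p′ * p′) , left _ r p (r′ * r′ - p′ * p′) eq m refl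
    prod _ eq (isOdd m)  = (e + o′ - m - p) * (p′ + (e + o′ - m - p)) * (r * r - p * p) , trans (ℤ.*-comm (+ 4 * (r * r - p * p)) _)
      (left _ r′ p′ (r * r - p * p) refl (e + o′ - m - p)
        (trans (reflect e o e′ o′) (trans (cong (λ δ → 1ℤ + + 2 * (e + o′ - p) - δ) eq) (identity (e + o′ - p) m (e + o′ - m - p) (regroup e o′ m p)))))
      where
      reflect : ∀ e o e′ o′ → e - o - (e′ - o′) ≡ 1ℤ + + 2 * (e + o′ - (e′ + o′)) - (e + o + 1ℤ - (e′ + o′))
      reflect = solve-∀
      regroup : ∀ e o′ m p → e + o′ - m - p ≡ (e + o′ - p) - m
      regroup = solve-∀
      identity : ∀ a m b → b ≡ a - m → 1ℤ + + 2 * a - (1ℤ + + 2 * m) ≡ + 2 * b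
      identity a m _ refl = cancel a m
        where
        cancel : ∀ a m → 1ℤ + + 2 * a - (1ℤ + + 2 * m) ≡ + 2 * (a - m)
        cancel = solve-∀

  mixed-squares : Odd (E + O) → Odd (E - O) → ∀ p p′ → E′ + O′ ≡ + 2 * p → E′ - O′ ≡ + 2 * p′ →
    (∃ λ t → n ≡ 1ℤ - + 4 * (p * p + p′ * p′) + + 8 * t) × Odd c
  mixed-squares F₁ F₂ p p′ G₁≡ G₂≡ = conclude (mixed-squares-difference F₁ p G₁≡) (mixed-squares-difference F₂ p′ G₂≡)
    where
    conclude : (∃ λ t → (E + O) * (E + O) - (E′ + O′) * (E′ + O′) ≡ 1ℤ + + 8 * t - + 4 * (p * p)) →
               (∃ λ t → (E - O) * (E - O) - (E′ - O′) * (E′ - O′) ≡ 1ℤ + + 8 * t - + 4 * (p′ * p′)) →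
               (∃ λ t → n ≡ 1ℤ - + 4 * (p * p + p′ * p′) + + 8 * t) × Odd c
    conclude (t , X≡) (t′ , Y≡) =
      odd-cofactors t t′ (p * p) (p′ * p′) X≡ Y≡ (odd-shift X-odd k₀ Q≡′) (norm-odd d (odd-shift X-odd k₁ c≡)) , odd-shift X-odd k₁ c≡
      where
      X-odd : Odd ((E + O) * (E + O) - (E′ + O′) * (E′ + O′))
      X-odd = 8t-4p+1-odd t (p * p) X≡

  -- Half of g(1) and half of g(-1) are e + o and e - o, whose squares sum to the even number 2(e² +
  -- o²); the term 4(p² + p′²) disappears modulo 8.
  mixed-even : Odd (E + O) → Odd (E - O) → ∀ e o → E′ ≡ + 2 * e → O′ ≡ + 2 * o → Outcome n
  mixed-even F₁ F₂ e o E′≡ O′≡ = conclude (mixed-squares F₁ F₂ (e + o) (e - o)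
      (trans (cong₂ _+_ E′≡ O′≡) (sum-even e o)) (trans (cong₂ _-_ E′≡ O′≡) (difference-even e o)))
    where
    identity : ∀ e o t → 1ℤ - + 4 * ((e + o) * (e + o) + (e - o) * (e - o)) + + 8 * t ≡ 1ℤ + + 8 * (t - e * e - o * o)
    identity = solve-∀
    conclude : (∃ λ t → n ≡ 1ℤ - + 4 * ((e + o) * (e + o) + (e - o) * (e - o)) + + 8 * t) × Odd c → Outcome n
    conclude ((t , n≡) , _) = one (t - e * e - o * o) (trans n≡ (identity e o t))

  -- Now the halves e + o + 1 and e - o have opposite parity, so p² + p′² is odd and the value is 1
  -- - 4 ≡ 5 (mod 8). Moreover d ≡ E O - E′ O′ is even minus odd.
  mixed-odd : Odd (E + O) → Odd (E - O) → Even (E * O) → ∀ e o → E′ ≡ 1ℤ + + 2 * e → O′ ≡ 1ℤ + + 2 * o → Outcome n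
  mixed-odd F₁ F₂ (z , EO≡) e o E′≡ O′≡ = conclude (mixed-squares F₁ F₂ (e + o + 1ℤ) (e - o)
      (trans (cong₂ _+_ E′≡ O′≡) (sum-odd e o)) (trans (cong₂ _-_ E′≡ O′≡) (difference-odd e o)))
    where
    identity : ∀ e o t → 1ℤ - + 4 * ((e + o + 1ℤ) * (e + o + 1ℤ) + (e - o) * (e - o)) + + 8 * t ≡ + 5 + + 8 * (t - e * e - o * o - e - o - 1ℤ)
    identity = solve-∀
    d-identity : ∀ z e o k → + 2 * z - (1ℤ + + 2 * e) * (1ℤ + + 2 * o) + + 2 * k ≡ 1ℤ + + 2 * (z + k - e - o - + 2 * e * o - 1ℤ)
    d-identity = solve-∀
    d-odd : d ≡ 1ℤ + + 2 * (z + k₂ - e - o - + 2 * e * o - 1ℤ)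
    d-odd = trans d≡ (trans (cong₂ (λ v w → v - w + + 2 * k₂) EO≡ (cong₂ _*_ E′≡ O′≡)) (d-identity z e o k₂))
    conclude : (∃ λ t → n ≡ 1ℤ - + 4 * ((e + o + 1ℤ) * (e + o + 1ℤ) + (e - o) * (e - o)) + + 8 * t) × Odd c → Outcome n
    conclude ((t , n≡) , c′ , c-odd) = five (t - e * e - o * o - e - o - 1ℤ) (((E + O) * (E + O) - (E′ + O′) * (E′ + O′)) * ((E - O) * (E - O) - (E′ - O′) * (E′ - O′)) * (Q * Q))
      c′ (z + k₂ - e - o - + 2 * e * o - 1ℤ) (trans n≡ (identity e o t))
      (cong₂ (λ c d → ((E + O) * (E + O) - (E′ + O′) * (E′ + O′)) * ((E - O) * (E - O) - (E′ - O′) * (E′ - O′)) * (Q * Q) * (norm c d * norm c d))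
             c-odd d-odd)

outcome : ∀ E O E′ O′ Q c d → Linked E O E′ O′ Q c d → Outcome (value (E + O) (E - O) (E′ + O′) (E′ - O′) Q (norm c d))
outcome E O E′ O′ Q c d links with classify E O | classify E′ O′
... | mixed F₁ F₂ _     | mixed G₁ G₂ _        = mixed-mixed links F₁ F₂ G₁ G₂
... | mixed F₁ F₂ _     | bothEven e′ o′ a′ b′ = mixed-even links F₁ F₂ e′ o′ a′ b′
... | mixed F₁ F₂ EO    | bothOdd e′ o′ a′ b′  = mixed-odd links F₁ F₂ EO e′ o′ a′ b′
... | bothEven e o a b  | bothEven e′ o′ a′ b′ = even-even links e o e′ o′ a b a′ b′
... | bothOdd e o a b   | bothOdd e′ o′ a′ b′  = odd-odd links e o e′ o′ a b a′ b′
... | bothOdd e o a b   | bothEven e′ o′ a′ b′ = odd-even links e o e′ o′ a b a′ b′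
... | bothEven e o a b  | bothOdd e′ o′ a′ b′  = subst Outcome (value-swap (E + O) (E - O) (E′ + O′) (E′ - O′) Q c d)
                                                   (odd-even (swap-links links) e′ o′ e o a′ b′ a b)
... | bothEven e o a b  | mixed G₁ G₂ _        = subst Outcome (value-swap (E + O) (E - O) (E′ + O′) (E′ - O′) Q c d)
                                                   (mixed-even (swap-links links) G₁ G₂ e o a b)
... | bothOdd e o a b   | mixed G₁ G₂ E′O′     = subst Outcome (value-swap (E + O) (E - O) (E′ + O′) (E′ - O′) Q c d)
                                                   (mixed-odd (swap-links links) G₁ G₂ E′O′ e o a b)

groupDet-outcome : ∀ a → Outcome (groupDet a)
groupDet-outcome a = let f = λ i → a (i ↑ˡ 8) ; g = λ i → a (8 ↑ʳ i) in
  subst Outcome (sym (groupDet-value a)) (outcome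
    (even (fold⁺ f)) (odd (fold⁺ f)) (even (fold⁺ g)) (odd (fold⁺ g))
    (norm-i (fold⁺ f) (fold⁺ g)) (norm-ζ₁ (fold⁻ f) (fold⁻ g)) (norm-ζ₂ (fold⁻ f) (fold⁻ g))
    (link {even (fold⁺ f)} {odd (fold⁺ f)} {even (fold⁺ g)} {odd (fold⁺ g)} (norm-i-mod-4 (fold⁺ f) (fold⁺ g)) (q₁-mod-2 f) (q₁-mod-2 g) (q₂-mod-2 f) (q₂-mod-2 g)))
  where
  collect : ∀ {x y} X Y k l → x ≡ X + + 2 * k → y ≡ Y + + 2 * l → x - y ≡ X - Y + + 2 * (k - l)
  collect X Y k l refl refl = identity X Y k l
    where
    identity : ∀ X Y k l → X + + 2 * k - (Y + + 2 * l) ≡ X - Y + + 2 * (k - l)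
    identity = solve-∀
  link : ∀ {E O E′ O′ Q c c′ d d′} →
    (∃ λ k → Q ≡ E * E + O * O - (E′ * E′ + O′ * O′) + + 4 * k) →
    (∃ λ k → c ≡ (E + O) * (E + O) + + 2 * k) → (∃ λ k → c′ ≡ (E′ + O′) * (E′ + O′) + + 2 * k) →
    (∃ λ k → d ≡ E * O + + 2 * k) → (∃ λ k → d′ ≡ E′ * O′ + + 2 * k) →
    Linked E O E′ O′ Q (c - c′) (d - d′)
  link {E} {O} {E′} {O′} (k , Q≡) (k₁ , c≡) (l₁ , c′≡) (k₂ , d≡) (l₂ , d′≡) = linked k (k₁ - l₁) (k₂ - l₂) Q≡
    (collect ((E + O) * (E + O)) ((E′ + O′) * (E′ + O′)) k₁ l₁ c≡ c′≡) (collect (E * O) (E′ * O′) k₂ l₂ d≡ d′≡)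

-- Realised values

value-cong : ∀ {F₁ F₂ G₁ G₂ Q N F₁′ F₂′ G₁′ G₂′ Q′ N′} → F₁ ≡ F₁′ → F₂ ≡ F₂′ → G₁ ≡ G₁′ → G₂ ≡ G₂′ → Q ≡ Q′ → N ≡ N′ →
  value F₁ F₂ G₁ G₂ Q N ≡ value F₁′ F₂′ G₁′ G₂′ Q′ N′
value-cong refl refl refl refl refl refl = refl

-- The element f + g Y with f = 1 + g: for it the quadratic forms f(ω) f(ω′) - g(ω) g(ω′) become
-- linear in g, and adding k (1 + X + … + X⁷) to g changes only g(1), by 8k.
shifted : (Fin 8 → ℤ) → SD16 → ℤ
shifted g = (λ i → δ zero i + g i) ++ g

module _ (g : Fin 8 → ℤ) where
  private
    ρ : Vec ℤ 8
    ρ = g (# 0) ∷ g (# 1) ∷ g (# 2) ∷ g (# 3) ∷ g (# 4) ∷ g (# 5) ∷ g (# 6) ∷ g (# 7) ∷ []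
    f : Fin 8 → ℤ
    f i = shifted g (i ↑ˡ 8)
    g′ : Fin 8 → ℤ
    g′ i = shifted g (8 ↑ʳ i)
    fᴾ gᴾ : Fin 8 → Polynomial 8
    gᴾ   = var
    fᴾ i = con (δ zero i) :+ var i

    F₁≡ : even (fold⁺ f) + odd (fold⁺ f) ≡ 1ℤ + (even (fold⁺ g) + odd (fold⁺ g))
    F₁≡ = proveℤ ρ (ᴾ.even (ᴾ.fold⁺ fᴾ) :+ ᴾ.odd (ᴾ.fold⁺ fᴾ)) (con 1ℤ :+ (ᴾ.even (ᴾ.fold⁺ gᴾ) :+ ᴾ.odd (ᴾ.fold⁺ gᴾ))) refl
    F₂≡ : even (fold⁺ f) - odd (fold⁺ f) ≡ 1ℤ + (even (fold⁺ g) - odd (fold⁺ g))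
    F₂≡ = proveℤ ρ (ᴾ.even (ᴾ.fold⁺ fᴾ) :- ᴾ.odd (ᴾ.fold⁺ fᴾ)) (con 1ℤ :+ (ᴾ.even (ᴾ.fold⁺ gᴾ) :- ᴾ.odd (ᴾ.fold⁺ gᴾ))) refl
    G₁≡ : even (fold⁺ g′) + odd (fold⁺ g′) ≡ even (fold⁺ g) + odd (fold⁺ g)
    G₁≡ = refl
    G₂≡ : even (fold⁺ g′) - odd (fold⁺ g′) ≡ even (fold⁺ g) - odd (fold⁺ g)
    G₂≡ = refl
    Q≡ : norm-i (fold⁺ f) (fold⁺ g′) ≡ 1ℤ + + 2 * re (fold⁺ g)
    Q≡ = proveℤ ρ (ᴾ.norm-i (ᴾ.fold⁺ fᴾ) (ᴾ.fold⁺ gᴾ)) (con 1ℤ :+ con (+ 2) :* ᴾ.re (ᴾ.fold⁺ gᴾ)) refl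
    c≡ : norm-ζ₁ (fold⁻ f) (fold⁻ g′) ≡ 1ℤ + + 2 * fold⁻ g (# 0)
    c≡ = proveℤ ρ (ᴾ.norm-ζ₁ (ᴾ.fold⁻ fᴾ) (ᴾ.fold⁻ gᴾ)) (con 1ℤ :+ con (+ 2) :* ᴾ.fold⁻ gᴾ (# 0)) refl
    d≡ : norm-ζ₂ (fold⁻ f) (fold⁻ g′) ≡ fold⁻ g (# 1) + fold⁻ g (# 3)
    d≡ = proveℤ ρ (ᴾ.norm-ζ₂ (ᴾ.fold⁻ fᴾ) (ᴾ.fold⁻ gᴾ)) (ᴾ.fold⁻ gᴾ (# 1) :+ ᴾ.fold⁻ gᴾ (# 3)) refl

  -- For f = 1 + g each form is 1 + g(ω) + g(ω′), a trace: 1 + 2 g(±1) at ±1, 1 + 2 re at i, and 1 +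
  -- 2 u₀ + (u₁ + u₃) √-2 at ζ, where ζ² and ζ⁶ cancel.
  groupDet-shifted : ∀ {G₁ G₂ R x y} → even (fold⁺ g) + odd (fold⁺ g) ≡ G₁ → even (fold⁺ g) - odd (fold⁺ g) ≡ G₂ →
    re (fold⁺ g) ≡ R → fold⁻ g (# 0) ≡ x → fold⁻ g (# 1) + fold⁻ g (# 3) ≡ y →
    groupDet (shifted g) ≡ (1ℤ + + 2 * G₁) * (1ℤ + + 2 * G₂) * ((1ℤ + + 2 * R) * (1ℤ + + 2 * R)) * (norm (1ℤ + + 2 * x) y * norm (1ℤ + + 2 * x) y)
  groupDet-shifted {G₁} {G₂} {R} {x} {y} refl refl refl refl refl = trans (groupDet-value (shifted g))
    (trans (value-cong F₁≡ F₂≡ G₁≡ G₂≡ Q≡ (cong₂ norm c≡ d≡)) (identity G₁ G₂ (1ℤ + + 2 * R) (norm (1ℤ + + 2 * x) y)))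
    where
    identity : ∀ G₁ G₂ Q N → ((1ℤ + G₁) * (1ℤ + G₁) - G₁ * G₁) * ((1ℤ + G₂) * (1ℤ + G₂) - G₂ * G₂) * (Q * Q) * (N * N)
      ≡ (1ℤ + + 2 * G₁) * (1ℤ + + 2 * G₂) * (Q * Q) * (N * N)
    identity = solve-∀

16k+1-isIntGroupDet : ∀ k → IsIntGroupDet (1ℤ + + 16 * k)
16k+1-isIntGroupDet k = shifted (λ _ → k) , trans
  (groupDet-shifted (λ _ → k) (G₁≡ k) (G₂≡ k) (R≡ k) (x≡ k) (y≡ k)) (identity k)
  where
  G₁≡ : ∀ k → k + k + (k + k) + (k + k + (k + k)) ≡ + 8 * k
  G₁≡ = solve-∀
  G₂≡ : ∀ k → k + k + (k + k) - (k + k + (k + k)) ≡ 0ℤ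
  G₂≡ = solve-∀
  R≡ : ∀ k → k + k - (k + k) ≡ 0ℤ
  R≡ = solve-∀
  x≡ : ∀ k → k - k ≡ 0ℤ
  x≡ = solve-∀
  y≡ : ∀ k → k - k + (k - k) ≡ 0ℤ
  y≡ = solve-∀
  identity : ∀ k → (1ℤ + + 2 * (+ 8 * k)) * 1ℤ * 1ℤ * 1ℤ ≡ 1ℤ + + 16 * k
  identity = solve-∀

16k+9-isIntGroupDet : ∀ k → IsIntGroupDet (+ 9 + + 16 * k)
16k+9-isIntGroupDet k = shifted g , trans
  (groupDet-shifted g (G₁≡ k) (G₂≡ k) (R≡ k) (x≡ k) (y≡ k)) (identity k)
  where
  g : Fin 8 → ℤ
  -- X + X² + X⁴ + X⁵ plus the multiple of 1 + X + ... + X⁷: g(1) = 4 + 8k, while the other factors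
  -- become 1, with c = -1 and d = 0.
  g = k ◂ 1ℤ + k ◂ 1ℤ + k ◂ k ◂ 1ℤ + k ◂ 1ℤ + k ◂ k ◂ k ◂ ⟨⟩
  G₁≡ : ∀ k → k + (1ℤ + k) + (1ℤ + k + k) + (1ℤ + k + (1ℤ + k) + (k + k)) ≡ + 4 + + 8 * k
  G₁≡ = solve-∀
  G₂≡ : ∀ k → k + (1ℤ + k) + (1ℤ + k + k) - (1ℤ + k + (1ℤ + k) + (k + k)) ≡ 0ℤ
  G₂≡ = solve-∀
  R≡ : ∀ k → k + (1ℤ + k) - (1ℤ + k + k) ≡ 0ℤ
  R≡ = solve-∀
  x≡ : ∀ k → k - (1ℤ + k) ≡ -1ℤ
  x≡ = solve-∀
  y≡ : ∀ k → 1ℤ + k - (1ℤ + k) + (k - k) ≡ 0ℤ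
  y≡ = solve-∀
  identity : ∀ k → (1ℤ + + 2 * (+ 4 + + 8 * k)) * 1ℤ * 1ℤ * 1ℤ ≡ + 9 + + 16 * k
  identity = solve-∀

[16k+5]N²-isIntGroupDet : ∀ k s t → let N = norm (1ℤ + + 4 * s) (1ℤ + + 4 * t) in IsIntGroupDet ((+ 5 + + 16 * k) * (N * N))
[16k+5]N²-isIntGroupDet k s t = shifted g , trans
  (groupDet-shifted g (G₁≡ k s t) (G₂≡ k s t) (R≡ k s) (x≡ k s) (y≡ k t))
  (trans (cong (λ c → (1ℤ + + 2 * (+ 2 + + 8 * k)) * 1ℤ * 1ℤ * (norm c (1ℤ + + 4 * t) * norm c (1ℤ + + 4 * t))) (c≡ s))
         (identity k (norm (1ℤ + + 4 * s) (1ℤ + + 4 * t))))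
  where
  g : Fin 8 → ℤ
  -- X + X² plus s (1 - X⁴) + 2t (X - X⁵) plus the multiple of 1 + X + ... + X⁷. The middle part
  -- vanishes at all fourth roots of unity, so s and t move only c = 1 + 4s and d = 1 + 4t.
  g = k + s ◂ 1ℤ + k + + 2 * t ◂ 1ℤ + k ◂ k ◂ k - s ◂ k - + 2 * t ◂ k ◂ k ◂ ⟨⟩
  G₁≡ : ∀ k s t → k + s + (k - s) + (1ℤ + k + k) + (1ℤ + k + + 2 * t + (k - + 2 * t) + (k + k)) ≡ + 2 + + 8 * k
  G₁≡ = solve-∀
  G₂≡ : ∀ k s t → k + s + (k - s) + (1ℤ + k + k) - (1ℤ + k + + 2 * t + (k - + 2 * t) + (k + k)) ≡ 0ℤ
  G₂≡ = solve-∀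
  R≡ : ∀ k s → k + s + (k - s) - (1ℤ + k + k) ≡ -1ℤ
  R≡ = solve-∀
  x≡ : ∀ k s → k + s - (k - s) ≡ + 2 * s
  x≡ = solve-∀
  y≡ : ∀ k t → 1ℤ + k + + 2 * t - (k - + 2 * t) + (k - k) ≡ 1ℤ + + 4 * t
  y≡ = solve-∀
  c≡ : ∀ s → 1ℤ + + 2 * (+ 2 * s) ≡ 1ℤ + + 4 * s
  c≡ = solve-∀
  identity : ∀ k N → (1ℤ + + 2 * (+ 2 + + 8 * k)) * 1ℤ * 1ℤ * (N * N) ≡ (+ 5 + + 16 * k) * (N * N)
  identity = solve-∀

[16k+13]N²-isIntGroupDet : ∀ k s t → let N = norm (1ℤ + + 4 * s) (1ℤ + + 4 * t) in IsIntGroupDet ((+ 13 + + 16 * k) * (N * N))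
[16k+13]N²-isIntGroupDet k s t = shifted g , trans
  (groupDet-shifted g (G₁≡ k s t) (G₂≡ k s t) (R≡ k s) (x≡ k s) (y≡ k t))
  (trans (cong (λ N → (1ℤ + + 2 * (+ 6 + + 8 * k)) * 1ℤ * 1ℤ * (N * N)) (N≡ s (1ℤ + + 4 * t)))
         (identity k (norm (1ℤ + + 4 * s) (1ℤ + + 4 * t))))
  where
  g : Fin 8 → ℤ
  -- The same with X + 2X² + X³ + X⁴ + X⁵, so that g(1) = 6 + 8k, and with s negated: c is -(1 +
  -- 4s), whose sign the norm ignores.
  g = k - s ◂ 1ℤ + k + + 2 * t ◂ + 2 + k ◂ 1ℤ + k ◂ 1ℤ + k + s ◂ 1ℤ + k - + 2 * t ◂ k ◂ k ◂ ⟨⟩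
  G₁≡ : ∀ k s t → k - s + (1ℤ + k + s) + (+ 2 + k + k) + (1ℤ + k + + 2 * t + (1ℤ + k - + 2 * t) + (1ℤ + k + k)) ≡ + 6 + + 8 * k
  G₁≡ = solve-∀
  G₂≡ : ∀ k s t → k - s + (1ℤ + k + s) + (+ 2 + k + k) - (1ℤ + k + + 2 * t + (1ℤ + k - + 2 * t) + (1ℤ + k + k)) ≡ 0ℤ
  G₂≡ = solve-∀
  R≡ : ∀ k s → k - s + (1ℤ + k + s) - (+ 2 + k + k) ≡ -1ℤ
  R≡ = solve-∀
  x≡ : ∀ k s → k - s - (1ℤ + k + s) ≡ -1ℤ - + 2 * s
  x≡ = solve-∀
  y≡ : ∀ k t → 1ℤ + k + + 2 * t - (1ℤ + k - + 2 * t) + (1ℤ + k - k) ≡ 1ℤ + + 4 * t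
  y≡ = solve-∀
  N≡ : ∀ s d → (1ℤ + + 2 * (-1ℤ - + 2 * s)) * (1ℤ + + 2 * (-1ℤ - + 2 * s)) + + 2 * (d * d) ≡ (1ℤ + + 4 * s) * (1ℤ + + 4 * s) + + 2 * (d * d)
  N≡ = solve-∀
  identity : ∀ k N → (1ℤ + + 2 * (+ 6 + + 8 * k)) * 1ℤ * 1ℤ * (N * N) ≡ (+ 13 + + 16 * k) * (N * N)
  identity = solve-∀

-- The element X³ + X⁵ + X⁶ + X⁷ + k (X³ + X⁴) (1 + Y).
1024[k+1]-isIntGroupDet : ∀ k → IsIntGroupDet (+ 1024 * (k + 1ℤ))
1024[k+1]-isIntGroupDet k = a , trans (groupDet-value a) (trans (value-cong F₁≡ F₂≡ G₁≡ G₂≡ Q≡ N≡) (identity k))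
  where
  fᴾ gᴾ : Fin 8 → Polynomial 1
  fᴾ = con 0ℤ ◂ con 0ℤ ◂ con 0ℤ ◂ con 1ℤ :+ var zero ◂ var zero ◂ con 1ℤ ◂ con 1ℤ ◂ con 1ℤ ◂ ⟨⟩
  gᴾ = con 0ℤ ◂ con 0ℤ ◂ con 0ℤ ◂ var zero ◂ var zero ◂ con 0ℤ ◂ con 0ℤ ◂ con 0ℤ ◂ ⟨⟩
  f g : Fin 8 → ℤ
  f = 0ℤ ◂ 0ℤ ◂ 0ℤ ◂ 1ℤ + k ◂ k ◂ 1ℤ ◂ 1ℤ ◂ 1ℤ ◂ ⟨⟩
  g = 0ℤ ◂ 0ℤ ◂ 0ℤ ◂ k ◂ k ◂ 0ℤ ◂ 0ℤ ◂ 0ℤ ◂ ⟨⟩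
  a : SD16 → ℤ
  a = f ++ g
  f′ g′ : Fin 8 → ℤ
  f′ i = a (i ↑ˡ 8)
  g′ i = a (8 ↑ʳ i)
  ρ : Vec ℤ 1
  ρ = k ∷ []
  F₁≡ : even (fold⁺ f′) + odd (fold⁺ f′) ≡ + 4 + + 2 * k
  F₁≡ = proveℤ ρ (ᴾ.even (ᴾ.fold⁺ fᴾ) :+ ᴾ.odd (ᴾ.fold⁺ fᴾ)) (con (+ 4) :+ con (+ 2) :* var zero) refl
  F₂≡ : even (fold⁺ f′) - odd (fold⁺ f′) ≡ - + 2
  F₂≡ = proveℤ ρ (ᴾ.even (ᴾ.fold⁺ fᴾ) :- ᴾ.odd (ᴾ.fold⁺ fᴾ)) (con (- + 2)) refl
  G₁≡ : even (fold⁺ g′) + odd (fold⁺ g′) ≡ + 2 * k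
  G₁≡ = proveℤ ρ (ᴾ.even (ᴾ.fold⁺ gᴾ) :+ ᴾ.odd (ᴾ.fold⁺ gᴾ)) (con (+ 2) :* var zero) refl
  G₂≡ : even (fold⁺ g′) - odd (fold⁺ g′) ≡ 0ℤ
  G₂≡ = proveℤ ρ (ᴾ.even (ᴾ.fold⁺ gᴾ) :- ᴾ.odd (ᴾ.fold⁺ gᴾ)) (con 0ℤ) refl
  Q≡ : norm-i (fold⁺ f′) (fold⁺ g′) ≡ + 2
  Q≡ = proveℤ ρ (ᴾ.norm-i (ᴾ.fold⁺ fᴾ) (ᴾ.fold⁺ gᴾ)) (con (+ 2)) refl
  c≡ : norm-ζ₁ (fold⁻ f′) (fold⁻ g′) ≡ 0ℤ
  c≡ = proveℤ ρ (ᴾ.norm-ζ₁ (ᴾ.fold⁻ fᴾ) (ᴾ.fold⁻ gᴾ)) (con 0ℤ) refl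
  d≡ : norm-ζ₂ (fold⁻ f′) (fold⁻ g′) ≡ -1ℤ
  d≡ = proveℤ ρ (ᴾ.norm-ζ₂ (ᴾ.fold⁻ fᴾ) (ᴾ.fold⁻ gᴾ)) (con -1ℤ) refl
  N≡ : norm (norm-ζ₁ (fold⁻ f′) (fold⁻ g′)) (norm-ζ₂ (fold⁻ f′) (fold⁻ g′)) ≡ + 2
  N≡ = cong₂ norm c≡ d≡
  -- In F₁² - G₁² = 16(k + 1) the terms in k² cancel; F₂² - G₂², Q² and N² are 4 each.
  identity : ∀ k → ((+ 4 + + 2 * k) * (+ 4 + + 2 * k) - + 2 * k * (+ 2 * k)) * + 4 * + 4 * + 4 ≡ + 1024 * (k + 1ℤ)
  identity = solve-∀

-- The form a² + 2 b²

-- The quadratic form m X² + 2x XY + k Y² is (a X + b Y)² + 2 (c X + d Y)².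
record Represented (m k x : ℕ) : Set where
  constructor represented
  field
    a b c d : ℤ
    m≡ : + m ≡ norm a c
    k≡ : + k ≡ norm b d
    x≡ : + x ≡ a * b + + 2 * (c * d)

transpose : ∀ {m k x} → Represented m k x → Represented k m x
transpose (represented a b c d m≡ k≡ x≡) = represented b a d c k≡ m≡ (trans x≡ (identity a b c d))
  where
  identity : ∀ a b c d → a * b + + 2 * (c * d) ≡ b * a + + 2 * (d * c)
  identity = solve-∀

-- The substitution X ↦ X + Y in the form.
translate : ∀ {m k x} → Represented m k x → Represented m (m ℕ.+ 2 ℕ.* x ℕ.+ k) (m ℕ.+ x)
translate {m} {k} {x} (represented a b c d m≡ k≡ x≡) = represented a (a + b) c (c + d) m≡
  (trans (cong (λ z → + m + z + + k) (ℤ.pos-* 2 x)) (trans (cong₂ _+_ (cong₂ (λ y z → y + + 2 * z) m≡ x≡) k≡) (k-identity a b c d)))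
  (trans (cong₂ _+_ m≡ x≡) (x-identity a b c d))
  where
  k-identity : ∀ a b c d → a * a + + 2 * (c * c) + + 2 * (a * b + + 2 * (c * d)) + (b * b + + 2 * (d * d)) ≡
    (a + b) * (a + b) + + 2 * ((c + d) * (c + d))
  k-identity = solve-∀
  x-identity : ∀ a b c d → a * a + + 2 * (c * c) + (a * b + + 2 * (c * d)) ≡ a * (a + b) + + 2 * (c * (c + d))
  x-identity = solve-∀

-- The substitution X ↦ X + Y, Y ↦ -Y, with the relations x = m - x′ and k = m - 2x′ + k′ written
-- additively to stay within ℕ.
reflect : ∀ {m k k′ x x′} → x ℕ.+ x′ ≡ m → k ℕ.+ 2 ℕ.* x′ ≡ m ℕ.+ k′ → Represented m k′ x′ → Represented m k x
reflect {m} {k} {k′} {x} {x′} x+x′≡m k+2x′≡m+k′ (represented a b c d m≡ k′≡ x′≡) = represented a (a - b) c (c - d) m≡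
  (trans (cancel (+ k) (+ 2 * + x′)) (trans (cong₂ _-_ (trans (cong (_+_ (+ k)) (sym (ℤ.pos-* 2 x′))) (cong +_ k+2x′≡m+k′)) refl)
    (trans (cong₂ _-_ (cong₂ _+_ m≡ k′≡) (cong (+ 2 *_) x′≡)) (k-identity a b c d))))
  (trans (cancel (+ x) (+ x′)) (trans (cong₂ _-_ (trans (cong +_ x+x′≡m) m≡) x′≡) (x-identity a b c d)))
  where
  cancel : ∀ y z → y ≡ y + z - z
  cancel = solve-∀
  k-identity : ∀ a b c d → a * a + + 2 * (c * c) + (b * b + + 2 * (d * d)) - + 2 * (a * b + + 2 * (c * d)) ≡
    (a - b) * (a - b) + + 2 * ((c - d) * (c - d))
  k-identity = solve-∀
  x-identity : ∀ a b c d → a * a + + 2 * (c * c) - (a * b + + 2 * (c * d)) ≡ a * (a - b) + + 2 * (c * (c - d))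
  x-identity = solve-∀

-- Reduction of forms of determinant 2. For x > 0 one of m and k is below 2x, since 4x² > x² + 2; if
-- it is m, x can be replaced by the smaller |x - m|. At x = 0 the form is X² + 2Y² or 2X² + Y².
represent : ∀ x m k → m ℕ.* k ≡ x ℕ.* x ℕ.+ 2 → Represented m k x
represent = <-rec (λ x → ∀ m k → m ℕ.* k ≡ x ℕ.* x ℕ.+ 2 → Represented m k x) step
  where
  Rec : ℕ → Set
  Rec x = ∀ {x′} → x′ ℕ.< x → ∀ m k → m ℕ.* k ≡ x′ ℕ.* x′ ℕ.+ 2 → Represented m k x′

  reduce : ∀ x → Rec x → ∀ m k → m ℕ.< 2 ℕ.* x → m ℕ.* k ≡ x ℕ.* x ℕ.+ 2 → Represented m k x
  reduce x rec zero k m<2x mk≡ = contradiction (trans mk≡ (ℕ.+-comm (x ℕ.* x) 2)) λ ()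
  reduce x rec m@(suc _) k m<2x mk≡ with ℕ.≤-total m x
  ... | inj₁ m≤x with ℕ.m≤n⇒∃[o]m+o≡n m≤x
  ...   | x′ , refl = subst (λ k → Represented m k x) k≡ (translate (rec (ℕ.m<n+m x′ (s≤s z≤n)) m k′ mk′≡))
    where
    expand : ∀ m x → (m ℕ.+ x) ℕ.* (m ℕ.+ x) ℕ.+ 2 ≡ m ℕ.* (m ℕ.+ 2 ℕ.* x) ℕ.+ (x ℕ.* x ℕ.+ 2)
    expand = ℕ-Solver.solve-∀
    mk≡′ : m ℕ.* k ≡ m ℕ.* (m ℕ.+ 2 ℕ.* x′) ℕ.+ (x′ ℕ.* x′ ℕ.+ 2)
    mk≡′ = trans mk≡ (expand m x′)
    k′ : ℕ
    k′ = k ℕ.∸ (m ℕ.+ 2 ℕ.* x′)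
    k≡ : m ℕ.+ 2 ℕ.* x′ ℕ.+ k′ ≡ k
    k≡ = ℕ.m+[n∸m]≡n {m ℕ.+ 2 ℕ.* x′} (ℕ.*-cancelˡ-≤ {m ℕ.+ 2 ℕ.* x′} {k} m
      (ℕ.m+n≤o⇒m≤o (m ℕ.* (m ℕ.+ 2 ℕ.* x′)) (ℕ.≤-reflexive (sym mk≡′))))
    mk′≡ : m ℕ.* k′ ≡ x′ ℕ.* x′ ℕ.+ 2
    mk′≡ = ℕ.+-cancelˡ-≡ (m ℕ.* (m ℕ.+ 2 ℕ.* x′)) _ _
      (trans (sym (ℕ.*-distribˡ-+ m (m ℕ.+ 2 ℕ.* x′) k′)) (trans (cong (m ℕ.*_) k≡) mk≡′))
  reduce x rec m@(suc _) k m<2x mk≡ | inj₂ x≤m with ℕ.m≤n⇒∃[o]m+o≡n x≤m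
  ...   | x′ , x+x′≡m = reflect x+x′≡m (sym k′≡) (rec x′<x m k′ mk′≡)
    where
    x′<x : x′ ℕ.< x
    x′<x = ℕ.+-cancelˡ-< x x′ x (subst (ℕ._< x ℕ.+ x) (sym x+x′≡m) (subst (m ℕ.<_) (cong (x ℕ.+_) (ℕ.+-identityʳ x)) m<2x))
    expand : ∀ x x′ → x ℕ.* x ℕ.+ 2 ℕ.+ (x ℕ.+ x′) ℕ.* (2 ℕ.* x′) ≡ (x ℕ.+ x′) ℕ.* (x ℕ.+ x′) ℕ.+ (x′ ℕ.* x′ ℕ.+ 2)
    expand = ℕ-Solver.solve-∀
    total : m ℕ.* (k ℕ.+ 2 ℕ.* x′) ≡ m ℕ.* m ℕ.+ (x′ ℕ.* x′ ℕ.+ 2)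
    total = trans (ℕ.*-distribˡ-+ m k (2 ℕ.* x′)) (trans (cong (ℕ._+ m ℕ.* (2 ℕ.* x′)) mk≡)
      (subst (λ m → x ℕ.* x ℕ.+ 2 ℕ.+ m ℕ.* (2 ℕ.* x′) ≡ m ℕ.* m ℕ.+ (x′ ℕ.* x′ ℕ.+ 2)) x+x′≡m (expand x x′)))
    k′ : ℕ
    k′ = k ℕ.+ 2 ℕ.* x′ ℕ.∸ m
    k′≡ : m ℕ.+ k′ ≡ k ℕ.+ 2 ℕ.* x′
    k′≡ = ℕ.m+[n∸m]≡n {m} (ℕ.*-cancelˡ-≤ {m} {k ℕ.+ 2 ℕ.* x′} m (ℕ.m+n≤o⇒m≤o (m ℕ.* m) (ℕ.≤-reflexive (sym total))))
    mk′≡ : m ℕ.* k′ ≡ x′ ℕ.* x′ ℕ.+ 2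
    mk′≡ = ℕ.+-cancelˡ-≡ (m ℕ.* m) _ _ (trans (sym (ℕ.*-distribˡ-+ m m k′)) (trans (cong (m ℕ.*_) k′≡) total))

  step : ∀ x → Rec x → ∀ m k → m ℕ.* k ≡ x ℕ.* x ℕ.+ 2 → Represented m k x
  step zero rec 0 k ()
  step zero rec 1 k mk≡ = represented 1ℤ 0ℤ 0ℤ 1ℤ refl (cong +_ (trans (sym (ℕ.*-identityˡ k)) mk≡)) refl
  step zero rec 2 k mk≡ = represented 0ℤ 1ℤ 1ℤ 0ℤ refl (cong +_ (ℕ.*-cancelˡ-≡ k 1 2 mk≡)) refl
  step zero rec m@(suc (suc (suc _))) zero mk≡ = contradiction (trans (sym (ℕ.*-zeroʳ m)) mk≡) λ ()
  step zero rec m@(suc (suc (suc _))) k@(suc _) mk≡ =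
    contradiction (ℕ.≤-trans (ℕ.m≤m*n m k) (ℕ.≤-reflexive mk≡)) λ { (s≤s (s≤s ())) }
  step x@(suc _) rec m k mk≡ with m ℕ.<? 2 ℕ.* x | k ℕ.<? 2 ℕ.* x
  ... | yes m<2x | _        = reduce x rec m k m<2x mk≡
  ... | no _     | yes k<2x = transpose (reduce x rec k m k<2x (trans (ℕ.*-comm k m) mk≡))
  ... | no m≮2x  | no k≮2x  = contradiction (ℕ.≤-trans (ℕ.*-mono-≤ (ℕ.≮⇒≥ m≮2x) (ℕ.≮⇒≥ k≮2x)) (ℕ.≤-reflexive mk≡)) (ℕ.<⇒≱ bound)
    where
    square : ∀ x → 2 ℕ.* x ℕ.* (2 ℕ.* x) ≡ x ℕ.* x ℕ.+ 3 ℕ.* (x ℕ.* x)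
    square = ℕ-Solver.solve-∀
    bound : x ℕ.* x ℕ.+ 2 ℕ.< 2 ℕ.* x ℕ.* (2 ℕ.* x)
    bound = subst (x ℕ.* x ℕ.+ 2 ℕ.<_) (sym (square x)) (ℕ.+-monoʳ-< (x ℕ.* x) (ℕ.*-monoʳ-≤ 3 {1} {x ℕ.* x} (s≤s z≤n)))

-- Norms modulo 8

residue : ∀ n .{{_ : NonZero n}} {m r} t → r ℕ.< n → + m ≡ + r + + n * t → m % n ≡ r
residue n {m} {r} (+ u) r<n m≡ =
  trans (cong (_% n) (trans (ℤ.+-injective (trans m≡ (cong (_+_ (+ r)) (sym (ℤ.pos-* n u))))) (cong (r ℕ.+_) (ℕ.*-comm n u))))
        (trans (ℕ.[m+kn]%n≡m%n r u n) (ℕ.m<n⇒m%n≡m r<n))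
residue n {m} {r} -[1+ u ] r<n m≡ = contradiction
  (ℕ.≤-trans (ℕ.m≤m*n n (suc u)) (ℕ.m+n≤o⇒n≤o m (ℕ.≤-reflexive (ℤ.+-injective sum≡)))) (ℕ.<⇒≱ r<n)
  where
  cancel : ∀ r n u → r + n * - u + n * u ≡ r
  cancel = solve-∀
  sum≡ : + m + + (n ℕ.* suc u) ≡ + r
  sum≡ = trans (cong₂ _+_ m≡ (ℤ.pos-* n (suc u))) (cancel (+ r) (+ n) (+ suc u))

quotient : ∀ n .{{_ : NonZero n}} {m r} → m % n ≡ r → + m ≡ + r + + n * + (m ℕ./ n)
quotient n {m} refl = trans (cong +_ (trans (ℕ.m≡m%n+[m/n]*n m n) (cong (m % n ℕ.+_) (ℕ.*-comm (m ℕ./ n) n))))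
  (cong (_+_ (+ (m % n))) (ℤ.pos-* n (m ℕ./ n)))

even-odd-absurd : ∀ {n} → Even n → Odd n → ⊥
even-odd-absurd (h , refl) (h′ , eq) = contradiction (ℕ.m*n≡1⇒m≡1 2 ∣ h - h′ ∣ (trans (sym (ℤ.abs-* (+ 2) (h - h′))) (cong ∣_∣ difference))) λ ()
  where
  distrib : ∀ h h′ → + 2 * (h - h′) ≡ + 2 * h - + 2 * h′
  distrib = solve-∀
  cancel : ∀ x → 1ℤ + x - x ≡ 1ℤ
  cancel = solve-∀
  difference : + 2 * (h - h′) ≡ 1ℤ
  difference = trans (distrib h h′) (trans (cong (_- + 2 * h′) eq) (cancel (+ 2 * h′)))

odd-nonZero : ∀ {n} → Odd (+ n) → n ≢ 0
odd-nonZero n-odd refl = even-odd-absurd (0ℤ , refl) n-odd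

%8≡3⇒odd : ∀ {m} → m % 8 ≡ 3 → Odd (+ m)
%8≡3⇒odd {m} m%8≡3 = 1ℤ + + 4 * + (m ℕ./ 8) , trans (quotient 8 m%8≡3) (identity (+ (m ℕ./ 8)))
  where
  identity : ∀ u → + 3 + + 8 * u ≡ 1ℤ + + 2 * (1ℤ + + 4 * u)
  identity = solve-∀

data NormClass (m : ℕ) (a b : ℤ) : Set where
  evenNorm      : Even (+ m) → NormClass m a b
  oneModEight   : m % 8 ≡ 1 → NormClass m a b
  threeModEight : m % 8 ≡ 3 → Odd a → Odd b → NormClass m a b

odd-odd-norm : ∀ {a b} → Odd a → Odd b → ∃ λ t → norm a b ≡ + 3 + + 8 * t
odd-odd-norm (x , refl) (y , refl) with odd-square x | odd-square y
... | s , eqs | t , eqt = s + + 2 * t , trans (cong₂ (λ u v → u + + 2 * v) eqs eqt) (identity s t)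
  where
  identity : ∀ s t → 1ℤ + + 8 * s + + 2 * (1ℤ + + 8 * t) ≡ + 3 + + 8 * (s + + 2 * t)
  identity = solve-∀

odd-even-norm : ∀ {a b} → Odd a → Even b → ∃ λ t → norm a b ≡ 1ℤ + + 8 * t
odd-even-norm (x , refl) (y , refl) with odd-square x
... | s , eqs = s + y * y , trans (cong (λ u → u + + 2 * (+ 2 * y * (+ 2 * y))) eqs) (identity s y)
  where
  identity : ∀ s y → 1ℤ + + 8 * s + + 2 * (+ 2 * y * (+ 2 * y)) ≡ 1ℤ + + 8 * (s + y * y)
  identity = solve-∀

even-or-odd : ∀ n → Even n ⊎ Odd n
even-or-odd n with parity n
... | isEven h = inj₁ (h , refl)
... | isOdd h  = inj₂ (h , refl)

normClass : ∀ m a b → + m ≡ norm a b → NormClass m a b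
normClass m a b m≡ with even-or-odd a | even-or-odd b
... | inj₁ a-even | _           = evenNorm (subst Even (sym m≡) (norm-even b a-even))
... | inj₂ a-odd  | inj₁ b-even = let t , eq = odd-even-norm a-odd b-even in oneModEight (residue 8 t (s≤s (s≤s z≤n)) (trans m≡ eq))
... | inj₂ a-odd  | inj₂ b-odd  = let t , eq = odd-odd-norm a-odd b-odd in
  threeModEight (residue 8 t (s≤s (s≤s (s≤s (s≤s z≤n)))) (trans m≡ eq)) a-odd b-odd

divisor-represented : ∀ {m x} → m ℕ.∣ x ℕ.* x ℕ.+ 2 → ∃ λ a → ∃ λ b → + m ≡ norm a b
divisor-represented {m} {x} (divides k eq) = a , c , m≡
  where open Represented (represent x m k (trans (ℕ.*-comm m k) (sym eq)))

-- Prime factors congruent to 3 modulo 8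

Prime₃ : ℕ → Set
Prime₃ p = Prime p × p % 8 ≡ 3

-- Each prime factor is itself of the form a² + 2 b², hence 1 or 3 modulo 8 when odd. Dropping a
-- factor 1 keeps the rest at 3, and the empty product is 1, so the search must succeed.
prime₃-factor : ∀ x ps → All Prime ps → product ps % 8 ≡ 3 → product ps ℕ.∣ x ℕ.* x ℕ.+ 2 → ∃ λ p → Prime₃ p × p ℕ.∣ product ps
prime₃-factor x []       []         ()
prime₃-factor x (p ∷ ps) (pr ∷ prs) m%8≡3 m∣x²+2
  with a , b , p≡ ← divisor-represented {p} {x} (ℕ.∣-trans (ℕ.m∣m*n (product ps)) m∣x²+2) with normClass p a b p≡
... | threeModEight p%8≡3 _ _ = p , (pr , p%8≡3) , ℕ.m∣m*n (product ps)
... | evenNorm (h , eq)   = ⊥-elim (even-odd-absurd (h * + product ps , trans (ℤ.pos-* p (product ps)) (trans (cong (_* + product ps) eq) (ℤ.*-assoc (+ 2) h (+ product ps)))) (%8≡3⇒odd m%8≡3))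
... | oneModEight p%8≡1       = let q , prime₃ , q∣ = prime₃-factor x ps prs rest%8≡3 (ℕ.∣-trans (ℕ.n∣m*n p) m∣x²+2) in q , prime₃ , ℕ.∣-trans q∣ (ℕ.n∣m*n p)
  where
  rest%8≡3 : product ps % 8 ≡ 3
  rest%8≡3 = trans (sym (ℕ.m%n%n≡m%n (product ps) 8)) (trans (cong (_% 8) (sym (ℕ.*-identityˡ (product ps % 8))))
    (trans (cong (λ r → (r ℕ.* (product ps % 8)) % 8) (sym p%8≡1)) (trans (sym (ℕ.%-distribˡ-* p (product ps) 8)) m%8≡3)))

even-* : ∀ {m} n → Even m → Even (m * n)
even-* n (h , refl) = h * n , ℤ.*-assoc (+ 2) h n

odd-factorˡ : ∀ m n → Odd (m * n) → Odd m
odd-factorˡ m n mn-odd with even-or-odd m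
... | inj₁ m-even = ⊥-elim (even-odd-absurd (even-* n m-even) mn-odd)
... | inj₂ m-odd  = m-odd

odd-abs : ∀ n → Odd n → Odd (+ ∣ n ∣)
odd-abs (+ n)    n-odd    = n-odd
odd-abs -[1+ n ] (h , eq) = - h - 1ℤ , trans (cong -_ eq) (identity h)
  where
  identity : ∀ h → - (1ℤ + + 2 * h) ≡ 1ℤ + + 2 * (- h - 1ℤ)
  identity = solve-∀

square-abs : ∀ n → n * n ≡ + ∣ n ∣ * + ∣ n ∣
square-abs (+ n)    = refl
square-abs -[1+ n ] = refl

norm-abs : ∀ a b → norm a b ≡ norm (+ ∣ a ∣) (+ ∣ b ∣)
norm-abs a b = cong₂ (λ x y → x + + 2 * y) (square-abs a) (square-abs b)

pos-norm : ∀ a b → + (a ℕ.* a ℕ.+ 2 ℕ.* (b ℕ.* b)) ≡ norm (+ a) (+ b)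
pos-norm a b = cong₂ _+_ (ℤ.pos-* a a) (trans (ℤ.pos-* 2 (b ℕ.* b)) (cong (+ 2 *_) (ℤ.pos-* b b)))

norm-multiplicative : ∀ c d e f → norm (c * f - + 2 * (d * e)) (c * e + d * f) ≡ norm f e * norm c d
norm-multiplicative = identity
  where
  identity : ∀ c d e f → (c * f - + 2 * (d * e)) * (c * f - + 2 * (d * e)) + + 2 * ((c * e + d * f) * (c * e + d * f)) ≡
    (f * f + + 2 * (e * e)) * (c * c + + 2 * (d * d))
  identity = solve-∀

-- If e c + f d = 1, then (c + d √-2) (f + e √-2) = x + √-2 for some integer x.
norm-divides : ∀ c d e f → + c * e + + d * f ≡ 1ℤ →
  ∃ λ x → c ℕ.* c ℕ.+ 2 ℕ.* (d ℕ.* d) ℕ.∣ x ℕ.* x ℕ.+ 2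
norm-divides c d e f bezout = ∣ X ∣ , divides (∣ f ∣ ℕ.* ∣ f ∣ ℕ.+ 2 ℕ.* (∣ e ∣ ℕ.* ∣ e ∣)) (ℤ.+-injective (begin
  + (∣ X ∣ ℕ.* ∣ X ∣ ℕ.+ 2)                             ≡⟨ cong (_+ + 2) (trans (ℤ.pos-* ∣ X ∣ ∣ X ∣) (sym (square-abs X))) ⟩
  norm X 1ℤ                                             ≡⟨ cong (norm X) bezout ⟨
  norm X (+ c * e + + d * f)                            ≡⟨ norm-multiplicative (+ c) (+ d) e f ⟩
  norm f e * norm (+ c) (+ d)                           ≡⟨ cong₂ _*_ (trans (norm-abs f e) (sym (pos-norm ∣ f ∣ ∣ e ∣))) (sym (pos-norm c d)) ⟩
  + (∣ f ∣ ℕ.* ∣ f ∣ ℕ.+ 2 ℕ.* (∣ e ∣ ℕ.* ∣ e ∣)) * + (c ℕ.* c ℕ.+ 2 ℕ.* (d ℕ.* d)) ≡⟨ ℤ.pos-* (∣ f ∣ ℕ.* ∣ f ∣ ℕ.+ 2 ℕ.* (∣ e ∣ ℕ.* ∣ e ∣)) (c ℕ.* c ℕ.+ 2 ℕ.* (d ℕ.* d)) ⟨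
  + ((∣ f ∣ ℕ.* ∣ f ∣ ℕ.+ 2 ℕ.* (∣ e ∣ ℕ.* ∣ e ∣)) ℕ.* (c ℕ.* c ℕ.+ 2 ℕ.* (d ℕ.* d))) ∎))
  where
  open ≡-Reasoning
  X : ℤ
  X = + c * f - + 2 * (+ d * e)

-- Bézout's identity over ℕ, divided by the gcd `suc g` and carried to ℤ. It comes in two
-- orientations, of which the other is obtained by exchanging c and d.
bezout-reduced⁺ : ∀ {c₀ d₀ g} c d x y → c₀ ≡ c ℕ.* suc g → d₀ ≡ d ℕ.* suc g → suc g ℕ.+ y ℕ.* d₀ ≡ x ℕ.* c₀ →
  ∃ λ e → ∃ λ f → + c * e + + d * f ≡ 1ℤ
bezout-reduced⁺ {g = g} c d x y refl refl eq = + x , - + y , ℤ.*-cancelʳ-≡ (+ c * + x + + d * - + y) 1ℤ (+ suc g) (begin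
  (+ c * + x + + d * - + y) * + suc g                    ≡⟨ expand (+ c) (+ d) (+ x) (+ y) (+ suc g) ⟩
  + x * (+ c * + suc g) - + y * (+ d * + suc g)          ≡⟨ cong₂ (λ u v → + x * u - + y * v) (ℤ.pos-* c (suc g)) (ℤ.pos-* d (suc g)) ⟨
  + x * + (c ℕ.* suc g) - + y * + (d ℕ.* suc g)          ≡⟨ cong₂ _-_ (ℤ.pos-* x (c ℕ.* suc g)) (ℤ.pos-* y (d ℕ.* suc g)) ⟨
  + (x ℕ.* (c ℕ.* suc g)) - + (y ℕ.* (d ℕ.* suc g))      ≡⟨ cong (λ z → + z - + (y ℕ.* (d ℕ.* suc g))) eq ⟨
  + suc g + + (y ℕ.* (d ℕ.* suc g)) - + (y ℕ.* (d ℕ.* suc g)) ≡⟨ cancel (+ suc g) (+ (y ℕ.* (d ℕ.* suc g))) ⟩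
  1ℤ * + suc g ∎)
  where
  open ≡-Reasoning
  expand : ∀ c d x y g → (c * x + d * - y) * g ≡ x * (c * g) - y * (d * g)
  expand = solve-∀
  cancel : ∀ g z → g + z - z ≡ 1ℤ * g
  cancel = solve-∀

bezout-reduced : ∀ {c₀ d₀ g} c d → c₀ ≡ c ℕ.* suc g → d₀ ≡ d ℕ.* suc g → Bézout.Identity (suc g) c₀ d₀ →
  ∃ λ e → ∃ λ f → + c * e + + d * f ≡ 1ℤ
bezout-reduced c d c₀≡ d₀≡ (Bézout.+- x y eq) = bezout-reduced⁺ c d x y c₀≡ d₀≡ eq
bezout-reduced c d c₀≡ d₀≡ (Bézout.-+ x y eq) =
  let f , e , bezout = bezout-reduced⁺ d c y x d₀≡ c₀≡ eq in e , f , trans (ℤ.+-comm (+ c * e) (+ d * f)) bezout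

coprime-norm-prime₃-factor : ∀ c d e f → Odd (+ c) → Odd (+ d) → + c * e + + d * f ≡ 1ℤ →
  ∃ λ p → Prime₃ p × p ℕ.∣ c ℕ.* c ℕ.+ 2 ℕ.* (d ℕ.* d)
coprime-norm-prime₃-factor c d e f c-odd d-odd bezout =
  let x , N∣x²+2 = norm-divides c d e f bezout
      p , prime₃ , p∣ = prime₃-factor x factors factorsPrime (subst (λ n → n % 8 ≡ 3) isFactorisation N%8≡3)
                                                             (subst (ℕ._∣ x ℕ.* x ℕ.+ 2) isFactorisation N∣x²+2)
  in p , prime₃ , subst (p ℕ.∣_) (sym isFactorisation) p∣
  where
  N : ℕ
  N = c ℕ.* c ℕ.+ 2 ℕ.* (d ℕ.* d)
  N%8≡3 : N % 8 ≡ 3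
  N%8≡3 = let t , eq = odd-odd-norm c-odd d-odd in residue 8 t (s≤s (s≤s (s≤s (s≤s z≤n)))) (trans (pos-norm c d) eq)
  instance
    N-nonZero : NonZero N
    N-nonZero = ℕ.≢-nonZero λ N≡0 → contradiction (trans (sym N%8≡3) (cong (_% 8) N≡0)) λ ()
  open PrimeFactorisation (factorise N)

norm-prime₃-factor : ∀ c d → Odd c → Odd d → ∃ λ p → Prime₃ p × ∃ λ q → norm c d ≡ q * + p
norm-prime₃-factor c d c-odd d-odd = from-bezout (Bézout.lemma ∣ c ∣ ∣ d ∣)
  where
  Goal : Set
  Goal = ∃ λ p → Prime₃ p × ∃ λ q → norm c d ≡ q * + p
  homogeneous : ∀ c d g → c * g * (c * g) + + 2 * (d * g * (d * g)) ≡ g * g * (c * c + + 2 * (d * d))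
  homogeneous = solve-∀
  scale : ∀ g c₀ d₀ → ∣ c ∣ ≡ c₀ ℕ.* g → ∣ d ∣ ≡ d₀ ℕ.* g →
    (∃ λ p → Prime₃ p × p ℕ.∣ c₀ ℕ.* c₀ ℕ.+ 2 ℕ.* (d₀ ℕ.* d₀)) → Goal
  scale g c₀ d₀ c≡ d≡ (p , prime₃ , divides q N≡) = p , prime₃ , + g * + g * + q , (begin
    norm c d                            ≡⟨ norm-abs c d ⟩
    norm (+ ∣ c ∣) (+ ∣ d ∣)            ≡⟨ cong₂ norm (trans (cong +_ c≡) (ℤ.pos-* c₀ g)) (trans (cong +_ d≡) (ℤ.pos-* d₀ g)) ⟩
    norm (+ c₀ * + g) (+ d₀ * + g)      ≡⟨ homogeneous (+ c₀) (+ d₀) (+ g) ⟩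
    + g * + g * norm (+ c₀) (+ d₀)      ≡⟨ cong (+ g * + g *_) (trans (sym (pos-norm c₀ d₀)) (trans (cong +_ N≡) (ℤ.pos-* q p))) ⟩
    + g * + g * (+ q * + p)             ≡⟨ ℤ.*-assoc (+ g * + g) (+ q) (+ p) ⟨
    + g * + g * + q * + p               ∎)
    where open ≡-Reasoning
  reduced-odd : ∀ {n} g n₀ → Odd n → ∣ n ∣ ≡ n₀ ℕ.* g → Odd (+ n₀)
  reduced-odd {n} g n₀ n-odd n≡ = odd-factorˡ (+ n₀) (+ g) (subst Odd (trans (cong +_ n≡) (ℤ.pos-* n₀ g)) (odd-abs n n-odd))
  from-divisors : ∀ g → g ℕ.∣ ∣ c ∣ → g ℕ.∣ ∣ d ∣ → Bézout.Identity g ∣ c ∣ ∣ d ∣ → Goal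
  from-divisors zero    (divides c₀ c≡) _ _ = ⊥-elim (odd-nonZero (odd-abs c c-odd) (trans c≡ (ℕ.*-zeroʳ c₀)))
  from-divisors (suc g) (divides c₀ c≡) (divides d₀ d≡) identity =
    let e , f , bezout = bezout-reduced c₀ d₀ c≡ d≡ identity in
    scale (suc g) c₀ d₀ c≡ d≡ (coprime-norm-prime₃-factor c₀ d₀ e f (reduced-odd (suc g) c₀ c-odd c≡) (reduced-odd (suc g) d₀ d-odd d≡) bezout)
  from-bezout : Bézout.Lemma ∣ c ∣ ∣ d ∣ → Goal
  from-bezout (Bézout.result g G identity) = from-divisors g (proj₁ (GCD.commonDivisor G)) (proj₂ (GCD.commonDivisor G)) identity

-- Fermat's little theorem for the base 2

nC0≡1 : ∀ n → n choose 0 ≡ 1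
nC0≡1 n = trans (nCk≡nC[n∸k] {0} {n} z≤n) (nCn≡1 n)

absorption : ∀ n k → suc k ℕ.* (suc n choose suc k) ≡ suc n ℕ.* (n choose k)
absorption zero    zero    = refl
absorption zero    (suc k) = trans (cong (suc (suc k) ℕ.*_) (k>n⇒nCk≡0 {1} {suc (suc k)} (s≤s (s≤s z≤n))))
  (trans (ℕ.*-zeroʳ (suc (suc k))) (sym (trans (ℕ.*-identityˡ _) (k>n⇒nCk≡0 {0} {suc k} (s≤s z≤n)))))
absorption (suc n) zero    = trans (ℕ.*-identityˡ _) (trans (nC1≡n (suc (suc n)))
  (sym (trans (cong (suc (suc n) ℕ.*_) (nC0≡1 (suc n))) (ℕ.*-identityʳ _))))
absorption (suc n) (suc k) = begin
  suc (suc k) ℕ.* (suc (suc n) choose suc (suc k))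
    ≡⟨ cong (suc (suc k) ℕ.*_) (nCk+nC[k+1]≡[n+1]C[k+1] (suc n) (suc k)) ⟨
  suc (suc k) ℕ.* (A ℕ.+ (suc n choose suc (suc k)))
    ≡⟨ ℕ.*-distribˡ-+ (suc (suc k)) A (suc n choose suc (suc k)) ⟩
  A ℕ.+ suc k ℕ.* A ℕ.+ suc (suc k) ℕ.* (suc n choose suc (suc k))
    ≡⟨ cong₂ (λ y z → A ℕ.+ y ℕ.+ z) (absorption n k) (absorption n (suc k)) ⟩
  A ℕ.+ suc n ℕ.* (n choose k) ℕ.+ suc n ℕ.* (n choose suc k)
    ≡⟨ ℕ.+-assoc A (suc n ℕ.* (n choose k)) (suc n ℕ.* (n choose suc k)) ⟩
  A ℕ.+ (suc n ℕ.* (n choose k) ℕ.+ suc n ℕ.* (n choose suc k))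
    ≡⟨ cong (A ℕ.+_) (trans (sym (ℕ.*-distribˡ-+ (suc n) (n choose k) (n choose suc k))) (cong (suc n ℕ.*_) (nCk+nC[k+1]≡[n+1]C[k+1] n k))) ⟩
  suc (suc n) ℕ.* A ∎
  where
  open ≡-Reasoning
  A : ℕ
  A = suc n choose suc k

rowSum : ℕ → ℕ → ℕ
rowSum n zero    = n choose 0
rowSum n (suc j) = rowSum n j ℕ.+ (n choose suc j)

rowSum-suc : ∀ n j → rowSum (suc n) (suc j) ≡ rowSum n j ℕ.+ rowSum n (suc j)
rowSum-suc n zero    = cong₂ ℕ._+_ (trans (nC0≡1 (suc n)) (sym (nC0≡1 n))) (sym (nCk+nC[k+1]≡[n+1]C[k+1] n 0))
rowSum-suc n (suc j) = trans (cong₂ ℕ._+_ (rowSum-suc n j) (sym (nCk+nC[k+1]≡[n+1]C[k+1] n (suc j))))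
  (rearrange (rowSum n j) (rowSum n (suc j)) (n choose suc j) (n choose suc (suc j)))
  where
  rearrange : ∀ a b c d → a ℕ.+ b ℕ.+ (c ℕ.+ d) ≡ a ℕ.+ c ℕ.+ (b ℕ.+ d)
  rearrange = ℕ-Solver.solve-∀

rowSum-full : ∀ n j → n ℕ.≤ j → rowSum n j ≡ 2 ℕ.^ n
rowSum-full zero    zero    _         = refl
rowSum-full zero    (suc j) _         = trans (cong₂ ℕ._+_ (rowSum-full zero j z≤n) (k>n⇒nCk≡0 {0} {suc j} (s≤s z≤n))) refl
rowSum-full (suc n) (suc j) (s≤s n≤j) = trans (rowSum-suc n j)
  (cong₂ ℕ._+_ (rowSum-full n j n≤j) (trans (rowSum-full n (suc j) (ℕ.m≤n⇒m≤1+n n≤j)) (sym (ℕ.+-identityʳ _))))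

-- By absorption p divides (j + 1) times the binomial coefficient, but not j + 1, which is smaller
-- than p.
prime∣binomial : ∀ {p} → Prime p → ∀ j → suc j ℕ.< p → p ℕ.∣ (p choose suc j)
prime∣binomial {suc n} pr j j<p with euclidsLemma (suc j) (suc n choose suc j) pr
                                     (divides (n choose j) (trans (absorption n j) (ℕ.*-comm (suc n) (n choose j))))
... | inj₁ p∣j = contradiction (ℕ.∣⇒≤ p∣j) (ℕ.<⇒≱ j<p)
... | inj₂ p∣C = p∣C

rowSum-prime : ∀ {p} → Prime p → ∀ j → j ℕ.< p → ∃ λ y → rowSum p j ≡ 1 ℕ.+ y ℕ.* p
rowSum-prime {p} pr zero    _   = 0 , nC0≡1 p
rowSum-prime {p} pr (suc j) j<p with rowSum-prime pr j (ℕ.<-trans (ℕ.n<1+n j) j<p) | prime∣binomial pr j j<p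
... | y , eq | divides z eq′ = y ℕ.+ z , trans (cong₂ ℕ._+_ eq eq′) (cong suc (sym (ℕ.*-distribʳ-+ p y z)))

-- 2^p is the sum of row p of Pascal's triangle; its two ends are 1 and p divides the rest.
fermat-two : ∀ {p} → Prime p → ∃ λ y → 2 ℕ.^ p ≡ 2 ℕ.+ y ℕ.* p
fermat-two {suc n} pr with rowSum-prime pr n (ℕ.n<1+n n)
... | y , eq = y , trans (sym (rowSum-full (suc n) (suc n) ℕ.≤-refl))
  (trans (cong₂ ℕ._+_ eq (nCn≡1 (suc n))) (ℕ.+-comm (1 ℕ.+ y ℕ.* suc n) 1))

-- Odd moduli for which 2 is a square

odd-difference : ∀ {m n} → Odd m → Even n → Odd (m - n)
odd-difference (x , refl) (y , refl) = x - y , identity x y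
  where
  identity : ∀ x y → 1ℤ + + 2 * x - + 2 * y ≡ 1ℤ + + 2 * (x - y)
  identity = solve-∀

-- Replacing x by a residue modulo m, or by m minus that residue, makes x odd without exceeding m.
odd-root : ∀ m .{{_ : NonZero m}} → Odd (+ m) → ∀ x k → x * x ≡ + 2 + + m * k →
  ∃ λ y → y ℕ.≤ m × Odd (+ y) × ∃ λ k → + y * + y ≡ + 2 + + m * k
odd-root m m-odd x k x²≡ with even-or-odd (+ (x ℤ.%ℕ m))
... | inj₂ r-odd = x ℤ.%ℕ m , ℕ.<⇒≤ (ℤ.n%ℕd<d x m) , r-odd , K , r²≡
  where
  Q K : ℤ
  Q = x ℤ./ℕ m
  K = k - + 2 * + (x ℤ.%ℕ m) * Q - Q * Q * + m
  isolate : ∀ r Q m → r * r ≡ (r + Q * m) * (r + Q * m) - m * (+ 2 * r * Q + Q * Q * m)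
  isolate = solve-∀
  collect : ∀ k r Q m → + 2 + m * k - m * (+ 2 * r * Q + Q * Q * m) ≡ + 2 + m * (k - + 2 * r * Q - Q * Q * m)
  collect = solve-∀
  r²≡ : + (x ℤ.%ℕ m) * + (x ℤ.%ℕ m) ≡ + 2 + + m * K
  r²≡ = trans (isolate (+ (x ℤ.%ℕ m)) Q (+ m))
    (trans (cong (λ z → z * z - + m * (+ 2 * + (x ℤ.%ℕ m) * Q + Q * Q * + m)) (sym (ℤ.a≡a%ℕn+[a/ℕn]*n x m)))
    (trans (cong (_- + m * (+ 2 * + (x ℤ.%ℕ m) * Q + Q * Q * + m)) x²≡) (collect k (+ (x ℤ.%ℕ m)) Q (+ m))))
... | inj₁ r-even = m ℕ.∸ r , ℕ.m∸n≤m m r , subst Odd (sym y≡) (odd-difference m-odd r-even) , K ,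
    trans (cong₂ _*_ y≡ y≡) y²≡
  where
  r : ℕ
  r = x ℤ.%ℕ m
  Q K : ℤ
  Q = x ℤ./ℕ m
  K = k - + 2 * (+ r + Q * + m) * (Q + 1ℤ) + (Q + 1ℤ) * (Q + 1ℤ) * + m
  y≡ : + (m ℕ.∸ r) ≡ + m - + r
  y≡ = trans (sym (ℤ.⊖-≥ (ℕ.<⇒≤ (ℤ.n%ℕd<d x m)))) (sym (ℤ.m-n≡m⊖n m r))
  isolate : ∀ r Q m → (m - r) * (m - r) ≡
    (r + Q * m) * (r + Q * m) - m * (+ 2 * (r + Q * m) * (Q + 1ℤ) - (Q + 1ℤ) * (Q + 1ℤ) * m)
  isolate = solve-∀
  collect : ∀ k z Q m → + 2 + m * k - m * (+ 2 * z * (Q + 1ℤ) - (Q + 1ℤ) * (Q + 1ℤ) * m) ≡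
    + 2 + m * (k - + 2 * z * (Q + 1ℤ) + (Q + 1ℤ) * (Q + 1ℤ) * m)
  collect = solve-∀
  y²≡ : (+ m - + r) * (+ m - + r) ≡ + 2 + + m * K
  y²≡ = trans (isolate (+ r) Q (+ m))
    (trans (cong (λ z → z * z - + m * (+ 2 * (+ r + Q * + m) * (Q + 1ℤ) - (Q + 1ℤ) * (Q + 1ℤ) * + m)) (sym (ℤ.a≡a%ℕn+[a/ℕn]*n x m)))
    (trans (cong (_- + m * (+ 2 * (+ r + Q * + m) * (Q + 1ℤ) - (Q + 1ℤ) * (Q + 1ℤ) * + m)) x²≡) (collect k (+ r + Q * + m) Q (+ m))))

-- Descent: if y ≤ m is odd and y² = 2 + m j, then j < m, also j divides y² - 2, and m j ≡ 7 modulo 8.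
two-square-mod : ∀ m → Odd (+ m) → ∀ x k → x * x ≡ + 2 + + m * k → m % 8 ≡ 1 ⊎ m % 8 ≡ 7
two-square-mod = <-rec (λ m → Odd (+ m) → ∀ x k → x * x ≡ + 2 + + m * k → m % 8 ≡ 1 ⊎ m % 8 ≡ 7) step
  where
  step : ∀ m → (∀ {n} → n ℕ.< m → Odd (+ n) → ∀ x k → x * x ≡ + 2 + + n * k → n % 8 ≡ 1 ⊎ n % 8 ≡ 7) →
    Odd (+ m) → ∀ x k → x * x ≡ + 2 + + m * k → m % 8 ≡ 1 ⊎ m % 8 ≡ 7
  step zero        rec m-odd x k x²≡ = contradiction refl (odd-nonZero m-odd)
  step m@(suc m-1) rec m-odd x k x²≡ with odd-root m m-odd x k x²≡
  ... | zero  , y≤m , y-odd , _ = contradiction refl (odd-nonZero y-odd)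
  -- Here y² + m (j + 1) = 2 with y ≥ 1, which leaves only m = 1.
  ... | y@(suc y-1) , y≤m , y-odd , -[1+ j ] , y²≡ = inj₁ (cong (_% 8) (ℕ.≤-antisym m≤1 (s≤s z≤n)))
    where
    cancel : ∀ m j → + 2 + m * - j + m * j ≡ + 2
    cancel = solve-∀
    sum≡ : y ℕ.* y ℕ.+ m ℕ.* suc j ≡ 2
    sum≡ = ℤ.+-injective (trans (cong₂ _+_ (trans (ℤ.pos-* y y) y²≡) (ℤ.pos-* m (suc j))) (cancel (+ m) (+ suc j)))
    m≤1 : m ℕ.≤ 1
    m≤1 = ℕ.≤-trans (ℕ.m≤m*n m (suc j)) (ℕ.+-cancelˡ-≤ 1 (m ℕ.* suc j) 1 (ℕ.≤-trans (ℕ.+-monoˡ-≤ (m ℕ.* suc j) {1} {y ℕ.* y} (s≤s z≤n)) (ℕ.≤-reflexive sum≡)))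
  ... | y@(suc y-1) , y≤m , y-odd@(h , y≡) , + j , y²≡ = conclude (odd-square h) (rec j<m j-odd (+ y) (+ m) (trans y²≡ (cong (_+_ (+ 2)) (ℤ.*-comm (+ m) (+ j)))))
    where
    y²≡ℕ : y ℕ.* y ≡ 2 ℕ.+ m ℕ.* j
    y²≡ℕ = ℤ.+-injective (trans (ℤ.pos-* y y) (trans y²≡ (cong (_+_ (+ 2)) (sym (ℤ.pos-* m j)))))
    j<m : j ℕ.< m
    j<m = ℕ.*-cancelˡ-< m j m (ℕ.<-≤-trans (ℕ.m<n+m (m ℕ.* j) {2} (s≤s z≤n)) (ℕ.≤-trans (ℕ.≤-reflexive (sym y²≡ℕ)) (ℕ.*-mono-≤ y≤m y≤m)))
    isolate : ∀ m j t → + 2 + m * j ≡ 1ℤ + + 8 * t → m * j ≡ 1ℤ + + 8 * t - + 2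
    isolate m j t eq = trans (cancel (m * j)) (cong (_- + 2) eq)
      where
      cancel : ∀ z → z ≡ + 2 + z - + 2
      cancel = solve-∀
    mj≡ : ∀ t → (1ℤ + + 2 * h) * (1ℤ + + 2 * h) ≡ 1ℤ + + 8 * t → + m * + j ≡ 1ℤ + + 8 * t - + 2
    mj≡ t eq = isolate (+ m) (+ j) t (trans (sym y²≡) (trans (cong₂ _*_ y≡ y≡) eq))
    j-odd : Odd (+ j)
    j-odd = odd-factorˡ (+ j) (+ m) (let t , eq = odd-square h in
      + 4 * t - 1ℤ , trans (ℤ.*-comm (+ j) (+ m)) (trans (mj≡ t eq) (identity t)))
      where
      identity : ∀ t → 1ℤ + + 8 * t - + 2 ≡ 1ℤ + + 2 * (+ 4 * t - 1ℤ)
      identity = solve-∀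
    split₁ : ∀ m s → m ≡ m * (1ℤ + + 8 * s) - + 8 * (m * s)
    split₁ = solve-∀
    split₇ : ∀ m s → m ≡ + 8 * (m + m * s) - m * (+ 7 + + 8 * s)
    split₇ = solve-∀
    gather₁ : ∀ t z → 1ℤ + + 8 * t - + 2 - + 8 * z ≡ + 7 + + 8 * (t - z - 1ℤ)
    gather₁ = solve-∀
    gather₇ : ∀ t z → + 8 * z - (1ℤ + + 8 * t - + 2) ≡ 1ℤ + + 8 * (z - t)
    gather₇ = solve-∀
    conclude : (∃ λ t → (1ℤ + + 2 * h) * (1ℤ + + 2 * h) ≡ 1ℤ + + 8 * t) → j % 8 ≡ 1 ⊎ j % 8 ≡ 7 → m % 8 ≡ 1 ⊎ m % 8 ≡ 7
    conclude (t , eq) (inj₁ j%8≡1) = inj₂ (residue 8 (t - + m * + (j ℕ./ 8) - 1ℤ) (ℕ.n<1+n 7)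
      (trans (split₁ (+ m) (+ (j ℕ./ 8))) (trans (cong (λ z → + m * z - + 8 * (+ m * + (j ℕ./ 8))) (sym (quotient 8 {j} j%8≡1)))
        (trans (cong (_- + 8 * (+ m * + (j ℕ./ 8))) (mj≡ t eq)) (gather₁ t (+ m * + (j ℕ./ 8)))))))
    conclude (t , eq) (inj₂ j%8≡7) = inj₁ (residue 8 (+ m + + m * + (j ℕ./ 8) - t) (s≤s (s≤s z≤n))
      (trans (split₇ (+ m) (+ (j ℕ./ 8))) (trans (cong (λ z → + 8 * (+ m + + m * + (j ℕ./ 8)) - + m * z) (sym (quotient 8 {j} j%8≡7)))
        (trans (cong (λ z → + 8 * (+ m + + m * + (j ℕ./ 8)) - z) (mj≡ t eq)) (gather₇ t (+ m + + m * + (j ℕ./ 8)))))))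

-- Primes congruent to 3 modulo 8 as norms

odd≡±[1+4s] : ∀ a → Odd a → ∃ λ s → a * a ≡ (1ℤ + + 4 * s) * (1ℤ + + 4 * s)
odd≡±[1+4s] _ (h , refl) with parity h
... | isEven s = s , cong₂ _*_ (identity s) (identity s)
  where
  identity : ∀ s → 1ℤ + + 2 * (+ 2 * s) ≡ 1ℤ + + 4 * s
  identity = solve-∀
... | isOdd s = - s - 1ℤ , identity s
  where
  identity : ∀ s → (1ℤ + + 2 * (1ℤ + + 2 * s)) * (1ℤ + + 2 * (1ℤ + + 2 * s)) ≡ (1ℤ + + 4 * (- s - 1ℤ)) * (1ℤ + + 4 * (- s - 1ℤ))
  identity = solve-∀

-- Both a and b must be odd, and each is 1 + 4s up to sign: the shape of c and d in the elements
-- realising (8k + 5) N².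
normalise-signs : ∀ {m a b} → m % 8 ≡ 3 → + m ≡ norm a b → NormClass m a b → ∃ λ s → ∃ λ t → + m ≡ norm (1ℤ + + 4 * s) (1ℤ + + 4 * t)
normalise-signs m%8≡3 m≡ (evenNorm m-even) = ⊥-elim (even-odd-absurd m-even (%8≡3⇒odd m%8≡3))
normalise-signs m%8≡3 m≡ (oneModEight m%8≡1)   = contradiction (trans (sym m%8≡3) m%8≡1) λ ()
normalise-signs {a = a} {b} m%8≡3 m≡ (threeModEight _ a-odd b-odd) =
  let s , a²≡ = odd≡±[1+4s] a a-odd
      t , b²≡ = odd≡±[1+4s] b b-odd
  in s , t , trans m≡ (cong₂ (λ y z → y + + 2 * z) a²≡ b²≡)

prime₃-norm : ∀ {p} → Prime₃ p → ∃ λ s → ∃ λ t → + p ≡ norm (1ℤ + + 4 * s) (1ℤ + + 4 * t)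
prime₃-norm {p} (pr , p%8≡3) = conclude (fermat-two pr)
  where
  j u x : ℕ
  j = p ℕ./ 8
  -- With p = 8j + 3 these are u = 2^((p-1)/2) and x = 2^((p+1)/4), so that x² = 2u is ±2 modulo p.
  u = 2 ℕ.^ (4 ℕ.* j ℕ.+ 1)
  x = 2 ℕ.^ (2 ℕ.* j ℕ.+ 1)

  exponent₁ : ∀ j → 3 ℕ.+ j ℕ.* 8 ≡ 1 ℕ.+ ((4 ℕ.* j ℕ.+ 1) ℕ.+ (4 ℕ.* j ℕ.+ 1))
  exponent₁ = ℕ-Solver.solve-∀
  exponent₂ : ∀ j → (2 ℕ.* j ℕ.+ 1) ℕ.+ (2 ℕ.* j ℕ.+ 1) ≡ 1 ℕ.+ (4 ℕ.* j ℕ.+ 1)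
  exponent₂ = ℕ-Solver.solve-∀

  p≡ : p ≡ 3 ℕ.+ j ℕ.* 8
  p≡ = trans (ℕ.m≡m%n+[m/n]*n p 8) (cong (ℕ._+ j ℕ.* 8) p%8≡3)
  2^p≡ : 2 ℕ.^ p ≡ 2 ℕ.* (u ℕ.* u)
  2^p≡ = trans (cong (2 ℕ.^_) (trans p≡ (exponent₁ j))) (cong (2 ℕ.*_) (ℕ.^-distribˡ-+-* 2 (4 ℕ.* j ℕ.+ 1) (4 ℕ.* j ℕ.+ 1)))
  x²≡ : x ℕ.* x ≡ 2 ℕ.* u
  x²≡ = trans (sym (ℕ.^-distribˡ-+-* 2 (2 ℕ.* j ℕ.+ 1) (2 ℕ.* j ℕ.+ 1))) (cong (2 ℕ.^_) (exponent₂ j))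

  v : ℕ
  -- With u = v + 1 the product 2(u - 1)(u + 1) = 2^p - 2 is 2v(v + 2), free of truncated
  -- subtraction.
  v = ℕ.pred u
  u≡ : u ≡ suc v
  u≡ = sym (ℕ.suc-pred u {{ℕ.m^n≢0 2 (4 ℕ.* j ℕ.+ 1)}})

  p∤2 : ¬ p ℕ.∣ 2
  p∤2 p∣2 = contradiction (ℕ.≤-trans (ℕ.≤-reflexive (sym p≡)) (ℕ.∣⇒≤ p∣2)) λ { (s≤s (s≤s ())) }

  p∣product : (∃ λ y → 2 ℕ.^ p ≡ 2 ℕ.+ y ℕ.* p) → p ℕ.∣ 2 ℕ.* v ℕ.* (v ℕ.+ 2)
  p∣product (y , eq) = divides y (ℕ.+-cancelˡ-≡ 2 _ _ (trans (trans (sym (expand v)) (cong (λ u → 2 ℕ.* (u ℕ.* u)) (sym u≡))) (trans (sym 2^p≡) eq)))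
    where
    expand : ∀ v → 2 ℕ.* ((1 ℕ.+ v) ℕ.* (1 ℕ.+ v)) ≡ 2 ℕ.+ 2 ℕ.* v ℕ.* (v ℕ.+ 2)
    expand = ℕ-Solver.solve-∀

  two-not-square : ¬ p ℕ.∣ v
  two-not-square (divides z v≡) = impossible (two-square-mod p (%8≡3⇒odd p%8≡3) (+ x) (+ 2 * + z) square)
    where
    expand : ∀ v → 2 ℕ.* (1 ℕ.+ v) ≡ 2 ℕ.+ 2 ℕ.* v
    expand = ℕ-Solver.solve-∀
    rearrange : ∀ z p → + 2 * (z * p) ≡ p * (+ 2 * z)
    rearrange = solve-∀
    square : + x * + x ≡ + 2 + + p * (+ 2 * + z)
    square = trans (sym (ℤ.pos-* x x)) (trans (cong +_ (trans x²≡ (trans (cong (2 ℕ.*_) u≡) (expand v))))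
      (cong (_+_ (+ 2)) (trans (ℤ.pos-* 2 v) (trans (cong (λ w → + 2 * w) (trans (cong +_ v≡) (ℤ.pos-* z p))) (rearrange (+ z) (+ p))))))
    impossible : ¬ (p % 8 ≡ 1 ⊎ p % 8 ≡ 7)
    impossible (inj₁ p%8≡1) = contradiction (trans (sym p%8≡3) p%8≡1) λ ()
    impossible (inj₂ p%8≡7) = contradiction (trans (sym p%8≡3) p%8≡7) λ ()

  p∣x²+2 : p ℕ.∣ v ℕ.+ 2 → p ℕ.∣ x ℕ.* x ℕ.+ 2
  p∣x²+2 p∣v+2 = subst (p ℕ.∣_) (trans (expand v) (cong (ℕ._+ 2) (sym (trans x²≡ (cong (2 ℕ.*_) u≡))))) (ℕ.∣n⇒∣m*n 2 p∣v+2)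
    where
    expand : ∀ v → 2 ℕ.* (v ℕ.+ 2) ≡ 2 ℕ.* (1 ℕ.+ v) ℕ.+ 2
    expand = ℕ-Solver.solve-∀

  conclude : (∃ λ y → 2 ℕ.^ p ≡ 2 ℕ.+ y ℕ.* p) → ∃ λ s → ∃ λ t → + p ≡ norm (1ℤ + + 4 * s) (1ℤ + + 4 * t)
  conclude fermat with euclidsLemma (2 ℕ.* v) (v ℕ.+ 2) pr (p∣product fermat)
  ... | inj₂ p∣v+2 = let a , b , p≡norm = divisor-represented {p} {x} (p∣x²+2 p∣v+2) in normalise-signs p%8≡3 p≡norm (normClass p a b p≡norm)
  ... | inj₁ p∣2v with euclidsLemma 2 v pr p∣2v
  ...   | inj₁ p∣2 = contradiction p∣2 p∤2
  ...   | inj₂ p∣v = contradiction p∣v two-not-square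

-- The two directions of the theorem

even-outcome : ∀ {n} → Even n → Outcome n → (+ 1024) ∣ n
even-outcome n-even (multiple t n≡)     = Signed.∣⇒∣ᵤ (Signed.divides t (trans n≡ (ℤ.*-comm (+ 1024) t)))
even-outcome n-even (one t n≡)          = ⊥-elim (even-odd-absurd n-even (+ 4 * t , trans n≡ (cong (_+_ 1ℤ) (ℤ.*-assoc (+ 2) (+ 4) t))))
even-outcome n-even (five t _ _ _ n≡ _) = ⊥-elim (even-odd-absurd n-even (+ 2 + + 4 * t , trans n≡ (identity t)))
  where
  identity : ∀ t → + 5 + + 8 * t ≡ 1ℤ + + 2 * (+ 2 + + 4 * t)
  identity = solve-∀

1024-multiple-isIntGroupDet : ∀ {n} → (+ 1024) Signed.∣ n → IsIntGroupDet n
1024-multiple-isIntGroupDet (Signed.divides q n≡) =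
  subst IsIntGroupDet (trans (cong (+ 1024 *_) (cancel q)) (trans (ℤ.*-comm (+ 1024) q) (sym n≡))) (1024[k+1]-isIntGroupDet (q - 1ℤ))
  where
  cancel : ∀ q → q - 1ℤ + 1ℤ ≡ q
  cancel = solve-∀

∣-difference : ∀ {n} k r t → n ≡ r + k * t → k ∣ (n - r)
∣-difference k r t refl = Signed.∣⇒∣ᵤ (Signed.divides t (identity k r t))
  where
  identity : ∀ k r t → r + k * t - r ≡ t * k
  identity = solve-∀

difference-∣ : ∀ n k r → k Signed.∣ (n - r) → ∃ λ t → n ≡ r + k * t
difference-∣ n k r (Signed.divides t n-r≡) = t , trans (cancel n r) (cong (_+_ r) (trans n-r≡ (ℤ.*-comm t k)))
  where
  cancel : ∀ n r → n ≡ r + (n - r)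
  cancel = solve-∀

Exceptional : ℤ → Set
Exceptional n = ∃[ m ] ∃[ p ] ((+ 8) ∣ (m - + 5) × Prime p × p % 8 ≡ 3 × n ≡ m * ((+ p) * (+ p)))

-- The cofactor of p² is m q²; its residue comes from n itself, as p² ≡ 1 (mod 8) gives m q² ≡ n ≡
-- 5.
exceptional : ∀ {n N} t m p q h s → n ≡ + 5 + + 8 * t → n ≡ m * (N * N) → Prime₃ p → N ≡ q * + p →
  + p ≡ 1ℤ + + 2 * h → (1ℤ + + 2 * h) * (1ℤ + + 2 * h) ≡ 1ℤ + + 8 * s → Exceptional n
exceptional {n} t m p q h s n≡5+8t n≡mN² (pr , p%8≡3) N≡ p≡ p²≡ =
  m * (q * q) , p , ∣-difference (+ 8) (+ 5) (t - m * (q * q) * s) m′≡ , pr , p%8≡3 , n≡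
  where
  regroup : ∀ m q p → m * (q * p * (q * p)) ≡ m * (q * q) * (p * p)
  regroup = solve-∀
  n≡ : n ≡ m * (q * q) * (+ p * + p)
  n≡ = trans n≡mN² (trans (cong (λ N → m * (N * N)) N≡) (regroup m q (+ p)))
  isolate : ∀ m s → m ≡ m * (1ℤ + + 8 * s) - + 8 * (m * s)
  isolate = solve-∀
  collect : ∀ t z → + 5 + + 8 * t - + 8 * z ≡ + 5 + + 8 * (t - z)
  collect = solve-∀
  m′≡ : m * (q * q) ≡ + 5 + + 8 * (t - m * (q * q) * s)
  m′≡ = trans (isolate (m * (q * q)) s)
    (trans (cong (λ z → m * (q * q) * z - + 8 * (m * (q * q) * s)) (sym (trans (cong₂ _*_ p≡ p≡) p²≡)))
    (trans (cong (_- + 8 * (m * (q * q) * s)) (trans (sym n≡) n≡5+8t)) (collect t (m * (q * q) * s))))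

odd-outcome : ∀ {n} → ¬ ((+ 2) ∣ n) → Outcome n → (+ 8) ∣ (n - + 1) ⊎ ((+ 8) ∣ (n - + 5) × Exceptional n)
odd-outcome 2∤n (multiple t n≡) = ⊥-elim (2∤n (Signed.∣⇒∣ᵤ (Signed.divides (+ 512 * t)
  (trans n≡ (trans (ℤ.*-assoc (+ 2) (+ 512) t) (ℤ.*-comm (+ 2) (+ 512 * t)))))))
odd-outcome 2∤n (one t n≡) = inj₁ (∣-difference (+ 8) (+ 1) t n≡)
odd-outcome {n} 2∤n (five t m c d n≡5+8t n≡mN²) = inj₂ (∣-difference (+ 8) (+ 5) t n≡5+8t ,
  conclude (norm-prime₃-factor (1ℤ + + 2 * c) (1ℤ + + 2 * d) (c , refl) (d , refl)))
  where
  conclude : (∃ λ p → Prime₃ p × ∃ λ q → norm (1ℤ + + 2 * c) (1ℤ + + 2 * d) ≡ q * + p) → Exceptional n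
  conclude (p , prime₃ , q , N≡) = let h , p≡ = %8≡3⇒odd (proj₂ prime₃) ; s , p²≡ = odd-square h in
    exceptional t m p q h s n≡5+8t n≡mN² prime₃ N≡ p≡ p²≡

8k+1-isIntGroupDet : ∀ {n t} → Parity t → n ≡ + 1 + + 8 * t → IsIntGroupDet n
8k+1-isIntGroupDet (isEven k) n≡ = subst IsIntGroupDet (sym (trans n≡ (identity k))) (16k+1-isIntGroupDet k)
  where
  identity : ∀ k → + 1 + + 8 * (+ 2 * k) ≡ 1ℤ + + 16 * k
  identity = solve-∀
8k+1-isIntGroupDet (isOdd k) n≡ = subst IsIntGroupDet (sym (trans n≡ (identity k))) (16k+9-isIntGroupDet k)
  where
  identity : ∀ k → + 1 + + 8 * (1ℤ + + 2 * k) ≡ + 9 + + 16 * k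
  identity = solve-∀

-- Varying k moves 1 + 2 g(1) in steps of 16, so each class modulo 8 is put together from two
-- families.
[8k+5]N²-isIntGroupDet : ∀ {m u p} s t → Parity u → m ≡ + 5 + + 8 * u → p ≡ norm (1ℤ + + 4 * s) (1ℤ + + 4 * t) →
  IsIntGroupDet (m * (p * p))
[8k+5]N²-isIntGroupDet s t (isEven k) m≡ p≡ =
  subst IsIntGroupDet (sym (cong₂ (λ m p → m * (p * p)) (trans m≡ (identity k)) p≡)) ([16k+5]N²-isIntGroupDet k s t)
  where
  identity : ∀ k → + 5 + + 8 * (+ 2 * k) ≡ + 5 + + 16 * k
  identity = solve-∀
[8k+5]N²-isIntGroupDet s t (isOdd k) m≡ p≡ =
  subst IsIntGroupDet (sym (cong₂ (λ m p → m * (p * p)) (trans m≡ (identity k)) p≡)) ([16k+13]N²-isIntGroupDet k s t)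
  where
  identity : ∀ k → + 5 + + 8 * (1ℤ + + 2 * k) ≡ + 13 + + 16 * k
  identity = solve-∀

exceptional-isIntGroupDet : ∀ {n} → Exceptional n → IsIntGroupDet n
exceptional-isIntGroupDet (m , p , 8∣m-5 , pr , p%8≡3 , n≡) =
  let s , t , p≡ = prime₃-norm (pr , p%8≡3)
      u , m≡ = difference-∣ m (+ 8) (+ 5) (Signed.∣ᵤ⇒∣ 8∣m-5)
  in subst IsIntGroupDet (sym n≡) ([8k+5]N²-isIntGroupDet s t (parity u) m≡ p≡)

mainTheorem1 : (n : ℤ) →
    ((+ 2) ∣ n → (IsIntGroupDet n ⇔ (+ 1024) ∣ n))
    × (¬ ((+ 2) ∣ n) →
    (IsIntGroupDet n ⇔
    ((+ 8) ∣ (n - + 1)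
    ⊎ ((+ 8) ∣ (n - + 5)
    × ∃[ m ] ∃[ p ] ((+ 8) ∣ (m - + 5) × Prime p × p % 8 ≡ 3
    × n ≡ m * ((+ p) * (+ p)))))))
mainTheorem1 n =
  (λ 2∣n → mk⇔ (λ (a , eq) → even-outcome (2∣⇒even (Signed.∣ᵤ⇒∣ 2∣n)) (subst Outcome eq (groupDet-outcome a)))
               (λ 1024∣n → 1024-multiple-isIntGroupDet (Signed.∣ᵤ⇒∣ 1024∣n))) ,
  (λ 2∤n → mk⇔ (λ (a , eq) → odd-outcome 2∤n (subst Outcome eq (groupDet-outcome a))) realize)
  where
  2∣⇒even : (+ 2) Signed.∣ n → Even n
  2∣⇒even (Signed.divides q n≡) = q , trans n≡ (ℤ.*-comm q (+ 2))
  realize : (+ 8) ∣ (n - + 1) ⊎ ((+ 8) ∣ (n - + 5) × Exceptional n) → IsIntGroupDet n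
  realize (inj₁ 8∣n-1)     = let t , n≡ = difference-∣ n (+ 8) (+ 1) (Signed.∣ᵤ⇒∣ 8∣n-1) in 8k+1-isIntGroupDet (parity t) n≡
  realize (inj₂ (_ , exc)) = exceptional-isIntGroupDet exc
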